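{- Let $G$ be a graph and let $f$ be a positive integer-valued function on $V(G)$. If for every $S\subseteq V(G)$, $$\tfrac{1}{2}\Omega_2(G\setminus S)\le \sum_{v\in S}\big(f(v)-\tfrac{3}{2}\big)+1+\tfrac{1}{2}\Omega_2(G[S]),$$ then $G$ has a spanning closed trail meeting each vertex $v$ at most $f(v)$ times.
   Context: Graphs are finite, loopless, and may have multiple edges. A graph is $m$-tree-connected if it contains $m$ pairwise edge-disjoint spanning trees (a one-vertex graph is $m$-tree-connected). The $m$-tree-connected components of $G$ are its maximal induced $m$-tree-connected subgraphs; their vertex sets partition $V(G)$. For a partition $P$ of $V(G)$, $e_G(P)$ is the number of edges with ends in different parts. $\Omega_m(G)=m|P|-e_G(P)$ for $P$ the partition into vertex sets of the $m$-tree-connected components (and $\Omega_m=0$ for the graph with no vertices). $G[S]$ is the induced subgraph on $S$ and $G\setminus S$ is obtained by deleting $S$. A spanning closed trail meeting each vertex $v$ at most $f(v)$ times is a closed trail passing through every vertex and through each vertex $v$ at most $f(v)$ times. -}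

module Defs where

open import Data.Nat as ℕ using (ℕ; zero; suc)
open import Data.Integer as ℤ using (ℤ)
open import Data.Fin using (Fin; _≟_)
open import Data.Fin.Subset using (Subset; _∈_; _⊆_; ∁; Nonempty)
open import Data.Bool using (Bool; true; false; if_then_else_; _∧_)
open import Data.Vec using (tabulate; lookup)
open import Data.Maybe using (Maybe; just)
open import Data.List using (List; []; _∷_; map; filter; length; allFin; foldr)
open import Data.List.Relation.Unary.Unique.Propositional using (Unique)
open import Data.List.Membership.Propositional using () renaming (_∈_ to _∈ₗ_)
open import Data.Product using (Σ; _×_; _,_; proj₁; proj₂)
open import Data.Sum using (_⊎_)
open import Relation.Binary.PropositionalEquality using (_≡_; _≢_)
open import Relation.Nullary using (¬_)
open import Relation.Nullary.Decidable using (⌊_⌋; ¬?)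

record Graph : Set where
  field
    nV       : ℕ
    nE       : ℕ
    ends     : Fin nE → Fin nV × Fin nV
    loopless : (e : Fin nE) → proj₁ (ends e) ≢ proj₂ (ends e)
open Graph public

module _ (G : Graph) where

  Joins : Fin (nE G) → Fin (nV G) → Fin (nV G) → Set
  Joins e u w = (ends G e ≡ (u , w)) ⊎ (ends G e ≡ (w , u))

  data Reach (P : Fin (nE G) → Set) : Fin (nV G) → Fin (nV G) → Set where
    here : ∀ {u} → Reach P u u
    step : ∀ {u w v} (e : Fin (nE G)) → P e → Joins e u w → Reach P w v → Reach P u v

  InsideE : Subset (nV G) → Fin (nE G) → Set
  InsideE X e = (proj₁ (ends G e) ∈ X) × (proj₂ (ends G e) ∈ X)

  -- The edge set T (a predicate on edges) is a spanning tree of G[X]: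
  -- all its edges lie in G[X], it is connected on X, and it is acyclic
  -- (every edge of T is a bridge of T).
  IsSpanningTree : Subset (nV G) → (Fin (nE G) → Set) → Set
  IsSpanningTree X T =
      ((e : Fin (nE G)) → T e → InsideE X e)
    × ((u v : Fin (nV G)) → u ∈ X → v ∈ X → Reach T u v)
    × ((e : Fin (nE G)) → T e →
         ¬ Reach (λ e′ → T e′ × e′ ≢ e) (proj₁ (ends G e)) (proj₂ (ends G e)))

  -- G[X] is m-tree-connected: m pairwise edge-disjoint spanning trees,
  -- given by an assignment of each edge to at most one tree.
  TreeConnected : ℕ → Subset (nV G) → Set
  TreeConnected m X =
    Σ (Fin (nE G) → Maybe (Fin m)) λ c →
      (i : Fin m) → IsSpanningTree X (λ e → c e ≡ just i)

  IsComponent : ℕ → Subset (nV G) → Subset (nV G) → Set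
  IsComponent m W X =
      X ⊆ W × Nonempty X × TreeConnected m X
    × ((Y : Subset (nV G)) → X ⊆ Y → Y ⊆ W → TreeConnected m Y → Y ⊆ X)

  -- A representative function r for the partition of W into the vertex sets
  -- of the m-tree-connected components of G[W]: the class of v ∈ W is
  -- { u ∈ W | r u ≡ r v }, each class is a component, and r picks a
  -- representative inside the class.
  classOf : Subset (nV G) → (Fin (nV G) → Fin (nV G)) → Fin (nV G) → Subset (nV G)
  classOf W r v = tabulate (λ u → lookup W u ∧ ⌊ r u ≟ r v ⌋)

  IsComponentRep : ℕ → Subset (nV G) → (Fin (nV G) → Fin (nV G)) → Set
  IsComponentRep m W r =
    (v : Fin (nV G)) → v ∈ W →
      (r v ∈ W) × (r (r v) ≡ r v) × IsComponent m W (classOf W r v)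

  numParts : Subset (nV G) → (Fin (nV G) → Fin (nV G)) → ℕ
  numParts W r = length (filter (λ v → ⌊ r v ≟ v ⌋ Data.Bool.≟ true)
                                (filter (λ v → lookup W v Data.Bool.≟ true) (allFin (nV G))))

  crossEdges : Subset (nV G) → (Fin (nV G) → Fin (nV G)) → ℕ
  crossEdges W r = length (filter (λ e →
      (lookup W (proj₁ (ends G e)) ∧ lookup W (proj₂ (ends G e))
        ∧ Data.Bool.not ⌊ r (proj₁ (ends G e)) ≟ r (proj₂ (ends G e)) ⌋) Data.Bool.≟ true)
      (allFin (nE G)))

  -- Ω_m(G[W]) = m|P| − e_{G[W]}(P), computed from a valid representative function
  Ω : ℕ → Subset (nV G) → (Fin (nV G) → Fin (nV G)) → ℤ
  Ω m W r = ℤ.+ (m ℕ.* numParts W r) ℤ.- ℤ.+ crossEdges W r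

  -- Σ_{v ∈ S} (2 f(v) − 3)  (twice Σ_{v∈S}(f(v) − 3/2))
  sumS : Subset (nV G) → (Fin (nV G) → ℕ) → ℤ
  sumS S f = foldr ℤ._+_ ℤ.0ℤ (map (λ v → if lookup S v then ℤ.+ (2 ℕ.* f v) ℤ.- ℤ.+ 3 else ℤ.0ℤ)
                      (allFin (nV G)))

  data WalkFrom : Fin (nV G) → List (Fin (nE G) × Fin (nV G)) → Fin (nV G) → Set where
    stop : ∀ {u} → WalkFrom u [] u
    go   : ∀ {u w z rest} (e : Fin (nE G)) → Joins e u w →
           WalkFrom w rest z → WalkFrom u ((e , w) ∷ rest) z

  -- the cyclic sequence of vertex-visits of a closed walk (the start vertex
  -- is visited once by the trivial trail; otherwise the visits are v₁ … v_k
  -- with v_k = v₀)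
  visits : Fin (nV G) → List (Fin (nE G) × Fin (nV G)) → List (Fin (nV G))
  visits s [] = s ∷ []
  visits s (x ∷ xs) = map proj₂ (x ∷ xs)

  timesMet : Fin (nV G) → List (Fin (nE G) × Fin (nV G)) → Fin (nV G) → ℕ
  timesMet s st v = length (filter (λ u → u ≟ v) (visits s st))

  SpanningClosedTrail : (Fin (nV G) → ℕ) → Set
  SpanningClosedTrail f =
    Σ (Fin (nV G)) λ s → Σ (List (Fin (nE G) × Fin (nV G))) λ st →
        WalkFrom s st s
      × Unique (map proj₁ st)
      × ((v : Fin (nV G)) → v ∈ₗ visits s st)
      × ((v : Fin (nV G)) → timesMet s st v ℕ.≤ f v)

{-# OPTIONS --safe #-}
module Submission where

-- Call an edge set H sparse if every nonempty vertex set X spans at most 2|X| − 2 edges of H,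
-- and X tight if equality holds.  Intersecting tight sets are closed under ∪ and ∩, so sparse sets
-- obey a matroid exchange theory, and an induction splitting off a vertex of degree at most 3 shows
-- that tight sets are exactly those carrying two edge-disjoint spanning trees.  Hence the
-- 2-tree-connected components of G[W] are the maximal tight sets of a maximal sparse edge set of
-- G[W], and Ω₂(G[W]) is 2|W| minus its number of edges.
--
-- The hypothesis at S = ∅ gives a sparse H for which the whole vertex set is tight.  Choose such an H
-- minimising the total excess of its degrees over h = 2f + 1.  Starting from W = V, remove from W, one
-- at a time, vertices whose degree cannot be pushed below max (h, deg H) by changing H inside a tight
-- subset of W.  In the end H is maximal in G[W] and all degrees outside W are at least h; if some
-- degree exceeded h, counting edges would contradict the hypothesis at S = V \ W.  So deg H ≤ 2f + 1.
--
-- Two disjoint spanning trees of H yield a connected spanning subgraph D of H with even degrees: add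
-- to the first tree the symmetric difference of suitable paths in the second.  A closed trail in D
-- that visits all vertices meets v at most ⌊(2 f v + 1) / 2⌋ = f v times.

open import Defs
open import Data.Nat as ℕ using (ℕ; zero; suc; _+_; _*_; _∸_; _⊔_; _≤_; _<_; z≤n; s≤s; _≤?_; _<?_)
open import Data.Nat.Properties hiding (_≟_; _≤?_; _<?_)
open import Data.Nat.ListAction using (sum)
open import Data.Nat.Tactic.RingSolver using (solve-∀)
open import Data.Integer as ℤ using (ℤ)
import Data.Integer.Properties as ℤ
open import Data.Integer.Tactic.RingSolver renaming (solve-∀ to solveℤ-∀)
open import Data.Fin using (Fin; zero; suc; _≟_)
open import Data.Fin.Properties using (any?; all?)
open import Data.Fin.Subset using (Subset; ∁) renaming (_∈_ to _∈ₛ_; _⊆_ to _⊆ₛ_)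
open import Data.Fin.Subset.Properties using (anySubset?)
open import Data.Bool using (Bool; true; false; _∧_; _∨_; not; _xor_; if_then_else_)
import Data.Bool.Properties as Bool
open import Data.Vec using (lookup; tabulate)
open import Data.Vec.Properties using (lookup∘tabulate; lookup-map; []=⇒lookup; lookup⇒[]=)
open import Data.Maybe using (Maybe; just; nothing)
open import Data.Maybe.Properties using (just-injective; ≡-dec)
import Data.List as List
open import Data.List using (List; []; _∷_; map; _++_; filter; length; allFin)
open import Data.List.Properties using (filter-≐; map-++; length-++)
open import Data.List.Membership.Propositional using (_∈_; _∉_)
open import Data.List.Membership.Propositional.Properties using (∈-filter⁺; ∈-filter⁻; ∈-allFin)
import Data.List.Membership.DecPropositional as DecMembership
open import Data.List.Relation.Unary.Any using (here; there)
open import Data.List.Relation.Unary.All as All using (All; []; _∷_)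
open import Data.List.Relation.Unary.All.Properties using (¬Any⇒All¬)
open import Data.List.Relation.Unary.AllPairs using ([]; _∷_)
open import Data.List.Relation.Unary.Unique.Propositional using (Unique)
import Data.List.Relation.Binary.Permutation.Setoid.Properties as Permutation
open import Data.Product using (∃; _×_; _,_; proj₁; proj₂)
open import Data.Sum using (_⊎_; inj₁; inj₂)
open import Data.Empty using (⊥; ⊥-elim)
open import Function using (_∘_)
open import Relation.Nullary using (¬_; Dec; yes; no; contradiction)
open import Relation.Nullary.Decidable
  using (⌊_⌋; from-yes; decidable-stable; map′; ¬?; _×-dec_; _→-dec_; dec-true; dec-false; isYes≗does)
open import Relation.Binary.PropositionalEquality
open import Algebra.Properties.CommutativeMonoid.Sum +-0-commutativeMonoid
  using (sum-cong-≗; ∑-distrib-+; ∑-comm) renaming (sum to Σsum)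

-- The threshold 2f + 1 is forced from both sides. An even degree at most 2f + 1 is at most 2f, so
-- the extra unit is free. In the count over S = V - W, the degrees of H on S sum to e_H(S) + |H| -
-- e_H(W), where |H| = 2|V| - 2, e_H(W) = 2|W| - Ω₂(G[W]) and e_H(S) ≤ 2|S| - Ω₂(G[S]). Degrees of
-- at least 2f + 1 on S, one of them larger, give Ω₂(G[W]) > Σ(2f + 1 - 4) + 2 + Ω₂(G[S]), and 1 - 4
-- is the -3 of the doubled hypothesis.
--
-- The obstacle is the maximality of H in G[W]. Let e = xy be an edge of G[W] outside H. The degrees
-- of x and y can each be pushed down by a local change; if the two changes live in disjoint tight
-- sets, both are made at once, which leaves room for e at both ends. Suppose the tight set Q closed
-- by e contains removed vertices, and let z be the first of them to be removed. Trading e for an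
-- edge at z then pushes z down as well, inside the vertex set from which z was removed as
-- immovable: a contradiction. So Q stays in W and, with the two local sets, blocks e. This is why
-- changes are confined to tight sets and vertices leave one at a time.

private variable
  n m : ℕ

-- Exhaustive search, descent and Boolean reasoning

-- Together with `from-yes` this settles a Boolean identity by evaluating its truth table.
∀Bool? : {P : Bool → Set} → (∀ b → Dec (P b)) → Dec (∀ b → P b)
∀Bool? P? = map′ (λ { (t , f) true → t ; (t , f) false → f })
                 (λ h → h true , h false) (P? true ×-dec P? false)

opaque
  -- Sets are Boolean functions throughout, and finite search runs over bit vectors. The tabulated
  -- function agrees with the given one only pointwise, hence the condition `resp`.
  anyFun? : {P : (Fin n → Bool) → Set} → (∀ {X Y} → X ≗ Y → P X → P Y) →
            (∀ X → Dec (P X)) → Dec (∃ P)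
  anyFun? resp P? =
    map′ (λ (X , p) → lookup X , p)
         (λ (X , p) → tabulate X , resp (sym ∘ lookup∘tabulate X) p)
         (anySubset? (λ X → P? (lookup X)))

  -- The constructive form of "choose a minimal one": either the goal already holds at `a` or
  -- something of smaller measure is produced. Every extremal choice and every greedy growth in the
  -- proof goes through it.
  iterate : {A : Set} {Q : A → Set} (μ : A → ℕ) →
            (∀ a → Q a ⊎ ∃ λ b → μ b < μ a) → A → ∃ Q
  iterate {A} {Q} μ improve a = iter (suc (μ a)) a ≤-refl
    where
    iter : ∀ k a → μ a < k → ∃ Q
    iter (suc k) a (s≤s a≤k) with improve a
    ... | inj₁ q = a , q
    ... | inj₂ (b , b<a) = iter k b (≤-trans b<a a≤k)

-- Linear arithmetic by certificate: `a ≤ b` is the sum of the known inequalities, and the ring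
-- identity says that the goal is this sum after cancellation.
certify : ∀ {a b} l r → a ≤ b → l + b ≡ r + a → l ≤ r
certify {a} {b} l r a≤b eq = +-cancelʳ-≤ a l r (≤-trans (+-monoʳ-≤ l a≤b) (≤-reflexive eq))

∧-intro : ∀ {a b} → a ≡ true → b ≡ true → a ∧ b ≡ true
∧-intro refl refl = refl

∧-elim : ∀ {a b} → a ∧ b ≡ true → a ≡ true × b ≡ true
∧-elim {true} {true} _ = refl , refl

∨-introˡ : ∀ {a b} → a ≡ true → a ∨ b ≡ true
∨-introˡ refl = refl

∨-introʳ : ∀ {a b} → b ≡ true → a ∨ b ≡ true
∨-introʳ {true} refl = refl
∨-introʳ {false} refl = refl

∨-elim : ∀ {a b} → a ∨ b ≡ true → a ≡ true ⊎ b ≡ true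
∨-elim {true} _ = inj₁ refl
∨-elim {false} p = inj₂ p

not-true : ∀ {a} → not a ≡ true → a ≡ false
not-true {false} _ = refl

not≡true : ∀ {a} → ¬ a ≡ true → a ≡ false
not≡true {true} p = ⊥-elim (p refl)
not≡true {false} _ = refl

true≢false : ∀ {a} → a ≡ true → a ≡ false → ⊥
true≢false refl ()

⌊⌋-intro : {P : Set} (d : Dec P) → P → ⌊ d ⌋ ≡ true
⌊⌋-intro d p = trans (isYes≗does d) (dec-true d p)

⌊⌋-elim : {P : Set} (d : Dec P) → ⌊ d ⌋ ≡ true → P
⌊⌋-elim (yes p) _ = p

≟-true : ∀ {i j : Fin n} → i ≡ j → ⌊ i ≟ j ⌋ ≡ true
≟-true {i = i} {j} p = trans (isYes≗does (i ≟ j)) (dec-true (i ≟ j) p)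

≟-false : ∀ {i j : Fin n} → i ≢ j → ⌊ i ≟ j ⌋ ≡ false
≟-false {i = i} {j} p = trans (isYes≗does (i ≟ j)) (dec-false (i ≟ j) p)

≟-≡ : ∀ {i j : Fin n} → ⌊ i ≟ j ⌋ ≡ true → i ≡ j
≟-≡ {i = i} {j} p with i ≟ j
... | yes q = q

≟-≢ : ∀ {i j : Fin n} → ⌊ i ≟ j ⌋ ≡ false → i ≢ j
≟-≢ {i = i} {j} p with i ≟ j
... | no q = q

≟-sym : ∀ (i j : Fin n) → ⌊ i ≟ j ⌋ ≡ ⌊ j ≟ i ⌋
≟-sym i j with i ≟ j
... | yes refl = sym (≟-true {i = i} refl)
... | no p = sym (≟-false (p ∘ sym))

-- Finite sums, weights and cardinalities of Boolean sets

infixr 7 _▷_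
_▷_ : Bool → ℕ → ℕ
true  ▷ k = k
false ▷ k = 0

ind : Bool → ℕ
ind b = b ▷ 1

ind≤1 : ∀ b → ind b ≤ 1
ind≤1 true = ≤-refl
ind≤1 false = z≤n

ind-pos : ∀ {b} → 0 < ind b → b ≡ true
ind-pos {true} _ = refl

ind-mono : ∀ {a b} → (a ≡ true → b ≡ true) → ind a ≤ ind b
ind-mono {true} h rewrite h refl = ≤-refl
ind-mono {false} h = z≤n

▷-mono : ∀ {a b k l} → (a ≡ true → b ≡ true) → k ≤ l → a ▷ k ≤ b ▷ l
▷-mono {true} h k≤l rewrite h refl = k≤l
▷-mono {false} h k≤l = z≤n

opaque
  ∑ : (Fin n → ℕ) → ℕ
  ∑ = Σsum

  ∑-empty : (f : Fin 0 → ℕ) → ∑ f ≡ 0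
  ∑-empty f = refl

  ∑-suc : (f : Fin (suc n) → ℕ) → ∑ f ≡ f zero + ∑ (f ∘ suc)
  ∑-suc f = refl

  ∑-cong : {f g : Fin n → ℕ} → f ≗ g → ∑ f ≡ ∑ g
  ∑-cong = sum-cong-≗

  ∑-+ : (f g : Fin n → ℕ) → ∑ (λ i → f i + g i) ≡ ∑ f + ∑ g
  ∑-+ = ∑-distrib-+

  ∑-swap : (f : Fin m → Fin n → ℕ) → ∑ (λ i → ∑ (f i)) ≡ ∑ (λ j → ∑ λ i → f i j)
  ∑-swap = ∑-comm

  ∑-mono : {f g : Fin n → ℕ} → (∀ i → f i ≤ g i) → ∑ f ≤ ∑ g
  ∑-mono {zero} h = z≤n
  ∑-mono {suc n} h = +-mono-≤ (h zero) (∑-mono (h ∘ suc))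

  ∑-mono-< : {f g : Fin n → ℕ} → (∀ i → f i ≤ g i) → ∀ i → f i < g i → ∑ f < ∑ g
  ∑-mono-< h zero p = +-mono-<-≤ p (∑-mono (h ∘ suc))
  ∑-mono-< h (suc i) p = +-mono-≤-< (h zero) (∑-mono-< (h ∘ suc) i p)

  ∑-zero : {f : Fin n → ℕ} → (∀ i → f i ≡ 0) → ∑ f ≡ 0
  ∑-zero {zero} h = refl
  ∑-zero {suc n} h rewrite h zero = ∑-zero (h ∘ suc)

  ∑-witness : {f g : Fin n → ℕ} → ∑ f < ∑ g → ∃ λ i → f i < g i
  ∑-witness {suc n} {f} {g} p with f zero <? g zero
  ... | yes q = zero , q
  ... | no q with ∑-witness (+-cancelˡ-< (f zero) _ _ (≤-trans p (+-monoˡ-≤ _ (≮⇒≥ q))))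
  ... | i , r = suc i , r

  ∑-term : (f : Fin n → ℕ) → ∀ i → f i ≤ ∑ f
  ∑-term f zero = m≤m+n _ _
  ∑-term f (suc i) = ≤-trans (∑-term (f ∘ suc) i) (m≤n+m _ _)

  ∑-const : ∀ n k → ∑ {n} (λ _ → k) ≡ n * k
  ∑-const zero k = refl
  ∑-const (suc n) k = cong (k +_) (∑-const n k)

  ∑-delta : (a : Fin n) (w : Fin n → ℕ) → ∑ (λ i → ⌊ i ≟ a ⌋ ▷ w i) ≡ w a
  ∑-delta {suc n} zero w = trans (cong (w zero +_) (∑-zero {n} {λ i → 0} λ i → refl)) (+-identityʳ _)
  ∑-delta (suc a) w =
    trans (∑-cong λ i → cong (_▷ w (suc i)) (shift i)) (∑-delta a (w ∘ suc))
    where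
    shift : ∀ i → ⌊ suc i ≟ suc a ⌋ ≡ ⌊ i ≟ a ⌋
    shift i = trans (isYes≗does (suc i ≟ suc a)) (sym (isYes≗does (i ≟ a)))

  ∑-scale : ∀ k (f : Fin n → ℕ) → ∑ (λ i → k * f i) ≡ k * ∑ f
  ∑-scale {zero} k f = sym (*-zeroʳ k)
  ∑-scale {suc n} k f = trans (cong (k * f zero +_) (∑-scale k (f ∘ suc))) (sym (*-distribˡ-+ k _ _))

  ▷-∑ : ∀ b (f : Fin n → ℕ) → b ▷ ∑ f ≡ ∑ (λ i → b ▷ f i)
  ▷-∑ true f = refl
  ▷-∑ {n} false f = sym (∑-zero {f = λ (_ : Fin n) → 0} λ _ → refl)

▷-0 : ∀ a b → a ▷ 0 ≡ b ▷ 0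
▷-0 = from-yes (∀Bool? λ a → ∀Bool? λ b → a ▷ 0 ℕ.≟ b ▷ 0)

wt : (Fin m → Bool) → (Fin m → ℕ) → ℕ
wt H w = ∑ λ e → H e ▷ w e

card : (Fin n → Bool) → ℕ
card X = wt X λ _ → 1

_∪_ _∩_ : (Fin n → Bool) → (Fin n → Bool) → Fin n → Bool
(X ∪ Y) v = X v ∨ Y v
(X ∩ Y) v = X v ∧ Y v

∁ᵇ : (Fin n → Bool) → Fin n → Bool
∁ᵇ X v = not (X v)

single : Fin n → Fin n → Bool
single a v = ⌊ v ≟ a ⌋

add del : (Fin n → Bool) → Fin n → Fin n → Bool
add H e g = ⌊ g ≟ e ⌋ ∨ H g
del H e g = not ⌊ g ≟ e ⌋ ∧ H g

infix 4 _⊑_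
_⊑_ : (Fin n → Bool) → (Fin n → Bool) → Set
X ⊑ Y = ∀ v → X v ≡ true → Y v ≡ true

⊑-refl : {X : Fin n → Bool} → X ⊑ X
⊑-refl v p = p

⊑-trans : {X Y Z : Fin n → Bool} → X ⊑ Y → Y ⊑ Z → X ⊑ Z
⊑-trans p q v = q v ∘ p v

∪-⊑ : {X Y Z : Fin n → Bool} → X ⊑ Z → Y ⊑ Z → X ∪ Y ⊑ Z
∪-⊑ p q v xy with ∨-elim xy
... | inj₁ x = p v x
... | inj₂ y = q v y

⊑-∪ʳ : {X Y : Fin n → Bool} → Y ⊑ X ∪ Y
⊑-∪ʳ v = ∨-introʳ

∁-⊑ : {X Y : Fin n → Bool} → X ⊑ Y → ∁ᵇ Y ⊑ ∁ᵇ X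
∁-⊑ {X = X} {Y} h v q with X v in eq
... | false = refl
... | true rewrite h v eq = q

add-self : (H : Fin n → Bool) (e : Fin n) → add H e e ≡ true
add-self H e = ∨-introˡ (≟-true {i = e} refl)

del-⊑ : {H : Fin n → Bool} {e : Fin n} → del H e ⊑ H
del-⊑ v = proj₂ ∘ ∧-elim

del-≢ : {H : Fin n → Bool} {e v : Fin n} → del H e v ≡ true → v ≢ e
del-≢ p = ≟-≢ (not-true (proj₁ (∧-elim p)))

del-intro : {H : Fin n → Bool} {e v : Fin n} → v ≢ e → H v ≡ true → del H e v ≡ true
del-intro p q rewrite ≟-false p = q

add-other : {H : Fin n → Bool} {e v : Fin n} → v ≢ e → add H e v ≡ H v
add-other p rewrite ≟-false p = refl

del-other : {H : Fin n → Bool} {e v : Fin n} → v ≢ e → del H e v ≡ H v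
del-other p rewrite ≟-false p = refl

wt-cong : {H H′ : Fin m → Bool} {w : Fin m → ℕ} → H ≗ H′ → wt H w ≡ wt H′ w
wt-cong {w = w} p = ∑-cong λ e → cong (_▷ w e) (p e)

wt-congʷ : {H : Fin m → Bool} {w w′ : Fin m → ℕ} → w ≗ w′ → wt H w ≡ wt H w′
wt-congʷ {H = H} p = ∑-cong λ e → cong (H e ▷_) (p e)

wt-mono : {H H′ : Fin m → Bool} {w w′ : Fin m → ℕ} → H ⊑ H′ → (∀ e → w e ≤ w′ e) →
          wt H w ≤ wt H′ w′
wt-mono p q = ∑-mono λ e → ▷-mono (p e) (q e)

wt-add : {H : Fin m → Bool} {e : Fin m} (w : Fin m → ℕ) → H e ≡ false →
         wt (add H e) w ≡ w e + wt H w
wt-add {H = H} {e} w p = begin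
  wt (add H e) w                                  ≡⟨ ∑-cong pointwise ⟩
  ∑ (λ g → ⌊ g ≟ e ⌋ ▷ w g + H g ▷ w g)          ≡⟨ ∑-+ _ _ ⟩
  ∑ (λ g → ⌊ g ≟ e ⌋ ▷ w g) + wt H w             ≡⟨ cong (_+ wt H w) (∑-delta e w) ⟩
  w e + wt H w                                    ∎
  where
  open ≡-Reasoning
  pointwise : ∀ g → add H e g ▷ w g ≡ ⌊ g ≟ e ⌋ ▷ w g + H g ▷ w g
  pointwise g with g ≟ e
  ... | yes refl rewrite p = sym (+-identityʳ _)
  ... | no _ = refl

wt-del : {H : Fin m → Bool} {e : Fin m} (w : Fin m → ℕ) → H e ≡ true →
         w e + wt (del H e) w ≡ wt H w
wt-del {H = H} {e} w p = begin
  w e + wt (del H e) w     ≡⟨ wt-add w (cong (λ b → not b ∧ H e) (≟-true refl)) ⟨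
  wt (add (del H e) e) w   ≡⟨ wt-cong restore ⟩
  wt H w                   ∎
  where
  open ≡-Reasoning
  restore : add (del H e) e ≗ H
  restore g with g ≟ e
  ... | yes refl = sym p
  ... | no _ = refl

card-pos : {X : Fin n → Bool} {v : Fin n} → X v ≡ true → 1 ≤ card X
card-pos {X = X} {v} p = subst (_≤ card X) (cong (_▷ 1) p) (∑-term (ind ∘ X) v)

card-single : (a : Fin n) → card (single a) ≡ 1
card-single a = ∑-delta a λ _ → 1

card-∪-∩ : (X Y : Fin n → Bool) → card X + card Y ≡ card (X ∪ Y) + card (X ∩ Y)
card-∪-∩ X Y = trans (sym (∑-+ _ _)) (trans
  (∑-cong λ v → from-yes (∀Bool? λ a → ∀Bool? λ b → ind a + ind b ℕ.≟ ind (a ∨ b) + ind (a ∧ b)) (X v) (Y v))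
  (∑-+ _ _))

card-∁ : (X : Fin n → Bool) → card X + card (∁ᵇ X) ≡ n
card-∁ {n} X = trans (sym (∑-+ _ _)) (trans
  (∑-cong λ v → from-yes (∀Bool? λ a → ind a + ind (not a) ℕ.≟ 1) (X v))
  (trans (∑-const n 1) (*-identityʳ n)))

card-mono-< : {X Y : Fin n → Bool} → X ⊑ Y → ∀ {v} → X v ≡ false → Y v ≡ true → card X < card Y
card-mono-< {X = X} {Y} h {v} p q = ∑-mono-< (λ u → ▷-mono (h u) ≤-refl) v lemma
  where
  lemma : ind (X v) < ind (Y v)
  lemma rewrite p | q = ≤-refl

⊑? : (X Y : Fin n → Bool) → X ⊑ Y ⊎ ∃ λ v → X v ≡ true × Y v ≡ false
⊑? {zero} X Y = inj₁ λ ()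
⊑? {suc n} X Y with X zero in p | Y zero in q | ⊑? (X ∘ suc) (Y ∘ suc)
... | true | false | _ = inj₂ (zero , p , q)
... | _ | _ | inj₂ (v , r) = inj₂ (suc v , r)
... | false | _ | inj₁ h = inj₁ λ { zero x → ⊥-elim (true≢false x p) ; (suc v) → h v }
... | true | true | inj₁ h = inj₁ λ { zero x → q ; (suc v) → h v }

infixr 5 _⊕_
_⊕_ : ∀ {a b c d} → a ≤ b → c ≤ d → a + c ≤ b + d
_⊕_ = +-mono-≤

-- Sparse edge sets and tight vertex sets

-- The defect `2|X| - e(X)` is submodular. If two sets have defect at most 2 and one of their union
-- and intersection has defect at least 2, the other has defect at most 2. The arithmetic is
-- symmetric in `u` and `i`, so it serves both unions and intersections.
uncross-tight : ∀ cx cy cu ci {ex ey eu ei} → ex + ey ≤ eu + ei → cx + cy ≡ cu + ci →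
  2 * cx ≤ ex + 2 → 2 * cy ≤ ey + 2 → ei + 2 ≤ 2 * ci → 2 * cu ≤ eu + 2
uncross-tight cx cy cu ci {ex} {ey} {eu} {ei} e c x y i =
  certify _ _ (e ⊕ x ⊕ y ⊕ i ⊕ ≤-reflexive (sym (cong (2 *_) c))) (eq ex ey eu ei cx cy cu ci)
  where
  eq : ∀ ex ey eu ei cx cy cu ci →
    2 * cu + (eu + ei + (ex + 2 + (ey + 2 + (2 * ci + 2 * (cx + cy))))) ≡
    eu + 2 + (ex + ey + (2 * cx + (2 * cy + (ei + 2 + 2 * (cu + ci)))))
  eq = solve-∀

-- The same submodular inequality solved for the defect of the first set, which is bounded below
-- through a tight second set.
uncross-sparse : ∀ cx cy cu ci {ex ey eu ei} → ex + ey ≤ eu + ei → cx + cy ≡ cu + ci →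
  2 * cy ≤ ey + 2 → eu + 2 ≤ 2 * cu → ei + 2 ≤ 2 * ci → ex + 2 ≤ 2 * cx
uncross-sparse cx cy cu ci {ex} {ey} {eu} {ei} e c y u i =
  certify _ _ (e ⊕ y ⊕ u ⊕ i ⊕ ≤-reflexive (sym (cong (2 *_) c))) (eq ex ey eu ei cx cy cu ci)
  where
  eq : ∀ ex ey eu ei cx cy cu ci →
    ex + 2 + (eu + ei + (ey + 2 + (2 * cu + (2 * ci + 2 * (cx + cy))))) ≡
    2 * cx + (ex + ey + (2 * cy + (eu + 2 + (ei + 2 + 2 * (cu + ci)))))
  eq = solve-∀

-- The theory is stated for a bare map `ends`, loops allowed, because splitting off a vertex changes
-- the ends of an edge while its label stays. Sparsity itself keeps loops out.
module Count {n m : ℕ} (ends : Fin m → Fin n × Fin n) where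

  src tgt : Fin m → Fin n
  src = proj₁ ∘ ends
  tgt = proj₂ ∘ ends

  within : (Fin n → Bool) → Fin m → Bool
  within X e = X (src e) ∧ X (tgt e)

  edges : (Fin m → Bool) → (Fin n → Bool) → ℕ
  edges H X = wt H λ e → ind (within X e)

  inc : Fin n → Fin m → ℕ
  inc v e = ind ⌊ src e ≟ v ⌋ + ind ⌊ tgt e ≟ v ⌋

  deg : (Fin m → Bool) → Fin n → ℕ
  deg H v = wt H (inc v)

  Sparse : (Fin m → Bool) → Set
  Sparse H = ∀ X v → X v ≡ true → edges H X + 2 ≤ 2 * card X

  record Tight (H : Fin m → Bool) (X : Fin n → Bool) : Set where
    constructor tight
    field
      nonempty  : ∃ λ v → X v ≡ true
      saturated : 2 * card X ≤ edges H X + 2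

  Linked : (Fin m → Bool) → (Fin n → Bool) → Fin n → Fin n → Set
  Linked H W x y = ∃ λ X → Tight H X × X ⊑ W × X x ≡ true × X y ≡ true

  within-mono : ∀ {X Y} → X ⊑ Y → within X ⊑ within Y
  within-mono h e p with ∧-elim p
  ... | a , b = ∧-intro (h _ a) (h _ b)

  edges-cong : ∀ {H H′ X X′} → H ≗ H′ → X ≗ X′ → edges H X ≡ edges H′ X′
  edges-cong {H} {H′} p q = trans (wt-cong p)
    (wt-congʷ {H = H′} λ e → cong ind (cong₂ _∧_ (q (src e)) (q (tgt e))))

  edges-mono : ∀ {H H′ X X′} → H ⊑ H′ → X ⊑ X′ → edges H X ≤ edges H′ X′
  edges-mono p q = wt-mono p λ e → ind-mono (within-mono q e)

  sparse-⊑ : ∀ {H H′} → H ⊑ H′ → Sparse H′ → Sparse H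
  sparse-⊑ p s X v q = ≤-trans (+-monoˡ-≤ 2 (edges-mono p (⊑-refl {X = X}))) (s X v q)

  -- An edge inside both sets lies inside the intersection and the union. Edges between the two
  -- differences lie only inside the union and account for the inequality.
  edges-supermodular : ∀ H X Y → edges H X + edges H Y ≤ edges H (X ∪ Y) + edges H (X ∩ Y)
  edges-supermodular H X Y = begin
    edges H X + edges H Y  ≡⟨ ∑-+ _ _ ⟨
    ∑ (λ e → H e ▷ ind (within X e) + H e ▷ ind (within Y e))
      ≤⟨ ∑-mono (λ e → pointwise (H e) (X (src e)) (X (tgt e)) (Y (src e)) (Y (tgt e))) ⟩
    ∑ (λ e → H e ▷ ind (within (X ∪ Y) e) + H e ▷ ind (within (X ∩ Y) e))
      ≡⟨ ∑-+ _ _ ⟩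
    edges H (X ∪ Y) + edges H (X ∩ Y) ∎
    where
    open ≤-Reasoning
    pointwise : ∀ h a b c d → h ▷ ind (a ∧ b) + h ▷ ind (c ∧ d) ≤
                h ▷ ind ((a ∨ c) ∧ (b ∨ d)) + h ▷ ind ((a ∧ c) ∧ (b ∧ d))
    pointwise = from-yes (∀Bool? λ h → ∀Bool? λ a → ∀Bool? λ b → ∀Bool? λ c → ∀Bool? λ d →
      h ▷ ind (a ∧ b) + h ▷ ind (c ∧ d) ≤? h ▷ ind ((a ∨ c) ∧ (b ∨ d)) + h ▷ ind ((a ∧ c) ∧ (b ∧ d)))

  module _ {H : Fin m → Bool} (sparse : Sparse H) where

    tight-∪ : ∀ {X Y} → Tight H X → Tight H Y → ∀ {v} → X v ≡ true → Y v ≡ true → Tight H (X ∪ Y)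
    tight-∪ {X} {Y} (tight _ tX) (tight _ tY) {v} p q = tight (v , ∨-introˡ p)
     (uncross-tight (card X) (card Y) (card (X ∪ Y)) (card (X ∩ Y)) (edges-supermodular H X Y) (card-∪-∩ X Y) tX tY (sparse (X ∩ Y) v (∧-intro p q)))

    tight-∩ : ∀ {X Y} → Tight H X → Tight H Y → ∀ {v} → X v ≡ true → Y v ≡ true → Tight H (X ∩ Y)
    tight-∩ {X} {Y} (tight _ tX) (tight _ tY) {v} p q = tight (v , ∧-intro p q)
     (uncross-tight (card X) (card Y) (card (X ∩ Y)) (card (X ∪ Y)) (subst (edges H X + edges H Y ≤_) (+-comm (edges H (X ∪ Y)) _) (edges-supermodular H X Y))
        (trans (card-∪-∩ X Y) (+-comm (card (X ∪ Y)) _)) tX tY (sparse (X ∪ Y) v (∨-introˡ p)))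

    tight-edges : ∀ {X} → Tight H X → edges H X + 2 ≡ 2 * card X
    tight-edges (tight (v , p) t) = ≤-antisym (sparse _ v p) t

  tight-single : ∀ {H} a → Tight H (single a)
  tight-single {H} a = tight (a , ≟-true {i = a} refl)
    (subst (λ k → 2 * k ≤ edges H (single a) + 2) (sym (card-single a)) (m≤n+m 2 _))

  tight-resp : ∀ {H H′ X Y} → H ≗ H′ → X ≗ Y → Tight H X → Tight H′ Y
  tight-resp q p (tight (v , x) t) = tight (v , trans (sym (p v)) x)
    (subst₂ (λ a b → 2 * a ≤ b + 2) (wt-cong p) (edges-cong q p) t)

  ⊑-resp : ∀ {X Y W : Fin n → Bool} → X ≗ Y → X ⊑ W → Y ⊑ W
  ⊑-resp p h v y = h v (trans (p v) y)

  ⊑-dec : ∀ (X W : Fin n → Bool) → Dec (X ⊑ W)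
  ⊑-dec X W = all? λ v → (X v Bool.≟ true) →-dec (W v Bool.≟ true)

  opaque
    tight? : ∀ H X → Dec (Tight H X)
    tight? H X = map′ (λ (p , t) → tight p t) (λ (tight p t) → p , t) (any? (λ v → X v Bool.≟ true) ×-dec (2 * card X ≤? edges H X + 2))

    linked? : ∀ H W x y → Dec (Linked H W x y)
    linked? H W x y = anyFun?
      (λ p (t , s , a , b) → tight-resp (λ _ → refl) p t , ⊑-resp p s , trans (sym (p x)) a , trans (sym (p y)) b)
      (λ X → tight? H X ×-dec ⊑-dec X W ×-dec (X x Bool.≟ true) ×-dec (X y Bool.≟ true))

    sparse? : ∀ H → Dec (Sparse H)
    sparse? H = map′
      (λ h X v p → ≮⇒≥ λ q → h (X , (v , p) , q))
      (λ s (X , (v , p) , q) → <⇒≱ q (s X v p))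
      (¬? (anyFun? {P = λ X → (∃ λ v → X v ≡ true) × 2 * card X < edges H X + 2}
        (λ p ((v , x) , t) → (v , trans (sym (p v)) x) ,
          subst₂ (λ a b → 2 * a < b + 2) (wt-cong p) (edges-cong {H} {H} (λ _ → refl) p) t)
        λ X → any? (λ v → X v Bool.≟ true) ×-dec (2 * card X <? edges H X + 2)))
  
  -- The vertex set of the circuit that an edge `xy` closes in the sparsity matroid.
  Minimal : (Fin m → Bool) → Fin n → Fin n → (Fin n → Bool) → Set
  Minimal H x y Q = Tight H Q × Q x ≡ true × Q y ≡ true ×
    (∀ Y → Tight H Y → Y x ≡ true → Y y ≡ true → Q ⊑ Y)

  minimal-tight : ∀ {H} → Sparse H → ∀ {x y X} → Tight H X → X x ≡ true → X y ≡ true →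
                  ∃ (Minimal H x y)
  minimal-tight {H} sparse {x} {y} {X} t p q =
    let (Q , t , p , q) , h = iterate {Q = λ (Q , _) → ∀ Y → Tight H Y → Y x ≡ true → Y y ≡ true → Q ⊑ Y}
          (λ (Q , _) → card Q) improve (X , t , p , q)
    in Q , t , p , q , h
    where
    Candidate : Set
    Candidate = ∃ λ Q → Tight H Q × Q x ≡ true × Q y ≡ true
    improve : (c : Candidate) → (∀ Y → Tight H Y → Y x ≡ true → Y y ≡ true → proj₁ c ⊑ Y) ⊎
              ∃ λ (d : Candidate) → card (proj₁ d) < card (proj₁ c)
    improve (Q , t , p , q)
      with anyFun? {P = λ Y → Tight H Y × Y x ≡ true × Y y ≡ true × card (Q ∩ Y) < card Q}
        (λ r (t , a , b , l) → tight-resp (λ _ → refl) r t , trans (sym (r x)) a , trans (sym (r y)) b ,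
          subst (_< card Q) (wt-cong λ v → cong (Q v ∧_) (r v)) l)
        (λ Y → tight? H Y ×-dec (Y x Bool.≟ true) ×-dec (Y y Bool.≟ true) ×-dec (card (Q ∩ Y) <? card Q))
    ... | yes (Y , tY , a , b , l) = inj₂ ((Q ∩ Y , tight-∩ sparse t tY p a , ∧-intro p a , ∧-intro q b) , l)
    ... | no none = inj₁ λ Y tY a b → below Y tY a b (⊑? Q Y)
      where
      below : ∀ Y → Tight H Y → Y x ≡ true → Y y ≡ true → Q ⊑ Y ⊎ _ → Q ⊑ Y
      below Y tY a b (inj₁ h) = h
      below Y tY a b (inj₂ (v , r , s)) = ⊥-elim (none (Y , tY , a , b ,
        card-mono-< (λ u → proj₁ ∘ ∧-elim) (subst (λ c → c ∧ Y v ≡ false) (sym r) s) r))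

  -- Only a tight set containing both ends of `e` becomes too full when `e` is added. Such a set
  -- contains `Q` by minimality, hence also `f`, whose removal restores its count.
  sparse-exchange : ∀ {H} → Sparse H → ∀ {e f Q} → H e ≡ false → H f ≡ true →
                    Minimal H (src e) (tgt e) Q → within Q f ≡ true → Sparse (del (add H e) f)
  sparse-exchange {H} sparse {e} {f} {Q} e∉H f∈H (_ , _ , _ , minimal) f∈Q X v p = bound (within X e) refl
    where
    H′ = del (add H e) f
    change : ind (within X f) + edges H′ X ≡ ind (within X e) + edges H X
    change = trans (wt-del (λ g → ind (within X g)) (∨-introʳ f∈H)) (wt-add (λ g → ind (within X g)) e∉H)
    bound : ∀ b → within X e ≡ b → edges H′ X + 2 ≤ 2 * card X
    bound false q = ≤-trans (+-monoˡ-≤ 2 (≤-trans (m≤n+m _ (ind (within X f)))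
      (≤-reflexive (trans change (cong (λ b → ind b + edges H X) q))))) (sparse X v p)
    bound true q with 2 * card X ≤? edges H X + 2
    ... | no loose = ≤-trans (+-monoˡ-≤ 2 (≤-trans (m≤n+m _ (ind (within X f)))
      (≤-reflexive (trans change (cong (λ b → ind b + edges H X) q))))) (≰⇒> loose)
    ... | yes t = subst (λ k → k + 2 ≤ 2 * card X) (sym (suc-injective (begin
        suc (edges H′ X)                  ≡⟨ cong (λ b → ind b + edges H′ X) (within-mono Q⊑X f f∈Q) ⟨
        ind (within X f) + edges H′ X     ≡⟨ change ⟩
        ind (within X e) + edges H X      ≡⟨ cong (λ b → ind b + edges H X) q ⟩
        suc (edges H X)                   ∎))) (sparse X v p)
      where
      open ≡-Reasoning
      Q⊑X : Q ⊑ X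
      Q⊑X = minimal X (tight (v , p) t) (proj₁ (∧-elim q)) (proj₂ (∧-elim q))

  splice : (A B : Fin m → Bool) → (Fin n → Bool) → Fin m → Bool
  splice A B Y e = if within Y e then B e else A e

  wt-splice : ∀ A B Y (w : Fin m → ℕ) → wt (splice A B Y) w + wt (λ e → A e ∧ within Y e) w ≡
              wt A w + wt (λ e → B e ∧ within Y e) w
  wt-splice A B Y w = trans (sym (∑-+ _ _)) (trans (∑-cong pointwise) (∑-+ _ _))
    where
    pointwise : ∀ e → splice A B Y e ▷ w e + (A e ∧ within Y e) ▷ w e ≡ A e ▷ w e + (B e ∧ within Y e) ▷ w e
    pointwise e with within Y e | A e | B e
    ... | true | true | true = refl
    ... | true | true | false = sym (+-identityʳ _)
    ... | true | false | true = +-identityʳ _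
    ... | true | false | false = refl
    ... | false | true | true = refl
    ... | false | true | false = refl
    ... | false | false | true = refl
    ... | false | false | false = refl

  wt-within : ∀ A Y X → Y ⊑ X → wt (λ e → A e ∧ within Y e) (λ e → ind (within X e)) ≡ edges A Y
  wt-within A Y X h = ∑-cong pointwise
    where
    pointwise : ∀ e → (A e ∧ within Y e) ▷ ind (within X e) ≡ A e ▷ ind (within Y e)
    pointwise e with A e | within Y e in q
    ... | false | _ = refl
    ... | true | false = refl
    ... | true | true rewrite within-mono h e q = refl

  edges-splice-⊒ : ∀ A B {Y X} → Y ⊑ X → edges B Y ≡ edges A Y → edges (splice A B Y) X ≡ edges A X
  edges-splice-⊒ A B {Y} {X} h eq = +-cancelʳ-≡ (edges A Y) _ _ (begin
    edges (splice A B Y) X + edges A Y  ≡⟨ cong (edges (splice A B Y) X +_) (wt-within A Y X h) ⟨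
    _                                   ≡⟨ wt-splice A B Y _ ⟩
    _                                   ≡⟨ cong (edges A X +_) (trans (wt-within B Y X h) eq) ⟩
    edges A X + edges A Y               ∎)
    where open ≡-Reasoning

  edges-splice-⊑ : ∀ A B {Y X} → X ⊑ Y → edges (splice A B Y) X ≡ edges B X
  edges-splice-⊑ A B {Y} {X} h = ∑-cong pointwise
    where
    pointwise : ∀ e → splice A B Y e ▷ ind (within X e) ≡ B e ▷ ind (within X e)
    pointwise e with within X e in q
    ... | true rewrite within-mono h e q = refl
    ... | false = ▷-0 (splice A B Y e) (B e)

  edges-splice-disjoint : ∀ A B {Y X} → (∀ v → X v ≡ true → Y v ≡ true → ⊥) →
                          edges (splice A B Y) X ≡ edges A X
  edges-splice-disjoint A B {Y} {X} disjoint = ∑-cong pointwise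
    where
    pointwise : ∀ e → splice A B Y e ▷ ind (within X e) ≡ A e ▷ ind (within X e)
    pointwise e with within Y e in q | within X e in r
    ... | false | _ = refl
    ... | true | true = ⊥-elim (disjoint (src e) (proj₁ (∧-elim r)) (proj₁ (∧-elim q)))
    ... | true | false = ▷-0 (B e) (A e)

  -- A set `Z` meeting `Y` is uncrossed with `Y`: the union spans as many edges as in `A`, the
  -- intersection spans only edges of `B`, and `Y` is tight for the spliced set too. Sets missing
  -- `Y` see only `A`.
  sparse-splice : ∀ {A B Y} → Sparse A → Tight A Y → Sparse B → edges B Y ≡ edges A Y →
                  Sparse (splice A B Y)
  sparse-splice {A} {B} {Y} sA (tight _ t) sB eq Z v p with any? (λ u → (Z u ∧ Y u) Bool.≟ true)
  ... | no none = subst (λ k → k + 2 ≤ 2 * card Z)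
    (sym (edges-splice-disjoint A B {Y} {Z} λ u a b → none (u , ∧-intro a b))) (sA Z v p)
  ... | yes (u , q) = uncross-sparse (card Z) (card Y) (card (Z ∪ Y)) (card (Z ∩ Y)) (edges-supermodular C Z Y) (card-∪-∩ Z Y)
    (subst (λ k → 2 * card Y ≤ k + 2) (sym (trans (edges-splice-⊑ A B {Y} {Y} ⊑-refl) eq)) t)
    (subst (λ k → k + 2 ≤ 2 * card (Z ∪ Y)) (sym (edges-splice-⊒ A B {Y} {Z ∪ Y} (⊑-∪ʳ {X = Z}) eq))
      (sA (Z ∪ Y) u (∨-introˡ (proj₁ (∧-elim {Z u} q)))))
    (subst (λ k → k + 2 ≤ 2 * card (Z ∩ Y)) (sym (edges-splice-⊑ A B {Y} {Z ∩ Y} λ w → proj₂ ∘ ∧-elim {Z w}))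
      (sB (Z ∩ Y) u q))
    where C = splice A B Y

  sparse-loopless : ∀ {H} → Sparse H → ∀ {e} → H e ≡ true → src e ≢ tgt e
  sparse-loopless {H} sparse {e} h loop with ≤-trans (+-monoˡ-≤ 2 one)
    (subst (λ k → edges H X + 2 ≤ 2 * k) (card-single (src e)) (sparse X (src e) (≟-true {i = src e} refl)))
    where
    X = single (src e)
    one : 1 ≤ edges H X
    one = subst (_≤ edges H X) (cong₂ (λ a b → a ▷ ind b) h (∧-intro (≟-true {i = src e} refl) (≟-true (sym loop))))
      (∑-term (λ g → H g ▷ ind (within X g)) e)
  ... | s≤s (s≤s ())

  -- Each edge counts once for every end in `X`. Adding the edges avoiding `X` makes the identity
  -- free of subtraction and of any term for edges leaving `X`.
  ∑-deg : ∀ H X → ∑ (λ v → X v ▷ deg H v) + edges H (∁ᵇ X) ≡ edges H X + wt H (λ _ → 1)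
  ∑-deg H X = begin
    ∑ (λ v → X v ▷ deg H v) + edges H (∁ᵇ X)
      ≡⟨ cong (_+ edges H (∁ᵇ X)) (trans (∑-cong λ v → ▷-∑ (X v) _) (∑-swap _)) ⟩
    ∑ (λ e → ∑ λ v → X v ▷ H e ▷ inc v e) + edges H (∁ᵇ X)
      ≡⟨ ∑-+ _ _ ⟨
    ∑ (λ e → ∑ (λ v → X v ▷ H e ▷ inc v e) + H e ▷ ind (within (∁ᵇ X) e))
      ≡⟨ ∑-cong pointwise ⟩
    ∑ (λ e → H e ▷ ind (within X e) + H e ▷ 1)
      ≡⟨ ∑-+ _ _ ⟩
    edges H X + wt H (λ _ → 1) ∎
    where
    open ≡-Reasoning
    shuffle : ∀ h x a b → x ▷ h ▷ (ind a + ind b) ≡ a ▷ h ▷ ind x + b ▷ h ▷ ind x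
    shuffle = from-yes (∀Bool? λ h → ∀Bool? λ x → ∀Bool? λ a → ∀Bool? λ b →
      x ▷ h ▷ (ind a + ind b) ℕ.≟ a ▷ h ▷ ind x + b ▷ h ▷ ind x)
    final : ∀ h x y → (h ▷ ind x + h ▷ ind y) + h ▷ ind (not x ∧ not y) ≡ h ▷ ind (x ∧ y) + h ▷ 1
    final = from-yes (∀Bool? λ h → ∀Bool? λ x → ∀Bool? λ y →
      (h ▷ ind x + h ▷ ind y) + h ▷ ind (not x ∧ not y) ℕ.≟ h ▷ ind (x ∧ y) + h ▷ 1)
    pointwise : ∀ e → ∑ (λ v → X v ▷ H e ▷ inc v e) + H e ▷ ind (within (∁ᵇ X) e) ≡
                H e ▷ ind (within X e) + H e ▷ 1
    pointwise e = trans (cong (_+ H e ▷ ind (within (∁ᵇ X) e)) (begin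
      ∑ (λ v → X v ▷ H e ▷ inc v e)
        ≡⟨ ∑-cong (λ v → trans (shuffle (H e) (X v) ⌊ src e ≟ v ⌋ ⌊ tgt e ≟ v ⌋)
             (cong₂ _+_ (cong (_▷ H e ▷ ind (X v)) (≟-sym (src e) v)) (cong (_▷ H e ▷ ind (X v)) (≟-sym (tgt e) v)))) ⟩
      ∑ (λ v → ⌊ v ≟ src e ⌋ ▷ H e ▷ ind (X v) + ⌊ v ≟ tgt e ⌋ ▷ H e ▷ ind (X v))
        ≡⟨ ∑-+ _ _ ⟩
      _ ≡⟨ cong₂ _+_ (∑-delta (src e) λ v → H e ▷ ind (X v)) (∑-delta (tgt e) λ v → H e ▷ ind (X v)) ⟩
      H e ▷ ind (X (src e)) + H e ▷ ind (X (tgt e)) ∎)) (final (H e) (X (src e)) (X (tgt e)))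

-- A set that becomes too full was tight before and contains the new edge. Two end maps occur
-- because a lifted edge reuses the label `e`; as `e` is not in `H`, its old ends do not matter to
-- `H`.
sparse-add : ∀ {ends ends′ : Fin m → Fin n × Fin n} {H e} → (∀ g → g ≢ e → ends′ g ≡ ends g) →
  H e ≡ false → Count.Sparse ends H →
  (∀ X → Count.Tight ends H X → Count.within ends′ X e ≡ false) → Count.Sparse ends′ (add H e)
sparse-add {ends = ends} {ends′} {H} {e} same e∉H sparse loose X v p = bound (C′.within X e) refl
  where
  module C = Count ends
  module C′ = Count ends′
  agree : ∀ g → H g ▷ ind (C′.within X g) ≡ H g ▷ ind (C.within X g)
  agree g with g ≟ e
  ... | yes refl rewrite e∉H = refl
  ... | no g≢e = cong (λ (a , b) → H g ▷ ind (X a ∧ X b)) (same g g≢e)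
  change : C′.edges (add H e) X ≡ ind (C′.within X e) + C.edges H X
  change = trans (wt-add (λ g → ind (C′.within X g)) e∉H) (cong (ind (C′.within X e) +_) (∑-cong agree))
  bound : ∀ b → C′.within X e ≡ b → C′.edges (add H e) X + 2 ≤ 2 * card X
  bound false q rewrite change | q = sparse X v p
  bound true q with 2 * card X ≤? C.edges H X + 2
  ... | yes t = ⊥-elim (true≢false q (loose X (C.tight (v , p) t)))
  ... | no ¬t rewrite change | q = ≰⇒> ¬t

-- Splitting off vertices: tight sets carry two disjoint connected spanning subgraphs

-- Connectivity is stated through two-colourings rather than paths: in this form it passes
-- through liftings and contractions by evaluating the colouring at the new edges.
Connects : (Fin m → Fin n × Fin n) → (Fin m → Set) → (Fin n → Bool) → Set
Connects {n = n} ends T X = ∀ (p : Fin n → Bool) → (∀ e → T e → p (proj₁ (ends e)) ≡ p (proj₂ (ends e))) →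
  ∀ u v → X u ≡ true → X v ≡ true → p u ≡ p v

-- The colouring `c` makes the two classes disjoint. Acyclicity is not carried along: for a tight
-- set it follows afterwards by counting edges.
TwoConnections : (Fin m → Fin n × Fin n) → (Fin m → Bool) → (Fin n → Bool) → Set
TwoConnections {m} ends H X = ∃ λ (c : Fin m → Bool) → ∀ b → Connects ends (λ e → H e ≡ true × c e ≡ b) X

card-add-≤ : (X : Fin n → Bool) (v : Fin n) → card (add X v) ≤ 1 + card X
card-add-≤ X v with X v in p
... | false = ≤-reflexive (wt-add (λ _ → 1) p)
... | true = ≤-trans (≤-reflexive (wt-cong same)) (n≤1+n _)
  where
  same : add X v ≗ X
  same u with u ≟ v
  ... | yes refl = sym p
  ... | no _ = refl

module _ {n m : ℕ} {ends : Fin m → Fin n × Fin n} where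
  open Count ends

  EndsAt : Fin m → Fin n → Fin n → Set
  EndsAt e v a = (src e ≡ v × tgt e ≡ a) ⊎ (src e ≡ a × tgt e ≡ v)

  ends-const : ∀ {e v a} → EndsAt e v a → (p : Fin n → Bool) → p (src e) ≡ p (tgt e) → p v ≡ p a
  ends-const (inj₁ (refl , refl)) p q = q
  ends-const (inj₂ (refl , refl)) p q = sym q

  ends-within : ∀ {e v a} → EndsAt e v a → ∀ X → X v ≡ true → X a ≡ true → within X e ≡ true
  ends-within (inj₁ (refl , refl)) X p q = ∧-intro p q
  ends-within (inj₂ (refl , refl)) X p q = ∧-intro q p

  edges-all : ∀ {H X} → (∀ e → H e ≡ true → within X e ≡ true) → edges H X ≡ wt H λ _ → 1
  edges-all {H} {X} inside = ∑-cong pointwise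
    where
    pointwise : ∀ e → H e ▷ ind (within X e) ≡ H e ▷ 1
    pointwise e with H e in q
    ... | true rewrite inside e q = refl
    ... | false = refl

  peel : ∀ {H v d} → (∀ e → H e ≡ true → src e ≢ tgt e) → deg H v ≡ suc d →
         ∃ λ e → H e ≡ true × (∃ λ a → EndsAt e v a) × deg (del H e) v ≡ d
  peel {H} {v} {d} loop-free eq with ∑-witness {f = λ _ → 0} {λ e → H e ▷ inc v e}
    (subst₂ _<_ (sym (∑-zero {f = λ (_ : Fin m) → 0} λ _ → refl)) (sym eq) (s≤s z≤n))
  ... | e , pos with H e in h | src e ≟ v in p | tgt e ≟ v in q
  ... | true | yes refl | yes s = ⊥-elim (loop-free e h (sym s))
  ... | true | yes refl | no t≢v = e , h , (tgt e , inj₁ (refl , refl)) ,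
    suc-injective (trans (cong (_+ deg (del H e) v) (sym one)) (trans (wt-del (inc v) h) eq))
    where
    one : inc v e ≡ 1
    one rewrite p | ≟-false t≢v = refl
  ... | true | no s≢v | yes refl = e , h , (src e , inj₂ (refl , refl)) ,
    suc-injective (trans (cong (_+ deg (del H e) v) (sym one)) (trans (wt-del (inc v) h) eq))
    where
    one : inc v e ≡ 1
    one rewrite q | ≟-false s≢v = refl

  module _ {H : Fin m → Bool} {X : Fin n → Bool} (sparse : Sparse H) (saturated : Tight H X)
           (inside : ∀ e → H e ≡ true → within X e ≡ true) where

    -- The degrees over `X` sum to twice `2|X| - 2`, which is less than `4|X|`.
    low-degree : ∃ λ v → X v ≡ true × deg H v < 4
    low-degree with ∑-witness {f = λ v → X v ▷ deg H v} {λ v → X v ▷ 4} small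
      where
      degrees : ∑ (λ v → X v ▷ deg H v) ≤ edges H X + edges H X
      degrees = ≤-trans (m≤m+n _ (edges H (∁ᵇ X)))
        (≤-reflexive (trans (∑-deg H X) (cong (edges H X +_) (sym (edges-all {H} {X} inside)))))
      fours : ∑ (λ v → X v ▷ 4) ≡ 4 * card X
      fours = trans (∑-cong λ v → quadruple (X v)) (∑-scale 4 λ v → X v ▷ 1)
        where
        quadruple : ∀ b → b ▷ 4 ≡ 4 * (b ▷ 1)
        quadruple true = refl
        quadruple false = refl
      small : ∑ (λ v → X v ▷ deg H v) < ∑ (λ v → X v ▷ 4)
      small = subst (∑ (λ v → X v ▷ deg H v) <_) (sym fours) (≤-trans
        (s≤s (≤-trans degrees (m≤n+m _ 3)))
        (≤-reflexive (trans (rearrange (edges H X)) (trans (cong (2 *_) (tight-edges sparse saturated)) (double (card X))))))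
        where
        rearrange : ∀ e → 4 + (e + e) ≡ 2 * (e + 2)
        rearrange = solve-∀
        double : ∀ c → 2 * (2 * c) ≡ 4 * c
        double = solve-∀
    ... | v , p with X v in q
    ... | true = v , q , p

    module _ {v : Fin n} (v∈X : X v ≡ true) where

      X⁻ : Fin n → Bool
      X⁻ = del X v

      card-X : 1 + card X⁻ ≡ card X
      card-X = wt-del (λ _ → 1) v∈X

      -- With a smaller degree at `v`, the nonempty set `X⁻` would span more than `2|X⁻| - 2` edges.
      degree≥2 : ∀ {u} → X⁻ u ≡ true → 2 ≤ deg H v
      degree≥2 {u} p = certify _ _
        (≤-reflexive card₂ ⊕ ≤-reflexive (sym (tight-edges sparse saturated)) ⊕ split ⊕ sparse X⁻ u p)
        (eq (edges H X) (edges H X⁻) (card X) (card X⁻) (deg H v))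
        where
        card₂ : 2 * (1 + card X⁻) ≡ 2 * card X
        card₂ = cong (2 *_) card-X
        pointwise : ∀ e → H e ▷ ind (within X e) ≤ H e ▷ ind (within X⁻ e) + H e ▷ inc v e
        pointwise e with src e ≟ v | tgt e ≟ v
        ... | yes _ | _ = ≤-trans (▷-mono {H e} (λ q → q) (≤-trans (ind≤1 _) (m≤m+n 1 _))) (m≤n+m _ _)
        ... | no _ | yes _ = ≤-trans (▷-mono {H e} (λ q → q) (ind≤1 _)) (m≤n+m _ _)
        ... | no _ | no _ = m≤m+n _ _
        split : edges H X ≤ edges H X⁻ + deg H v
        split = ≤-trans (∑-mono pointwise) (≤-reflexive (∑-+ _ _))
        eq : ∀ e e′ c c′ d → 2 + (2 * c + (e + 2 + (e′ + d + 2 * c′))) ≡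
                             d + (2 * (1 + c′) + (2 * c + (e + (e′ + 2))))
        eq = solve-∀

      module _ {K : Fin m → Bool} (K⊑H : K ⊑ H) where

        inside-X⁻ : deg K v ≡ 0 → ∀ e → K e ≡ true → within X⁻ e ≡ true
        inside-X⁻ none e k = ∧-intro (avoid (src e) src≢v (proj₁ (∧-elim (inside e (K⊑H e k)))))
                                     (avoid (tgt e) tgt≢v (proj₂ (∧-elim (inside e (K⊑H e k)))))
          where
          avoid : ∀ u → u ≢ v → X u ≡ true → X⁻ u ≡ true
          avoid u = del-intro {H = X}
          inc≡0 : inc v e ≡ 0
          inc≡0 = n≤0⇒n≡0 (subst₂ _≤_ (cong (_▷ inc v e) k) none (∑-term (λ g → K g ▷ inc v g) e))
          src≢v : src e ≢ v
          src≢v p = contradiction (trans (cong (λ b → ind b + ind ⌊ tgt e ≟ v ⌋) (sym (≟-true p))) inc≡0) λ ()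
          tgt≢v : tgt e ≢ v
          tgt≢v p = contradiction (trans (+-comm 1 _) (trans (cong (λ b → ind ⌊ src e ≟ v ⌋ + ind b) (sym (≟-true p))) inc≡0)) λ ()

        saturated-X⁻ : ∀ {d} → wt H (λ _ → 1) ≡ d + wt K (λ _ → 1) → 2 * card X⁻ ≤ d + wt K (λ _ → 1)
        saturated-X⁻ {d} eq = +-cancelˡ-≤ 2 _ _ (≤-reflexive (begin
          2 + 2 * card X⁻          ≡⟨ *-distribˡ-+ 2 1 (card X⁻) ⟨
          2 * (1 + card X⁻)        ≡⟨ cong (2 *_) card-X ⟩
          2 * card X               ≡⟨ tight-edges sparse saturated ⟨
          edges H X + 2            ≡⟨ +-comm (edges H X) 2 ⟩
          2 + edges H X            ≡⟨ cong (2 +_) (trans (edges-all {H} {X} inside) eq) ⟩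
          2 + (d + wt K (λ _ → 1)) ∎))
          where open ≡-Reasoning

      connects-extend : ∀ {p : Fin n → Bool} {a} → X⁻ a ≡ true → p v ≡ p a →
        (∀ u w → X⁻ u ≡ true → X⁻ w ≡ true → p u ≡ p w) → ∀ u w → X u ≡ true → X w ≡ true → p u ≡ p w
      connects-extend {p} {a} a∈X⁻ same const u w u∈X w∈X = trans (to-a u u∈X) (sym (to-a w w∈X))
        where
        to-a : ∀ u → X u ≡ true → p u ≡ p a
        to-a u q with u ≟ v
        ... | yes refl = same
        ... | no u≢v = const u a (del-intro {H = X} u≢v q) a∈X⁻

      far-end : ∀ {e a} → H e ≡ true → EndsAt e v a → X⁻ a ≡ true
      far-end {e} h (inj₁ (refl , refl)) = del-intro {H = X} (sparse-loopless {H} sparse h ∘ sym) (proj₂ (∧-elim {X (src e)} (inside e h)))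
      far-end {e} h (inj₂ (refl , refl)) = del-intro {H = X} (sparse-loopless {H} sparse h) (proj₁ (∧-elim {X (src e)} (inside e h)))

      -- Each colour class receives one of the two edges at `v`, which hangs `v` on as a leaf.
      extend-by-two : ∀ {K e₁ e₂ a₁ a₂} → (∀ g → K g ≡ true → H g ≡ true × g ≢ e₁ × g ≢ e₂) → e₂ ≢ e₁ →
        H e₁ ≡ true → H e₂ ≡ true → EndsAt e₁ v a₁ → EndsAt e₂ v a₂ →
        TwoConnections ends K X⁻ → TwoConnections ends H X
      extend-by-two {K} {e₁} {e₂} {a₁} {a₂} K⊑ e₂≢e₁ h₁ h₂ at₁ at₂ (c , connects) = c′ , extended
        where
        c′ : Fin m → Bool
        c′ g = if ⌊ g ≟ e₁ ⌋ then true else if ⌊ g ≟ e₂ ⌋ then false else c g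
        c′₁ : c′ e₁ ≡ true
        c′₁ rewrite ≟-true {i = e₁} refl = refl
        c′₂ : c′ e₂ ≡ false
        c′₂ rewrite ≟-false e₂≢e₁ | ≟-true {i = e₂} refl = refl
        c′-K : ∀ g → K g ≡ true → c′ g ≡ c g
        c′-K g k with K⊑ g k
        ... | _ , g≢e₁ , g≢e₂ rewrite ≟-false g≢e₁ | ≟-false g≢e₂ = refl
        extended : ∀ b → Connects ends (λ e → H e ≡ true × c′ e ≡ b) X
        extended b p const = join b refl
          where
          const′ : ∀ u w → X⁻ u ≡ true → X⁻ w ≡ true → p u ≡ p w
          const′ = connects b p λ g (k , q) → const g (proj₁ (K⊑ g k) , trans (c′-K g k) q)
          join : ∀ b′ → b ≡ b′ → ∀ u w → X u ≡ true → X w ≡ true → p u ≡ p w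
          join true refl = connects-extend (far-end h₁ at₁) (ends-const at₁ p (const e₁ (h₁ , c′₁))) const′
          join false refl = connects-extend (far-end h₂ at₂) (ends-const at₂ p (const e₂ (h₂ , c′₂))) const′

      -- The edges e₁ and e₂ are lifted at v to a single edge a₁a₂, which reuses the label e₁.
      lifted : Fin m → Fin n → Fin n → Fin m → Fin n × Fin n
      lifted e₁ a₁ a₂ g = if ⌊ g ≟ e₁ ⌋ then (a₁ , a₂) else ends g

      -- The class that used the lifted edge gets the path through `v` formed by `e₁` and `e₂`
      -- instead; the other class reaches `v` by `e₃`.
      extend-by-three : ∀ {K e₁ e₂ e₃ a₁ a₂ a₃} →
        (∀ g → K g ≡ true → H g ≡ true × g ≢ e₁ × g ≢ e₂ × g ≢ e₃) →
        e₂ ≢ e₁ → e₃ ≢ e₁ → e₃ ≢ e₂ → H e₁ ≡ true → H e₂ ≡ true → H e₃ ≡ true →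
        EndsAt e₁ v a₁ → EndsAt e₂ v a₂ → EndsAt e₃ v a₃ →
        TwoConnections (lifted e₁ a₁ a₂) (add K e₁) X⁻ → TwoConnections ends H X
      extend-by-three {K} {e₁} {e₂} {e₃} {a₁} {a₂} {a₃} K⊑ e₂≢e₁ e₃≢e₁ e₃≢e₂ h₁ h₂ h₃ at₁ at₂ at₃ (c , connects) =
        c′ , extended
        where
        c′ : Fin m → Bool
        c′ g = if ⌊ g ≟ e₂ ⌋ then c e₁ else if ⌊ g ≟ e₃ ⌋ then not (c e₁) else c g
        c′₁ : c′ e₁ ≡ c e₁
        c′₁ rewrite ≟-false (e₂≢e₁ ∘ sym) | ≟-false (e₃≢e₁ ∘ sym) = refl
        c′₂ : c′ e₂ ≡ c e₁
        c′₂ rewrite ≟-true {i = e₂} refl = refl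
        c′₃ : c′ e₃ ≡ not (c e₁)
        c′₃ rewrite ≟-false e₃≢e₂ | ≟-true {i = e₃} refl = refl
        extended : ∀ b → Connects ends (λ e → H e ≡ true × c′ e ≡ b) X
        extended b p const = join (b Bool.≟ c e₁)
          where
          lifted-const : ∀ g → add K e₁ g ≡ true × c g ≡ b →
                         p (proj₁ (lifted e₁ a₁ a₂ g)) ≡ p (proj₂ (lifted e₁ a₁ a₂ g))
          lifted-const g (k , q) with g ≟ e₁
          ... | yes refl = trans (sym (ends-const at₁ p (const e₁ (h₁ , trans c′₁ q))))
                                 (ends-const at₂ p (const e₂ (h₂ , trans c′₂ q)))
          ... | no g≢e₁ with K⊑ g k
          ... | h , _ , g≢e₂ , g≢e₃ = const g (h , trans c′-g q)
            where
            c′-g : c′ g ≡ c g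
            c′-g rewrite ≟-false g≢e₂ | ≟-false g≢e₃ = refl
          const′ : ∀ u w → X⁻ u ≡ true → X⁻ w ≡ true → p u ≡ p w
          const′ = connects b p lifted-const
          join : Dec (b ≡ c e₁) → ∀ u w → X u ≡ true → X w ≡ true → p u ≡ p w
          join (yes q) = connects-extend (far-end h₁ at₁) (ends-const at₁ p (const e₁ (h₁ , trans c′₁ (sym q)))) const′
          join (no q) = connects-extend (far-end h₃ at₃)
            (ends-const at₃ p (const e₃ (h₃ , trans c′₃ (sym (Bool.¬-not q))))) const′

      lifted-sparse : ∀ {K e₁ a₁ a₂} → K ⊑ H → K e₁ ≡ false →
        ¬ Linked K (λ _ → true) a₁ a₂ → Count.Sparse (lifted e₁ a₁ a₂) (add K e₁)
      lifted-sparse {K} {e₁} {a₁} {a₂} K⊑H e₁∉K free = sparse-add unchanged e₁∉K (sparse-⊑ K⊑H sparse) loose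
        where
        unchanged : ∀ g → g ≢ e₁ → lifted e₁ a₁ a₂ g ≡ ends g
        unchanged g p rewrite ≟-false p = refl
        at-e₁ : lifted e₁ a₁ a₂ e₁ ≡ (a₁ , a₂)
        at-e₁ rewrite ≟-true {i = e₁} refl = refl
        loose : ∀ Y → Tight K Y → Count.within (lifted e₁ a₁ a₂) Y e₁ ≡ false
        loose Y t rewrite at-e₁ = not≡true λ q → free (Y , t , (λ _ _ → refl) , ∧-elim q)

      -- Otherwise the union of the two tight sets, together with v, would span too many edges.
      not-both-linked : ∀ {e₁ e₂ e₃ a₁ a₂ a₃} → let K = del (del (del H e₁) e₂) e₃ in
        H e₁ ≡ true → del H e₁ e₂ ≡ true → del (del H e₁) e₂ e₃ ≡ true →
        EndsAt e₁ v a₁ → EndsAt e₂ v a₂ → EndsAt e₃ v a₃ →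
        Linked K (λ _ → true) a₁ a₂ → Linked K (λ _ → true) a₁ a₃ → ⊥
      not-both-linked {e₁} {e₂} {e₃} {a₁} {a₂} {a₃} h₁ h₂ h₃ at₁ at₂ at₃ (A , tA , _ , a₁∈A , a₂∈A) (B , tB , _ , a₁∈B , a₃∈B) =
        1+n≰n {4 + edges K U} (certify _ _ (Tight.saturated tU ⊕ many ⊕ sparse D v v∈D ⊕ *-monoʳ-≤ 2 (card-add-≤ U v))
          (eq (edges K U) (edges H D) (card U) (card D)))
        where
        K⊑H : del (del (del H e₁) e₂) e₃ ⊑ H
        K⊑H g = del-⊑ {H = H} g ∘ del-⊑ {H = del H e₁} g ∘ del-⊑ {H = del (del H e₁) e₂} g
        K U D : _ → Bool
        K = del (del (del H e₁) e₂) e₃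
        U = A ∪ B
        D = add U v
        tU : Tight K U
        tU = tight-∪ (sparse-⊑ K⊑H sparse) tA tB a₁∈A a₁∈B
        v∈D : D v ≡ true
        v∈D = add-self U v
        U⊑D : U ⊑ D
        U⊑D u = ∨-introʳ {⌊ u ≟ v ⌋}
        drop : ∀ {F e a} → F e ≡ true → EndsAt e v a → U a ≡ true → edges F D ≡ 1 + edges (del F e) D
        drop {F} {e} {a} f at a∈U = trans (sym (wt-del (λ g → ind (within D g)) f))
          (cong (λ b → ind b + edges (del F e) D) (ends-within at D v∈D (U⊑D a a∈U)))
        many : 3 + edges K U ≤ edges H D
        many = subst (3 + edges K U ≤_)
          (sym (trans (drop h₁ at₁ (∨-introˡ a₁∈A)) (cong suc
               (trans (drop h₂ at₂ (∨-introˡ a₂∈A)) (cong suc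
                 (drop {F = del (del H e₁) e₂} h₃ at₃ (∨-introʳ a₃∈B)))))))
          (+-monoʳ-≤ 3 (edges-mono {H = K} ⊑-refl U⊑D))
        eq : ∀ k h u d → 5 + k + (k + 2 + (h + (2 * d + 2 * (1 + u)))) ≡
                         4 + k + (2 * u + (3 + k + (h + 2 + 2 * d)))
        eq = solve-∀

two-connections : ∀ {n m} {ends : Fin m → Fin n × Fin n} {H X} → Count.Sparse ends H →
  Count.Tight ends H X → (∀ e → H e ≡ true → Count.within ends X e ≡ true) → TwoConnections ends H X
two-connections {n} {m} {ends} {H} {X} = induct (card X) ends H X ≤-refl
  where
  -- The end map is an argument of the induction because a lifting step redefines it.
  induct : ∀ k (ends : Fin m → Fin n × Fin n) H X → card X ≤ k → Count.Sparse ends H →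
       Count.Tight ends H X → (∀ e → H e ≡ true → Count.within ends X e ≡ true) → TwoConnections ends H X
  induct zero ends H X bound sparse (Count.tight (v , p) _) inside = contradiction (≤-trans (card-pos p) bound) λ ()
  induct (suc k) ends H X bound sparse saturated inside with low-degree sparse saturated inside
  ... | v , v∈X , deg<4 with any? (λ u → del X v u Bool.≟ true)
  -- Here `X` is the single vertex `v`, so any colouring of the edges serves.
  ... | no none = (λ _ → true) , λ b p const u w u∈X w∈X → cong p (trans (only u u∈X) (sym (only w w∈X)))
    where
    only : ∀ u → X u ≡ true → u ≡ v
    only u u∈X with u ≟ v
    ... | yes q = q
    ... | no u≢v = ⊥-elim (none (u , del-intro {H = X} u≢v u∈X))
  ... | yes (u , u∈X′) = by-degree (deg H v) refl
    where
    open Count ends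
    X′ : Fin n → Bool
    X′ = del X v
    bound′ : card X′ ≤ k
    bound′ = ≤-pred (subst (_≤ suc k) (sym (card-X sparse saturated inside v∈X)) bound)
    loop-free : ∀ {F : Fin m → Bool} → F ⊑ H → ∀ e → F e ≡ true → src e ≢ tgt e
    loop-free F⊑H e f = sparse-loopless {H} sparse (F⊑H e f)

    by-degree : ∀ d → deg H v ≡ d → TwoConnections ends H X
    by-degree 0 eq = contradiction (subst (2 ≤_) eq (degree≥2 sparse saturated inside v∈X u∈X′)) λ ()
    by-degree 1 eq = contradiction (subst (2 ≤_) eq (degree≥2 sparse saturated inside v∈X u∈X′)) λ { (s≤s ()) }
    by-degree (suc (suc (suc (suc d)))) eq = contradiction (subst (_< 4) eq deg<4) λ { (s≤s (s≤s (s≤s (s≤s ())))) }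
    by-degree 2 eq with peel (loop-free {H} ⊑-refl) eq
    ... | e₁ , h₁ , (a₁ , at₁) , eq₁ with peel (loop-free {del H e₁} del-⊑) eq₁
    ... | e₂ , h₂ , (a₂ , at₂) , eq₂ =
      extend-by-two sparse saturated inside v∈X {K} members (del-≢ {H = H} h₂) h₁ (del-⊑ {H = H} e₂ h₂) at₁ at₂
        (induct k ends K X′ bound′ (sparse-⊑ K⊑H sparse) (tight (u , u∈X′) (subst (2 * card X′ ≤_) size sat)) inside′)
      where
      K : Fin m → Bool
      K = del (del H e₁) e₂
      K⊑H : K ⊑ H
      K⊑H g = del-⊑ {H = H} g ∘ del-⊑ {H = del H e₁} g
      members : ∀ g → K g ≡ true → H g ≡ true × g ≢ e₁ × g ≢ e₂
      members g q = K⊑H g q , del-≢ {H = H} (del-⊑ {H = del H e₁} g q) , del-≢ {H = del H e₁} q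
      inside′ : ∀ e → K e ≡ true → within X′ e ≡ true
      inside′ = inside-X⁻ sparse saturated inside v∈X {K} K⊑H eq₂
      total : wt H (λ _ → 1) ≡ 2 + wt K (λ _ → 1)
      total = trans (sym (wt-del {H = H} (λ _ → 1) h₁)) (cong suc (sym (wt-del {H = del H e₁} (λ _ → 1) h₂)))
      sat : 2 * card X′ ≤ 2 + wt K (λ _ → 1)
      sat = saturated-X⁻ sparse saturated inside v∈X {K} K⊑H {2} total
      size : 2 + wt K (λ _ → 1) ≡ edges K X′ + 2
      size = trans (+-comm 2 _) (cong (_+ 2) (sym (edges-all {ends = ends} {H = K} {X′} inside′)))
    by-degree 3 eq with peel (loop-free {H} ⊑-refl) eq
    ... | e₁ , h₁ , (a₁ , at₁) , eq₁ with peel (loop-free {del H e₁} del-⊑) eq₁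
    ... | e₂ , h₂ , (a₂ , at₂) , eq₂ with peel (loop-free {del (del H e₁) e₂} (λ g → del-⊑ {H = H} g ∘ del-⊑ {H = del H e₁} g)) eq₂
    ... | e₃ , h₃ , (a₃ , at₃) , eq₃ = choose
      where
      K : Fin m → Bool
      K = del (del (del H e₁) e₂) e₃
      h₂′ : H e₂ ≡ true
      h₂′ = del-⊑ {H = H} e₂ h₂
      h₃′ : H e₃ ≡ true
      h₃′ = del-⊑ {H = H} e₃ (del-⊑ {H = del H e₁} e₃ h₃)
      e₂≢e₁ : e₂ ≢ e₁
      e₂≢e₁ = del-≢ {H = H} h₂
      e₃≢e₁ : e₃ ≢ e₁
      e₃≢e₁ = del-≢ {H = H} (del-⊑ {H = del H e₁} e₃ h₃)
      e₃≢e₂ : e₃ ≢ e₂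
      e₃≢e₂ = del-≢ {H = del H e₁} h₃
      members : ∀ g → K g ≡ true → H g ≡ true × g ≢ e₁ × g ≢ e₂ × g ≢ e₃
      members g q = let q₂ = del-⊑ {H = del (del H e₁) e₂} g q ; q₁ = del-⊑ {H = del H e₁} g q₂ in
        del-⊑ {H = H} g q₁ , del-≢ {H = H} q₁ , del-≢ {H = del H e₁} q₂ , del-≢ {H = del (del H e₁) e₂} q
      K⊑H : K ⊑ H
      K⊑H g = proj₁ ∘ members g
      inside′ : ∀ e → K e ≡ true → within X′ e ≡ true
      inside′ = inside-X⁻ sparse saturated inside v∈X {K} K⊑H eq₃
      total : wt H (λ _ → 1) ≡ 3 + wt K (λ _ → 1)
      total = trans (sym (wt-del {H = H} (λ _ → 1) h₁)) (cong suc (trans (sym (wt-del {H = del H e₁} (λ _ → 1) h₂)) (cong suc (sym (wt-del {H = del (del H e₁) e₂} (λ _ → 1) h₃)))))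
      sat : 2 * card X′ ≤ 3 + wt K (λ _ → 1)
      sat = saturated-X⁻ sparse saturated inside v∈X {K} K⊑H {3} total
      e₁∉K : K e₁ ≡ false
      e₁∉K = not≡true λ q → proj₁ (proj₂ (members e₁ q)) refl
      far : ∀ {e a} → H e ≡ true → EndsAt {ends = ends} e v a → X′ a ≡ true
      far = far-end sparse saturated inside v∈X

      recurse : ∀ {a₂} → X′ a₂ ≡ true → ¬ Linked K (λ _ → true) a₁ a₂ →
                TwoConnections (lifted sparse saturated inside v∈X e₁ a₁ a₂) (add K e₁) X′
      recurse {a} a∈X′ free = induct k ends′ (add K e₁) X′ bound′
        (lifted-sparse sparse saturated inside v∈X K⊑H e₁∉K free)
        (Count.tight (u , u∈X′) (subst (2 * card X′ ≤_) size sat)) inside″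
        where
        ends′ : Fin m → Fin n × Fin n
        ends′ = lifted sparse saturated inside v∈X e₁ a₁ a
        inside″ : ∀ e → add K e₁ e ≡ true → Count.within ends′ X′ e ≡ true
        inside″ e q with e ≟ e₁ | inside′ e
        ... | yes refl | _ = ∧-intro (far h₁ at₁) a∈X′
        ... | no _ | in′ = in′ q
        size : 3 + wt K (λ _ → 1) ≡ Count.edges ends′ (add K e₁) X′ + 2
        size = trans (+-comm 2 _) (cong (_+ 2) (trans (sym (wt-add {H = K} (λ _ → 1) e₁∉K))
          (sym (edges-all {ends = ends′} {H = add K e₁} {X′} inside″))))

      choose : TwoConnections ends H X
      -- Lifting at `e₁`, `e₂` keeps sparsity unless `a₁` and `a₂` share a tight set; in that case
      -- `e₃` takes the role of `e₂`. Both pairs cannot be obstructed.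
      choose with linked? K (λ _ → true) a₁ a₂ | linked? K (λ _ → true) a₁ a₃
      ... | no free | _ = extend-by-three sparse saturated inside v∈X {K} members e₂≢e₁ e₃≢e₁ e₃≢e₂
        h₁ h₂′ h₃′ at₁ at₂ at₃ (recurse (far h₂′ at₂) free)
      ... | yes _ | no free = extend-by-three sparse saturated inside v∈X {K}
        (λ g q → let h , g≢e₁ , g≢e₂ , g≢e₃ = members g q in h , g≢e₁ , g≢e₃ , g≢e₂) e₃≢e₁ e₂≢e₁ (e₃≢e₂ ∘ sym)
        h₁ h₃′ h₂′ at₁ at₃ at₂ (recurse (far h₃′ at₃) free)
      ... | yes l₁ | yes l₂ = ⊥-elim (not-both-linked sparse saturated inside v∈X h₁ h₂ h₃ at₁ at₂ at₃ l₁ l₂)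

-- Counting the parts of a partition against the edges that cross it

module Parts {n m : ℕ} (ends : Fin m → Fin n × Fin n) where
  open Count ends

  parts : (Fin n → Bool) → (Fin n → Fin n) → ℕ
  parts Z r = card λ v → Z v ∧ ⌊ r v ≟ v ⌋

  crosses : (Fin n → Bool) → (Fin n → Fin n) → Fin m → Bool
  crosses Z r e = within Z e ∧ not ⌊ r (src e) ≟ r (tgt e) ⌋

  cross : (Fin m → Bool) → (Fin n → Bool) → (Fin n → Fin n) → ℕ
  cross H Z r = wt H λ e → ind (crosses Z r e)

  record Retraction (Z : Fin n → Bool) (r : Fin n → Fin n) : Set where
    constructor retraction
    field
      closed     : ∀ u → Z u ≡ true → Z (r u) ≡ true
      idempotent : ∀ u → Z u ≡ true → r (r u) ≡ r u
  open Retraction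

  -- Connectivity of `T` once every class of `r` is contracted to a point: contraction enters as the
  -- restriction to colourings constant on classes.
  ConnectsParts : (Fin m → Bool) → (Fin n → Bool) → (Fin n → Fin n) → Set
  ConnectsParts T Z r = ∀ (p : Fin n → Bool) → (∀ u → Z u ≡ true → p (r u) ≡ p u) →
    (∀ e → T e ≡ true → p (src e) ≡ p (tgt e)) → ∀ u w → Z u ≡ true → Z w ≡ true → p u ≡ p w

  -- Contraction of the crossing edge `e`: the class of its source is given the representative of
  -- its target.
  module Merge {T : Fin m → Bool} {Z : Fin n → Bool} {r : Fin n → Fin n} (ret : Retraction Z r)
               (inside : ∀ e → T e ≡ true → within Z e ≡ true) {e : Fin m} (e∈T : T e ≡ true) (e-crosses : r (src e) ≢ r (tgt e)) where

    a b : Fin n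
    a = r (src e)
    b = r (tgt e)

    src∈Z : Z (src e) ≡ true
    src∈Z = proj₁ (∧-elim (inside e e∈T))

    tgt∈Z : Z (tgt e) ≡ true
    tgt∈Z = proj₂ (∧-elim {Z (src e)} (inside e e∈T))

    redirect : Fin n → Fin n
    redirect u = if ⌊ u ≟ a ⌋ then b else u

    merged : Fin n → Fin n
    merged u = redirect (r u)

    redirect-a : redirect a ≡ b
    redirect-a rewrite ≟-true {i = a} refl = refl

    redirect-≢ : ∀ {u} → u ≢ a → redirect u ≡ u
    redirect-≢ p rewrite ≟-false p = refl

    merged-retraction : Retraction Z merged
    merged-retraction .closed u u∈Z with r u ≟ a
    ... | yes _ = closed ret (tgt e) tgt∈Z
    ... | no _ = closed ret u u∈Z
    merged-retraction .idempotent u u∈Z with r u ≟ a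
    ... | yes _ = trans (cong redirect (idempotent ret (tgt e) tgt∈Z)) (redirect-≢ (e-crosses ∘ sym))
    ... | no ru≢a = trans (cong redirect (idempotent ret u u∈Z)) (redirect-≢ ru≢a)

    merged-connects : ConnectsParts T Z r → ConnectsParts T Z merged
    merged-connects connects p classes = connects p λ u u∈Z → begin
      p (r u)          ≡⟨ classes (r u) (closed ret u u∈Z) ⟨
      p (redirect (r (r u))) ≡⟨ cong (p ∘ redirect) (idempotent ret u u∈Z) ⟩
      p (merged u)     ≡⟨ classes u u∈Z ⟩
      p u              ∎
      where open ≡-Reasoning

    parts-merged : parts Z merged + 1 ≡ parts Z r
    parts-merged = trans (cong (parts Z merged +_) (sym (∑-delta a (λ _ → 1)))) (trans (sym (∑-+ _ _)) (∑-cong pointwise))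
      where
      ra≡a : r a ≡ a
      ra≡a = idempotent ret (src e) src∈Z
      pointwise : ∀ v → ind (Z v ∧ ⌊ merged v ≟ v ⌋) + ind ⌊ v ≟ a ⌋ ≡ ind (Z v ∧ ⌊ r v ≟ v ⌋)
      pointwise v with v ≟ a
      ... | yes refl rewrite ra≡a | redirect-a | ≟-true {i = a} refl | ≟-false (e-crosses ∘ sym) | closed ret (src e) src∈Z = refl
      ... | no v≢a with Z v in z
      ... | false = refl
      ... | true with r v ≟ a
      ... | yes rv≡a rewrite rv≡a | ≟-false (v≢a ∘ sym) | ≟-false {i = b} {v} (λ q → e-crosses (sym (trans (sym (idempotent ret (tgt e) tgt∈Z)) (trans (cong r q) rv≡a)))) = refl
      ... | no _ = +-identityʳ _

    cross-merged : cross T Z merged + 1 ≤ cross T Z r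
    cross-merged = ≤-trans (≤-reflexive (trans (cong (cross T Z merged +_) (sym (∑-delta e (λ _ → 1)))) (sym (∑-+ _ _)))) (∑-mono pointwise)
      where
      pointwise : ∀ g → T g ▷ ind (crosses Z merged g) + ind ⌊ g ≟ e ⌋ ≤ T g ▷ ind (crosses Z r g)
      pointwise g with g ≟ e
      ... | yes refl rewrite e∈T | inside e e∈T | ≟-false e-crosses | redirect-a | redirect-≢ (e-crosses ∘ sym) | ≟-true {i = b} refl = ≤-refl
      ... | no _ with r (src g) ≟ r (tgt g)
      ... | yes q rewrite q | ≟-true {i = redirect (r (tgt g))} refl = ≤-reflexive (trans (+-identityʳ _) refl)
      ... | no _ = ≤-trans (≤-reflexive (+-identityʳ _)) (▷-mono {T g} (λ q → q) (ind-mono {crosses Z merged g} λ q → ∧-intro (proj₁ (∧-elim {within Z g} q)) refl))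

  -- A connected graph on k points has at least k - 1 edges, for the contracted graph. With two
  -- classes or more, some edge of `T` leaves the class of `a`, since otherwise membership in that
  -- class would be a forbidden colouring. Merging along this edge loses exactly one class and at
  -- least one crossing edge.
  parts-bound : ∀ {T Z} k r → parts Z r ≤ k → Retraction Z r → (∀ e → T e ≡ true → within Z e ≡ true) →
                ConnectsParts T Z r → parts Z r ≤ 1 + cross T Z r
  parts-bound {T} {Z} zero r small ret inside connects = ≤-trans small z≤n
  parts-bound {T} {Z} (suc k) r small ret inside connects with parts Z r ≤? 1
  ... | yes one = ≤-trans one (s≤s z≤n)
  ... | no many with ∑-witness {f = λ _ → 0} {λ v → ind (Z v ∧ ⌊ r v ≟ v ⌋)}
        (subst (_< parts Z r) (sym (∑-zero {f = λ (_ : Fin n) → 0} λ _ → refl)) (≤-trans (s≤s z≤n) (≰⇒> many)))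
  ... | a , a-rep with any? (λ e → (T e Bool.≟ true) ×-dec (¬? (⌊ r (src e) ≟ a ⌋ Bool.≟ ⌊ r (tgt e) ≟ a ⌋)))
  ... | yes (e , e∈T , differ) = certify _ _
      (≤-reflexive (sym M.parts-merged) ⊕ parts-bound k M.merged
        (≤-pred (subst (_≤ suc k) (trans (sym M.parts-merged) (+-comm _ 1)) small))
        M.merged-retraction inside (M.merged-connects connects) ⊕ M.cross-merged)
      (eq (parts Z r) (parts Z M.merged) (cross T Z r) (cross T Z M.merged))
    where
    module M = Merge ret inside e∈T (λ q → differ (cong (λ u → ⌊ u ≟ a ⌋) q))
    eq : ∀ p p′ c c′ → p + (p′ + 1 + (1 + c′ + c)) ≡ 1 + c + (p + (p′ + (c′ + 1)))
    eq = solve-∀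
  ... | no none = ⊥-elim (many (≤-trans (∑-mono only-a) (≤-reflexive (card-single a))))
    where
    p : Fin n → Bool
    p u = ⌊ r u ≟ a ⌋
    rep : Z a ∧ ⌊ r a ≟ a ⌋ ≡ true
    rep = ind-pos a-rep
    const : ∀ e → T e ≡ true → p (src e) ≡ p (tgt e)
    const e e∈T with p (src e) Bool.≟ p (tgt e)
    ... | yes q = q
    ... | no q = ⊥-elim (none (e , e∈T , q))
    only-a : ∀ v → ind (Z v ∧ ⌊ r v ≟ v ⌋) ≤ ind ⌊ v ≟ a ⌋
    only-a v = ind-mono λ q → let v∈Z , rv≡v = ∧-elim {Z v} q ; a∈Z , ra≡a = ∧-elim {Z a} rep in
      ≟-true (trans (sym (≟-≡ rv≡v)) (≟-≡ (trans
        (connects p (λ u u∈Z → cong (λ w → ⌊ w ≟ a ⌋) (idempotent ret u u∈Z)) const v a v∈Z a∈Z) ra≡a)))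

  fibre : (Fin n → Bool) → (Fin n → Fin n) → Fin n → Fin n → Bool
  fibre Z r v u = Z u ∧ ⌊ r u ≟ v ⌋

  ∑-fibre : ∀ (a : Fin n) (f : Fin n → ℕ) → ∑ (λ v → ⌊ a ≟ v ⌋ ▷ f v) ≡ f a
  ∑-fibre a f = trans (∑-cong λ v → cong (_▷ f v) (≟-sym a v)) (∑-delta a f)

  -- Every class of size c spans exactly `2c - 2` edges; summing over the classes counts all edges
  -- except the crossing ones.
  edges-fibres : ∀ {K Z r} → Retraction Z r →
    (∀ v → Z v ≡ true → r v ≡ v → edges K (fibre Z r v) + 2 ≡ 2 * card (fibre Z r v)) →
    edges K Z + 2 * parts Z r ≡ 2 * card Z + cross K Z r
  edges-fibres {K} {Z} {r} ret sat = begin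
    edges K Z + 2 * parts Z r
      ≡⟨ cong (_+ 2 * parts Z r) split ⟩
    uncrossed + cross K Z r + 2 * parts Z r
      ≡⟨ swap uncrossed (cross K Z r) (2 * parts Z r) ⟩
    uncrossed + 2 * parts Z r + cross K Z r
      ≡⟨ cong (_+ cross K Z r) total ⟩
    2 * card Z + cross K Z r ∎
    where
    open ≡-Reasoning
    swap : ∀ a b c → a + b + c ≡ a + c + b
    swap = solve-∀
    rep : Fin n → Bool
    rep v = Z v ∧ ⌊ r v ≟ v ⌋
    uncrossed : ℕ
    uncrossed = wt K λ e → ind (within Z e ∧ ⌊ r (src e) ≟ r (tgt e) ⌋)
    split : edges K Z ≡ uncrossed + cross K Z r
    split = trans (∑-cong λ e → pointwise (K e) (within Z e) ⌊ r (src e) ≟ r (tgt e) ⌋) (∑-+ _ _)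
      where
      pointwise : ∀ k z c → k ▷ ind z ≡ k ▷ ind (z ∧ c) + k ▷ ind (z ∧ not c)
      pointwise = from-yes (∀Bool? λ k → ∀Bool? λ z → ∀Bool? λ c →
        k ▷ ind z ℕ.≟ k ▷ ind (z ∧ c) + k ▷ ind (z ∧ not c))
    rep-r : ∀ u → Z u ≡ true → rep (r u) ≡ true
    rep-r u u∈Z = ∧-intro (closed ret u u∈Z) (≟-true (idempotent ret u u∈Z))
    edge-sum : ∑ (λ v → rep v ▷ edges K (fibre Z r v)) ≡ uncrossed
    edge-sum = trans (∑-cong λ v → ▷-∑ (rep v) _) (trans (∑-swap _) (∑-cong pointwise))
      where
      regroup : ∀ p k zs zt s t → p ▷ k ▷ ind ((zs ∧ s) ∧ (zt ∧ t)) ≡ s ▷ p ▷ k ▷ ind ((zs ∧ zt) ∧ t)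
      regroup = from-yes (∀Bool? λ p → ∀Bool? λ k → ∀Bool? λ zs → ∀Bool? λ zt → ∀Bool? λ s → ∀Bool? λ t →
        p ▷ k ▷ ind ((zs ∧ s) ∧ (zt ∧ t)) ℕ.≟ s ▷ p ▷ k ▷ ind ((zs ∧ zt) ∧ t))
      guard : ∀ {p z} y → (z ≡ true → p ≡ true) → ∀ k t → p ▷ k ▷ ind ((z ∧ y) ∧ t) ≡ k ▷ ind ((z ∧ y) ∧ t)
      guard {z = true} y h k t rewrite h refl = refl
      guard {true} {false} y h k t = refl
      guard {false} {false} y h k t = ▷-0 false k
      pointwise : ∀ e → ∑ (λ v → rep v ▷ K e ▷ ind (within (fibre Z r v) e)) ≡
                  K e ▷ ind (within Z e ∧ ⌊ r (src e) ≟ r (tgt e) ⌋)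
      pointwise e = begin
        ∑ (λ v → rep v ▷ K e ▷ ind (within (fibre Z r v) e))
          ≡⟨ ∑-cong (λ v → regroup (rep v) (K e) (Z (src e)) (Z (tgt e)) ⌊ r (src e) ≟ v ⌋ ⌊ r (tgt e) ≟ v ⌋) ⟩
        ∑ (λ v → ⌊ r (src e) ≟ v ⌋ ▷ rep v ▷ K e ▷ ind (within Z e ∧ ⌊ r (tgt e) ≟ v ⌋))
          ≡⟨ ∑-fibre (r (src e)) _ ⟩
        rep (r (src e)) ▷ K e ▷ ind (within Z e ∧ ⌊ r (tgt e) ≟ r (src e) ⌋)
          ≡⟨ guard (Z (tgt e)) (rep-r (src e)) (K e) _ ⟩
        K e ▷ ind (within Z e ∧ ⌊ r (tgt e) ≟ r (src e) ⌋)
          ≡⟨ cong (λ b → K e ▷ ind (within Z e ∧ b)) (≟-sym (r (tgt e)) (r (src e))) ⟩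
        K e ▷ ind (within Z e ∧ ⌊ r (src e) ≟ r (tgt e) ⌋) ∎
    card-sum : ∑ (λ v → rep v ▷ card (fibre Z r v)) ≡ card Z
    card-sum = trans (∑-cong λ v → ▷-∑ (rep v) _) (trans (∑-swap _) (∑-cong pointwise))
      where
      regroup : ∀ p z s → p ▷ ind (z ∧ s) ≡ s ▷ p ▷ ind z
      regroup = from-yes (∀Bool? λ p → ∀Bool? λ z → ∀Bool? λ s → p ▷ ind (z ∧ s) ℕ.≟ s ▷ p ▷ ind z)
      guard : ∀ {p z} → (z ≡ true → p ≡ true) → p ▷ ind z ≡ ind z
      guard {z = true} h rewrite h refl = refl
      guard {p} {false} h = ▷-0 p false
      pointwise : ∀ u → ∑ (λ v → rep v ▷ ind (fibre Z r v u)) ≡ ind (Z u)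
      pointwise u = trans (∑-cong λ v → regroup (rep v) (Z u) ⌊ r u ≟ v ⌋) (trans (∑-fibre (r u) _) (guard (rep-r u)))
    total : uncrossed + 2 * parts Z r ≡ 2 * card Z
    total = begin
      uncrossed + 2 * parts Z r
        ≡⟨ cong₂ _+_ (sym edge-sum) (sym (∑-scale 2 _)) ⟩
      ∑ (λ v → rep v ▷ edges K (fibre Z r v)) + ∑ (λ v → 2 * ind (rep v))
        ≡⟨ ∑-+ _ _ ⟨
      ∑ (λ v → rep v ▷ edges K (fibre Z r v) + 2 * ind (rep v))
        ≡⟨ ∑-cong pointwise ⟩
      ∑ (λ v → 2 * (rep v ▷ card (fibre Z r v)))
        ≡⟨ ∑-scale 2 _ ⟩
      2 * ∑ (λ v → rep v ▷ card (fibre Z r v))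
        ≡⟨ cong (2 *_) card-sum ⟩
      2 * card Z ∎
      where
      pointwise : ∀ v → rep v ▷ edges K (fibre Z r v) + 2 * ind (rep v) ≡ 2 * (rep v ▷ card (fibre Z r v))
      pointwise v with rep v in q
      ... | false = refl
      ... | true = sat v (proj₁ (∧-elim q)) (≟-≡ (proj₂ (∧-elim {Z v} q)))

-- From two-colourings back to paths

module Reachability (G : Graph) where
  open Count (ends G)

  reach-trans : ∀ {P u v w} → Reach G P u v → Reach G P v w → Reach G P u w
  reach-trans here q = q
  reach-trans (step e p j r) q = step e p j (reach-trans r q)

  reach-const : ∀ {P u v} (p : Fin (nV G) → Bool) → (∀ e → P e → p (src e) ≡ p (tgt e)) →
                Reach G P u v → p u ≡ p v
  reach-const p const here = refl
  reach-const p const (step e q (inj₁ refl) r) = trans (const e q) (reach-const p const r)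
  reach-const p const (step e q (inj₂ refl) r) = trans (sym (const e q)) (reach-const p const r)

  -- The colouring to test is "explored from `u`". Once no edge of `P` leaves the explored set, it
  -- is constant along `P`, so `v` has the colour of `u`.
  connects⇒reach : ∀ {P X} → (∀ e → Dec (P e)) → Connects (ends G) P X →
                   ∀ u v → X u ≡ true → X v ≡ true → Reach G P u v
  connects⇒reach {P} P? connects u v u∈X v∈X =
    let (p , p-u , reached) , const = iterate {Q = λ (p , _) → ∀ e → P e → p (src e) ≡ p (tgt e)}
          (λ (p , _) → card (∁ᵇ p)) grow (single u , ≟-true {i = u} refl , λ w q → subst (Reach G P u) (sym (≟-≡ q)) here)
    in reached v (trans (sym (connects p const u v u∈X v∈X)) p-u)
    where
    Explored : Set
    Explored = ∃ λ p → p u ≡ true × (∀ w → p w ≡ true → Reach G P u w)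
    extend : ((p , _) : Explored) → ∀ e {a b} → P e → Joins G e a b → p a ≡ true → p b ≡ false →
             ∃ λ ((q , _) : Explored) → card (∁ᵇ q) < card (∁ᵇ p)
    extend (p , p-u , reached) e {a} {b} pe joins p-a p-b =
      (add p b , ∨-introʳ {⌊ u ≟ b ⌋} p-u , reached′) ,
      card-mono-< (∁-⊑ {X = p} λ w → ∨-introʳ {⌊ w ≟ b ⌋}) {b} (cong not (add-self p b)) (cong not p-b)
      where
      reached′ : ∀ w → add p b w ≡ true → Reach G P u w
      reached′ w q with w ≟ b
      ... | yes refl = reach-trans (reached a p-a) (step e pe joins here)
      ... | no _ = reached w q
    grow : (E : Explored) → (∀ e → P e → proj₁ E (src e) ≡ proj₁ E (tgt e)) ⊎
           ∃ λ (E′ : Explored) → card (∁ᵇ (proj₁ E′)) < card (∁ᵇ (proj₁ E))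
    grow E@(p , _) with any? (λ e → P? e ×-dec ¬? (p (src e) Bool.≟ p (tgt e)))
    ... | no none = inj₁ λ e pe → decide e pe (p (src e) Bool.≟ p (tgt e))
      where
      decide : ∀ e → P e → Dec (p (src e) ≡ p (tgt e)) → p (src e) ≡ p (tgt e)
      decide e pe (yes q) = q
      decide e pe (no q) = ⊥-elim (none (e , pe , q))
    ... | yes (e , pe , differ) with p (src e) in s | p (tgt e) in t
    ... | true | true = ⊥-elim (differ refl)
    ... | false | false = ⊥-elim (differ refl)
    ... | true | false = inj₂ (extend E e pe (inj₁ refl) s t)
    ... | false | true = inj₂ (extend E e pe (inj₂ refl) t s)

-- Tight sets are 2-tree-connected

module Components (G : Graph) where
  open Count (ends G)
  open Parts (ends G)
  open Reachability G

  connects-card : ∀ {T X} → (∀ e → T e ≡ true → within X e ≡ true) →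
                  Connects (ends G) (λ e → T e ≡ true) X → card X ≤ 1 + wt T (λ _ → 1)
  connects-card {T} {X} inside connects = ≤-trans (≤-reflexive all-parts)
    (≤-trans (parts-bound (parts X (λ v → v)) (λ v → v) ≤-refl (retraction (λ _ q → q) (λ _ _ → refl)) inside
      (λ p _ const → connects p const)) (s≤s (wt-mono {H = T} ⊑-refl λ e → ind≤1 _)))
    where
    all-parts : card X ≡ parts X (λ v → v)
    all-parts = ∑-cong λ v → cong ind (sym (trans (cong (X v ∧_) (≟-true {i = v} refl)) (Bool.∧-identityʳ (X v))))

  colour : Bool → Fin 2
  colour true = zero
  colour false = suc zero

  colour⁻¹ : Fin 2 → Bool
  colour⁻¹ zero = true
  colour⁻¹ (suc zero) = false

  colour-inverse : ∀ i → colour (colour⁻¹ i) ≡ i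
  colour-inverse zero = refl
  colour-inverse (suc zero) = refl

  colour-inverse′ : ∀ b → colour⁻¹ (colour b) ≡ b
  colour-inverse′ true = refl
  colour-inverse′ false = refl

  tight⇒treeConnected : ∀ {K X} → Sparse K → Tight K (lookup X) → TreeConnected G 2 X
  tight⇒treeConnected {K} {X} sparse saturated = c , λ i → insideE i , spanning i , acyclic i
    where
    KX : Fin (nE G) → Bool
    KX e = K e ∧ within (lookup X) e
    inside : ∀ e → KX e ≡ true → within (lookup X) e ≡ true
    inside e = proj₂ ∘ ∧-elim {K e}
    edges-KX : edges KX (lookup X) ≡ edges K (lookup X)
    edges-KX = trans (edges-all {ends = ends G} {KX} {lookup X} inside) (∑-cong λ e → pointwise (K e) (within (lookup X) e))
      where
      pointwise : ∀ k w → (k ∧ w) ▷ 1 ≡ k ▷ ind w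
      pointwise true w = refl
      pointwise false w = refl
    two : TwoConnections (ends G) KX (lookup X)
    two = two-connections (sparse-⊑ {KX} {K} (λ e → proj₁ ∘ ∧-elim) sparse)
      (tight (Tight.nonempty saturated) (subst (λ k → 2 * card (lookup X) ≤ k + 2) (sym edges-KX) (Tight.saturated saturated)))
      inside
    c : Fin (nE G) → Maybe (Fin 2)
    c e = if KX e then just (colour (proj₁ two e)) else nothing
    c-elim : ∀ {e i} → c e ≡ just i → KX e ≡ true × proj₁ two e ≡ colour⁻¹ i
    c-elim {e} eq with KX e
    ... | true = refl , trans (sym (colour-inverse′ _)) (cong colour⁻¹ (just-injective eq))
    c-intro : ∀ {e i} → KX e ≡ true × proj₁ two e ≡ colour⁻¹ i → c e ≡ just i
    c-intro {e} (k , q) rewrite k | q = cong just (colour-inverse _)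
    insideE : ∀ i e → c e ≡ just i → InsideE G X e
    insideE i e q = let w = inside e (proj₁ (c-elim q)) in
      lookup⇒[]= _ X (proj₁ (∧-elim w)) , lookup⇒[]= _ X (proj₂ (∧-elim {lookup X (src e)} w))
    connects : ∀ i → Connects (ends G) (λ e → c e ≡ just i) (lookup X)
    connects i p const = proj₂ two (colour⁻¹ i) p λ e q → const e (c-intro q)
    c-dec : ∀ i e → Dec (c e ≡ just i)
    c-dec i e = map′ c-intro c-elim ((KX e Bool.≟ true) ×-dec (proj₁ two e Bool.≟ colour⁻¹ i))
    spanning : ∀ i u v → u ∈ₛ X → v ∈ₛ X → Reach G (λ e → c e ≡ just i) u v
    spanning i u v p q = connects⇒reach (c-dec i) (connects i) u v ([]=⇒lookup p) ([]=⇒lookup q)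
    tree : Bool → Fin (nE G) → Bool
    tree b e = KX e ∧ not (proj₁ two e xor b)
    tree-elim : ∀ {b e} → tree b e ≡ true → KX e ≡ true × proj₁ two e ≡ b
    tree-elim {b} {e} q with KX e | proj₁ two e | b
    ... | true | true | true = refl , refl
    ... | true | false | false = refl , refl
    tree-intro : ∀ {b e} → KX e ≡ true × proj₁ two e ≡ b → tree b e ≡ true
    tree-intro {true} (k , q) rewrite k | q = refl
    tree-intro {false} (k , q) rewrite k | q = refl
    trees : ∀ b → wt (tree b) (λ _ → 1) + wt (tree (not b)) (λ _ → 1) + 2 ≡ 2 * card (lookup X)
    trees b = trans (cong (_+ 2) (trans (sym (∑-+ _ _)) (trans (∑-cong λ e → pointwise (KX e) (proj₁ two e) b)
      (trans (sym (edges-all {ends = ends G} {KX} {lookup X} inside)) edges-KX)))) (tight-edges sparse saturated)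
      where
      pointwise : ∀ k c b → ind (k ∧ not (c xor b)) + ind (k ∧ not (c xor (not b))) ≡ ind k
      pointwise = from-yes (∀Bool? λ k → ∀Bool? λ c → ∀Bool? λ b →
        ind (k ∧ not (c xor b)) + ind (k ∧ not (c xor (not b))) ℕ.≟ ind k)
    large : ∀ b → card (lookup X) ≤ 1 + wt (tree b) (λ _ → 1)
    large b = connects-card {tree b} (λ e q → inside e (proj₁ (tree-elim {b} q)))
      λ p const → proj₂ two b p λ e q → const e (tree-intro q)
    -- If the ends of `e` stayed joined without it, deleting `e` would leave its class connected.
    -- The class would then have at least `|X|` edges and the other at least `|X| - 1`, one more in
    -- total than `2|X| - 2`.
    acyclic : ∀ i e → c e ≡ just i → ¬ Reach G (λ e′ → c e′ ≡ just i × e′ ≢ e) (src e) (tgt e)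
    acyclic i e e∈T reach = 1+n≰n {wt (tree b) (λ _ → 1) + wt (tree (not b)) (λ _ → 1) + 2}
      (≤-trans (≤-reflexive (cong suc (trees b))) (≤-trans (s≤s (≤-reflexive (double (card (lookup X)))))
        (≤-trans (s≤s (+-mono-≤ small (large (not b)))) (≤-reflexive arrange))))
      where
      b : Bool
      b = colour⁻¹ i
      T⁻ : Fin (nE G) → Bool
      T⁻ = del (tree b) e
      small : card (lookup X) ≤ wt (tree b) (λ _ → 1)
      small = ≤-trans (connects-card {T⁻} (λ g q → inside g (proj₁ (tree-elim {b} (del-⊑ {H = tree b} g q)))) still)
        (≤-reflexive (wt-del (λ _ → 1) (tree-intro (c-elim e∈T))))
        where
        still : Connects (ends G) (λ g → T⁻ g ≡ true) (lookup X)
        still p const = connects i p extended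
          where
          extended : ∀ g → c g ≡ just i → p (src g) ≡ p (tgt g)
          extended g q with g ≟ e
          ... | no g≢e = const g (del-intro {H = tree b} g≢e (tree-intro (c-elim q)))
          ... | yes refl = reach-const p (λ h (q , h≢e) → const h (del-intro {H = tree b} h≢e (tree-intro (c-elim q)))) reach
      double : ∀ k → 2 * k ≡ k + k
      double = solve-∀
      arrange : suc (wt (tree b) (λ _ → 1) + (1 + wt (tree (not b)) (λ _ → 1))) ≡
                wt (tree b) (λ _ → 1) + wt (tree (not b)) (λ _ → 1) + 2
      arrange = rearrange (wt (tree b) (λ _ → 1)) (wt (tree (not b)) (λ _ → 1))
        where
        rearrange : ∀ s t → suc (s + (1 + t)) ≡ s + t + 2
        rearrange = solve-∀

-- The components of G[W] and Ω₂ read off from a maximal sparse set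

length-filter : ∀ {A : Set} {k} (p : A → Bool) (g : Fin k → A) →
  length (filter (λ x → p x Bool.≟ true) (List.tabulate g)) ≡ ∑ λ i → ind (p (g i))
length-filter {k = zero} p g = sym (∑-empty _)
length-filter {k = suc k} p g with p (g zero) in q
... | true = trans (cong suc (length-filter p (g ∘ suc))) (trans (cong (λ b → ind b + ∑ λ i → ind (p (g (suc i)))) (sym q)) (sym (∑-suc λ i → ind (p (g i)))))
... | false = trans (length-filter p (g ∘ suc)) (trans (cong (λ b → ind b + ∑ λ i → ind (p (g (suc i)))) (sym q)) (sym (∑-suc λ i → ind (p (g i)))))

filter-filter : ∀ {A : Set} (p q : A → Bool) xs →
  filter (λ x → p x Bool.≟ true) (filter (λ x → q x Bool.≟ true) xs) ≡ filter (λ x → (q x ∧ p x) Bool.≟ true) xs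
filter-filter p q [] = refl
filter-filter p q (x ∷ xs) with q x
... | false = filter-filter p q xs
... | true with p x
... | true = cong (x ∷_) (filter-filter p q xs)
... | false = filter-filter p q xs

-- `blocked` is the maximality of `K` in G[W], in the form in which it is used: a tight set within
-- `W` prevents each missing edge from being added.
module Blocked (G : Graph) (W : Subset (nV G)) {K : Fin (nE G) → Bool} (sparse : Count.Sparse (ends G) K)
  (inside : ∀ e → K e ≡ true → Count.within (ends G) (lookup W) e ≡ true)
  (blocked : ∀ e → Count.within (ends G) (lookup W) e ≡ true → K e ≡ false →
             Count.Linked (ends G) K (lookup W) (proj₁ (ends G e)) (proj₂ (ends G e))) where
  open Count (ends G)
  open Parts (ends G)
  open Reachability G
  open Components G

  w : Fin (nV G) → Bool
  w = lookup W

  link : Fin (nV G) → Fin (nV G) → Set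
  link = Linked K w

  link-refl : ∀ {x} → w x ≡ true → link x x
  link-refl {x} p = single x , tight-single x , (λ v q → subst (λ u → w u ≡ true) (sym (≟-≡ q)) p) ,
    ≟-true {i = x} refl , ≟-true {i = x} refl

  link-sym : ∀ {x y} → link x y → link y x
  link-sym (X , t , s , p , q) = X , t , s , q , p

  link-trans : ∀ {x y z} → link x y → link y z → link x z
  link-trans (X , tX , sX , p , q) (Y , tY , sY , r , s) =
    X ∪ Y , tight-∪ sparse tX tY q r , ∪-⊑ {X = X} {Y} sX sY , ∨-introˡ p , ∨-introʳ {X _} s

  link-W : ∀ {x y} → link x y → w y ≡ true
  link-W (X , t , s , p , q) = s _ q

  linkers : Fin (nV G) → List (Fin (nV G))
  linkers v = filter (linked? K w v) (allFin (nV G))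

  -- Linked vertices have identical lists of linkers, so the head of the list is a canonical
  -- representative. The default concerns only vertices outside `W`, whose lists are empty.
  first : Fin (nV G) → List (Fin (nV G)) → Fin (nV G)
  first v [] = v
  first v (u ∷ _) = u

  r : Fin (nV G) → Fin (nV G)
  r v = first v (linkers v)

  link-r : ∀ {v} → w v ≡ true → link v (r v)
  link-r {v} p with linkers v in eq
  ... | [] = link-refl p
  ... | u ∷ us = proj₂ (∈-filter⁻ (linked? K w v) {xs = allFin (nV G)} (subst (u ∈_) (sym eq) (here refl)))

  first-nonempty : ∀ {x L} u v → x ∈ L → first u L ≡ first v L
  first-nonempty {L = _ ∷ _} u v _ = refl

  r-cong : ∀ {u v} → link u v → r u ≡ r v
  r-cong {u} {v} l = trans (cong (first u) same)
    (first-nonempty u v (subst (v ∈_) same (∈-filter⁺ (linked? K w u) (∈-allFin v) l)))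
    where
    same : linkers u ≡ linkers v
    same = filter-≐ (linked? K w u) (linked? K w v)
      ((λ m → link-trans (link-sym l) m) , (λ m → link-trans l m)) (allFin (nV G))

  r-W : ∀ {v} → w v ≡ true → w (r v) ≡ true
  r-W = link-W ∘ link-r

  r-idem : ∀ {v} → w v ≡ true → r (r v) ≡ r v
  r-idem = sym ∘ r-cong ∘ link-r

  r-linked : ∀ {u v} → w u ≡ true → w v ≡ true → r u ≡ r v → link u v
  r-linked {u} {v} p q eq = link-trans (link-r p) (link-sym (subst (link v) (sym eq) (link-r q)))

  class : Fin (nV G) → Fin (nV G) → Bool
  class v u = w u ∧ ⌊ r u ≟ r v ⌋

  -- The tight sets through `v` all meet in `v`, so they can be absorbed one after another into a
  -- single tight set until no linked vertex is missing.
  class-tight : ∀ {v} → w v ≡ true → Tight K (class v)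
  class-tight {v} v∈W =
    let (Q , t , s , v∈Q) , closed = iterate {Q = λ (Q , _) → ∀ u → link v u → Q u ≡ true}
          (λ (Q , _) → card (∁ᵇ Q)) grow (single v , tight-single v ,
            (λ u q → subst (λ u → w u ≡ true) (sym (≟-≡ q)) v∈W) , ≟-true {i = v} refl)
    in tight-resp (λ _ → refl) (agree (Q , t , s , v∈Q) closed) t
    where
    Partial : Set
    Partial = ∃ λ Q → Tight K Q × Q ⊑ w × Q v ≡ true
    grow : (P : Partial) → (∀ u → link v u → proj₁ P u ≡ true) ⊎
           ∃ λ (P′ : Partial) → card (∁ᵇ (proj₁ P′)) < card (∁ᵇ (proj₁ P))
    grow (Q , t , s , v∈Q) with any? (λ u → linked? K w v u ×-dec (Q u Bool.≟ false))
    ... | no none = inj₁ λ u l → Bool.¬-not λ q → none (u , l , q)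
    ... | yes (u , (X , tX , sX , v∈X , u∈X) , u∉Q) = inj₂
      ((Q ∪ X , tight-∪ sparse t tX v∈Q v∈X , ∪-⊑ {X = Q} {X} s sX , ∨-introˡ v∈Q) ,
       card-mono-< (∁-⊑ {X = Q} (λ _ → ∨-introˡ)) {u} (cong not (∨-introʳ {Q u} u∈X)) (cong not u∉Q))
    agree : ((Q , _) : Partial) → (∀ u → link v u → Q u ≡ true) → Q ≗ class v
    agree (Q , t , s , v∈Q) closed u with Q u in q
    ... | true = sym (∧-intro (s u q) (≟-true (r-cong (Q , t , s , q , v∈Q))))
    ... | false = sym (not≡true λ c → let u∈W , eq = ∧-elim {w u} c in
      true≢false (closed u (r-linked v∈W u∈W (sym (≟-≡ eq)))) q)

  lookup-class : ∀ v → lookup (classOf G W r v) ≗ class v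
  lookup-class v = lookup∘tabulate (class v)

  -- The classes inside `Z` are full already; `2 (parts - 1)` edges of `K` between them are exactly
  -- what `Z` needs to be tight.
  union-tight : ∀ Z → Z ⊑ w → (∀ u v → Z u ≡ true → w v ≡ true → r u ≡ r v → Z v ≡ true) →
    (∃ λ v → Z v ≡ true) → 2 * parts Z r ≤ 2 + cross K Z r → Tight K Z
  union-tight Z Z⊑W saturated nonempty few = tight nonempty (certify _ _
    (few ⊕ ≤-reflexive (sym (edges-fibres {K} ret classes)))
    (eq (edges K Z) (card Z) (parts Z r) (cross K Z r)))
    where
    ret : Retraction Z r
    ret = retraction (λ u q → saturated u (r u) q (r-W (Z⊑W u q)) (sym (r-idem (Z⊑W u q)))) (λ u q → r-idem (Z⊑W u q))
    classes : ∀ v → Z v ≡ true → r v ≡ v → edges K (fibre Z r v) + 2 ≡ 2 * card (fibre Z r v)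
    classes v v∈Z rv≡v = tight-edges sparse (tight-resp (λ _ → refl) same (class-tight (Z⊑W v v∈Z)))
      where
      same : class v ≗ fibre Z r v
      same u with ⌊ r u ≟ r v ⌋ in q
      ... | false = trans (Bool.∧-zeroʳ (w u)) (sym (trans (cong (Z u ∧_) (trans (cong (λ x → ⌊ r u ≟ x ⌋) (sym rv≡v)) q)) (Bool.∧-zeroʳ (Z u))))
      ... | true = trans (Bool.∧-identityʳ (w u)) (sym (trans (cong (Z u ∧_) (trans (cong (λ x → ⌊ r u ≟ x ⌋) (sym rv≡v)) q)) (trans (Bool.∧-identityʳ (Z u)) Z≡w)))
        where
        Z≡w : Z u ≡ w u
        Z≡w with Z u in z
        ... | true = sym (Z⊑W u z)
        ... | false = sym (not≡true λ p → true≢false (saturated v u v∈Z p (sym (≟-≡ q))) z)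
    eq : ∀ e c p x → 2 * c + (2 + x + (e + 2 * p)) ≡ e + 2 + (2 * p + (2 * c + x))
    eq = solve-∀

  numParts≡parts : numParts G W r ≡ parts w r
  numParts≡parts = trans (cong length (filter-filter (λ v → ⌊ r v ≟ v ⌋) w (allFin (nV G))))
    (length-filter (λ v → w v ∧ ⌊ r v ≟ v ⌋) (λ v → v))

  -- An edge of G[W] missing from `K` has linked ends, hence lies within one class. So G and `K`
  -- have the same crossing edges.
  crosses⇒K : ∀ {e} → crosses w r e ≡ true → K e ≡ true
  crosses⇒K {e} q with K e in k
  ... | true = refl
  ... | false = let e∈W , differ = ∧-elim {within w e} q in
    ⊥-elim (≟-≢ (not-true differ) (r-cong (blocked e e∈W k)))

  crossEdges≡cross : crossEdges G W r ≡ cross K w r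
  crossEdges≡cross = trans (length-filter (λ e → w (src e) ∧ w (tgt e) ∧ not ⌊ r (src e) ≟ r (tgt e) ⌋) (λ e → e))
    (∑-cong λ e → trans (cong ind (sym (Bool.∧-assoc (w (src e)) (w (tgt e)) _))) (pointwise e))
    where
    pointwise : ∀ e → ind (crosses w r e) ≡ K e ▷ ind (crosses w r e)
    pointwise e with crosses w r e in q
    ... | true = sym (cong (_▷ 1) (crosses⇒K {e} q))
    ... | false = ▷-0 true (K e)

  -- This is `Ω₂(G[W]) = 2|W| - e_K(W)` without subtraction.
  Ω-count : 2 * numParts G W r + edges K w ≡ 2 * card w + crossEdges G W r
  Ω-count = begin
    2 * numParts G W r + edges K w      ≡⟨ cong (λ k → 2 * k + edges K w) numParts≡parts ⟩
    2 * parts w r + edges K w           ≡⟨ +-comm _ (edges K w) ⟩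
    edges K w + 2 * parts w r           ≡⟨ edges-fibres {K} (retraction (λ _ → r-W) (λ _ → r-idem)) classes ⟩
    2 * card w + cross K w r            ≡⟨ cong (2 * card w +_) crossEdges≡cross ⟨
    2 * card w + crossEdges G W r       ∎
    where
    open ≡-Reasoning
    classes : ∀ v → w v ≡ true → r v ≡ v → edges K (fibre w r v) + 2 ≡ 2 * card (fibre w r v)
    classes v p rv≡v = tight-edges sparse (tight-resp (λ _ → refl)
      (λ u → cong (λ x → w u ∧ ⌊ r u ≟ x ⌋) rv≡v) (class-tight p))

  -- Let `Z` be the union of the classes meeting `Y`. Each of the two trees connects the classes of
  -- `Z`, so it has at least `parts - 1` crossing edges. The trees are disjoint and their crossing
  -- edges belong to `K`, which makes `Z` tight.
  trees-linked : ∀ {Y} → Y ⊆ₛ W → TreeConnected G 2 Y → ∀ {u v} → u ∈ₛ Y → v ∈ₛ Y → link u v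
  trees-linked {Y} Y⊆W (c , trees) {u} {v} u∈Y v∈Y =
    Z , union-tight Z (λ x → proj₁ ∘ ∧-elim) closed (u , Y⊆Z u∈Y) few , (λ x → proj₁ ∘ ∧-elim) , Y⊆Z u∈Y , Y⊆Z v∈Y
    where
    Y? : ∀ x → Dec (∃ λ y → lookup Y y ≡ true × r x ≡ r y)
    Y? x = any? λ y → (lookup Y y Bool.≟ true) ×-dec (r x ≟ r y)
    Z : Fin (nV G) → Bool
    Z x = w x ∧ ⌊ Y? x ⌋
    Y⊆Z : ∀ {x} → x ∈ₛ Y → Z x ≡ true
    Y⊆Z {x} p = ∧-intro ([]=⇒lookup (Y⊆W p)) (⌊⌋-intro (Y? x) (x , []=⇒lookup p , refl))
    closed : ∀ x y → Z x ≡ true → w y ≡ true → r x ≡ r y → Z y ≡ true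
    closed x y p q eq = let y′ , y′∈Y , eq′ = ⌊⌋-elim (Y? x) (proj₂ (∧-elim {w x} p)) in
      ∧-intro q (⌊⌋-intro (Y? y) (y′ , y′∈Y , trans (sym eq) eq′))
    T : Fin 2 → Fin (nE G) → Bool
    T i e = ⌊ ≡-dec _≟_ (c e) (just i) ⌋
    T-elim : ∀ {i e} → T i e ≡ true → c e ≡ just i
    T-elim {i} {e} = ⌊⌋-elim (≡-dec _≟_ (c e) (just i))
    T-intro : ∀ {i e} → c e ≡ just i → T i e ≡ true
    T-intro {i} {e} = ⌊⌋-intro (≡-dec _≟_ (c e) (just i))
    ret : Retraction Z r
    ret = retraction (λ x p → closed x (r x) p (r-W (proj₁ (∧-elim p))) (sym (r-idem (proj₁ (∧-elim p)))))
                     (λ x p → r-idem (proj₁ (∧-elim p)))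
    inside-Z : ∀ i e → T i e ≡ true → within Z e ≡ true
    inside-Z i e q = let s , t = proj₁ (trees i) e (T-elim {i} q) in ∧-intro (Y⊆Z s) (Y⊆Z t)
    connects : ∀ i → ConnectsParts (T i) Z r
    connects i p const-r const-T x y x∈Z y∈Z =
      let x′ , x′∈Y , eqx = ⌊⌋-elim (Y? x) (proj₂ (∧-elim {w x} x∈Z))
          y′ , y′∈Y , eqy = ⌊⌋-elim (Y? y) (proj₂ (∧-elim {w y} y∈Z))
          x′∈ = lookup⇒[]= x′ Y x′∈Y ; y′∈ = lookup⇒[]= y′ Y y′∈Y
      in begin
        p x       ≡⟨ const-r x x∈Z ⟨
        p (r x)   ≡⟨ cong p eqx ⟩
        p (r x′)  ≡⟨ const-r x′ (Y⊆Z x′∈) ⟩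
        p x′      ≡⟨ reach-const p (λ e q → const-T e (T-intro {i} q)) (proj₁ (proj₂ (trees i)) x′ y′ x′∈ y′∈) ⟩
        p y′      ≡⟨ const-r y′ (Y⊆Z y′∈) ⟨
        p (r y′)  ≡⟨ cong p eqy ⟨
        p (r y)   ≡⟨ const-r y y∈Z ⟩
        p y       ∎
      where open ≡-Reasoning
    bound : ∀ i → parts Z r ≤ 1 + cross (T i) Z r
    bound i = parts-bound (parts Z r) r ≤-refl ret (inside-Z i) (connects i)
    crossings : cross (T zero) Z r + cross (T (suc zero)) Z r ≤ cross K Z r
    crossings = ≤-trans (≤-reflexive (sym (∑-+ _ _))) (∑-mono pointwise)
      where
      disjoint : ∀ e → T zero e ≡ true → T (suc zero) e ≡ true → ⊥
      disjoint e p q with trans (sym (T-elim {zero} {e} p)) (T-elim {suc zero} {e} q)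
      ... | ()
      pointwise : ∀ e → T zero e ▷ ind (crosses Z r e) + T (suc zero) e ▷ ind (crosses Z r e) ≤ K e ▷ ind (crosses Z r e)
      pointwise e with crosses Z r e in q
      ... | false = ≤-reflexive (cong₂ _+_ (▷-0 (T zero e) false) (trans (▷-0 (T (suc zero) e) false) (▷-0 false (K e))))
      ... | true rewrite crosses⇒K {e} (∧-intro (within-mono {Z} {w} (λ x → proj₁ ∘ ∧-elim) e (proj₁ (∧-elim {within Z e} q))) (proj₂ (∧-elim {within Z e} q)))
        with T zero e in p₀ | T (suc zero) e in p₁
      ... | true | true = ⊥-elim (disjoint e p₀ p₁)
      ... | true | false = ≤-refl
      ... | false | true = ≤-refl
      ... | false | false = z≤n
    few : 2 * parts Z r ≤ 2 + cross K Z r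
    few = certify _ _ (bound zero ⊕ bound (suc zero) ⊕ crossings)
      (eq (parts Z r) (cross (T zero) Z r) (cross (T (suc zero)) Z r) (cross K Z r))
      where
      eq : ∀ p a b k → 2 * p + (1 + a + (1 + b + k)) ≡ 2 + k + (p + (p + (a + b)))
      eq = solve-∀

  component-rep : IsComponentRep G 2 W r
  component-rep v v∈W = lookup⇒[]= _ W (r-W v∈w) , r-idem v∈w , class⊆W , (v , v∈class) ,
    tight⇒treeConnected {K} sparse (tight-resp (λ _ → refl) (sym ∘ lookup-class v) (class-tight v∈w)) , maximal
    where
    v∈w : w v ≡ true
    v∈w = []=⇒lookup v∈W
    C : Subset (nV G)
    C = classOf G W r v
    class-elim : ∀ {u} → u ∈ₛ C → class v u ≡ true
    class-elim {u} p = trans (sym (lookup-class v u)) ([]=⇒lookup p)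
    class-intro : ∀ {u} → class v u ≡ true → u ∈ₛ C
    class-intro {u} p = lookup⇒[]= u C (trans (lookup-class v u) p)
    class⊆W : C ⊆ₛ W
    class⊆W {u} p = lookup⇒[]= u W (proj₁ (∧-elim (class-elim p)))
    v∈class : v ∈ₛ C
    v∈class = class-intro (∧-intro v∈w (≟-true {i = r v} refl))
    maximal : ∀ Y → C ⊆ₛ Y → Y ⊆ₛ W → TreeConnected G 2 Y → Y ⊆ₛ C
    maximal Y C⊆Y Y⊆W tc {u} u∈Y = class-intro (∧-intro ([]=⇒lookup (Y⊆W u∈Y))
      (≟-true (r-cong (trees-linked Y⊆W tc u∈Y (C⊆Y v∈class)))))

-- Local changes of a sparse set inside tight sets

module Exchange {n m : ℕ} (ends : Fin m → Fin n × Fin n) where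
  open Count ends

  full : Fin n → Bool
  full _ = true

  record Saturated (K : Fin m → Bool) (W : Fin n → Bool) : Set where
    field
      sparse  : Sparse K
      inside  : ∀ e → K e ≡ true → within W e ≡ true
      blocked : ∀ e → within W e ≡ true → K e ≡ false → Linked K W (src e) (tgt e)

  saturated-resp : ∀ {K W W′} → W ≗ W′ → Saturated K W → Saturated K W′
  saturated-resp {K} {W} {W′} same sat = record
    { sparse  = sparse
    ; inside  = λ e k → trans (sym (same-within e)) (inside e k)
    ; blocked = λ e p k → let X , t , s , q = blocked e (trans (same-within e) p) k in
        X , t , (λ v x → trans (sym (same v)) (s v x)) , q
    }
    where
    open Saturated sat
    same-within : ∀ e → within W e ≡ within W′ e
    same-within e = cong₂ _∧_ (same (src e)) (same (tgt e))

  saturate : ∀ {K W} → Sparse K → (∀ e → K e ≡ true → within W e ≡ true) →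
             ∃ λ K′ → K ⊑ K′ × Saturated K′ W
  saturate {K} {W} sparse inside =
    let (K′ , K⊑K′ , sparse′ , inside′) , blocked = iterate
          {Q = λ (K′ , _) → ∀ e → within W e ≡ true → K′ e ≡ false → Linked K′ W (src e) (tgt e)}
          (λ (K′ , _) → card (∁ᵇ K′)) grow (K , ⊑-refl , sparse , inside)
    in K′ , K⊑K′ , record { sparse = sparse′ ; inside = inside′ ; blocked = blocked }
    where
    Extension : Set
    Extension = ∃ λ K′ → K ⊑ K′ × Sparse K′ × (∀ e → K′ e ≡ true → within W e ≡ true)
    -- A blocking tight set may leave `W`, but all edges of `K′` lie in `W`: intersecting with `W`
    -- drops vertices and keeps every edge.
    restrict-tight : ∀ {K′ X e} → (∀ e → K′ e ≡ true → within W e ≡ true) → within W e ≡ true →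
                     Tight K′ X → within X e ≡ true → Linked K′ W (src e) (tgt e)
    restrict-tight {K′} {X} {e} inside e∈W (tight _ t) e∈X =
      X ∩ W , tight (src e , s) bound , (λ v → proj₂ ∘ ∧-elim {X v}) , s ,
      ∧-intro (proj₂ (∧-elim {X (src e)} e∈X)) (proj₂ (∧-elim {W (src e)} e∈W))
      where
      s : X (src e) ∧ W (src e) ≡ true
      s = ∧-intro (proj₁ (∧-elim {X (src e)} e∈X)) (proj₁ (∧-elim {W (src e)} e∈W))
      pointwise : ∀ g → K′ g ▷ ind (within X g) ≤ K′ g ▷ ind (within (X ∩ W) g)
      pointwise g with K′ g in k
      ... | false = z≤n
      ... | true = ind-mono λ q → let a , b = ∧-elim {X (src g)} q ; c , d = ∧-elim {W (src g)} (inside g k) in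
        ∧-intro (∧-intro a c) (∧-intro b d)
      bound : 2 * card (X ∩ W) ≤ edges K′ (X ∩ W) + 2
      bound = ≤-trans (*-monoʳ-≤ 2 (wt-mono {H = X ∩ W} {X} (λ v → proj₁ ∘ ∧-elim) λ _ → ≤-refl))
        (≤-trans t (+-monoˡ-≤ 2 (∑-mono pointwise)))
    grow : (E : Extension) → (∀ e → within W e ≡ true → proj₁ E e ≡ false → Linked (proj₁ E) W (src e) (tgt e)) ⊎
           ∃ λ (E′ : Extension) → card (∁ᵇ (proj₁ E′)) < card (∁ᵇ (proj₁ E))
    grow (K′ , K⊑K′ , sparse , inside)
      with any? (λ e → (within W e Bool.≟ true) ×-dec (K′ e Bool.≟ false) ×-dec ¬? (linked? K′ W (src e) (tgt e)))
    ... | no none = inj₁ λ e p q → decide e p q (linked? K′ W (src e) (tgt e))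
      where
      decide : ∀ e → within W e ≡ true → K′ e ≡ false → Dec (Linked K′ W (src e) (tgt e)) → Linked K′ W (src e) (tgt e)
      decide e p q (yes l) = l
      decide e p q (no ¬l) = ⊥-elim (none (e , p , q , ¬l))
    ... | yes (e , e∈W , e∉K′ , free) = inj₂ ((add K′ e , (λ g → ∨-introʳ {⌊ g ≟ e ⌋} ∘ K⊑K′ g) ,
        sparse-add {ends = ends} {ends} {K′} (λ _ _ → refl) e∉K′ sparse
          (λ X t → not≡true λ q → free (restrict-tight {K′} inside e∈W t q)) , inside′) ,
        card-mono-< (∁-⊑ {X = K′} λ g → ∨-introʳ {⌊ g ≟ e ⌋}) {e} (cong not (add-self K′ e)) (cong not e∉K′))
      where
      inside′ : ∀ g → add K′ e g ≡ true → within W g ≡ true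
      inside′ g q with g ≟ e
      ... | yes refl = e∈W
      ... | no _ = inside g q

  AgreeOff : (Fin n → Bool) → (Fin m → Bool) → (Fin m → Bool) → Set
  AgreeOff X A B = ∀ e → within X e ≡ false → A e ≡ B e

  outside : ∀ {X : Fin n → Bool} {v} → X v ≡ false → ∀ {u} → X u ≡ true → u ≢ v
  outside v∉X u∈X refl = true≢false u∈X v∉X

  deg-agree : ∀ X {A B} → AgreeOff X A B → ∀ {v} → X v ≡ false → deg A v ≡ deg B v
  deg-agree X {A} {B} agree {v} v∉X = ∑-cong pointwise
    where
    pointwise : ∀ e → A e ▷ inc v e ≡ B e ▷ inc v e
    pointwise e with within X e in q
    ... | false = cong (_▷ inc v e) (agree e q)
    ... | true rewrite ≟-false (outside {X} v∉X (proj₁ (∧-elim q))) | ≟-false (outside {X} v∉X (proj₂ (∧-elim {X (src e)} q)))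
      = ▷-0 (A e) (B e)

  -- The edges not inside `X` coincide and the totals are equal, so the numbers inside agree as
  -- well. Hence a swap within a tight set keeps that set tight.
  edges-agree : ∀ X {A B} → AgreeOff X A B → wt A (λ _ → 1) ≡ wt B (λ _ → 1) → edges A X ≡ edges B X
  edges-agree X {A} {B} agree eq = +-cancelˡ-≡ (wt B λ _ → 1) _ _ (begin
    wt B (λ _ → 1) + edges A X ≡⟨ ∑-+ _ _ ⟨
    _                          ≡⟨ ∑-cong pointwise ⟩
    _                          ≡⟨ ∑-+ _ _ ⟩
    wt A (λ _ → 1) + edges B X ≡⟨ cong (_+ edges B X) eq ⟩
    wt B (λ _ → 1) + edges B X ∎)
    where
    open ≡-Reasoning
    pointwise : ∀ e → B e ▷ 1 + A e ▷ ind (within X e) ≡ A e ▷ 1 + B e ▷ ind (within X e)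
    pointwise e with within X e in q
    ... | true = +-comm (B e ▷ 1) _
    ... | false rewrite agree e q = refl

  edges-agree-disjoint : ∀ X Y {A B} → AgreeOff X A B → (∀ v → X v ≡ true → Y v ≡ true → ⊥) → edges A Y ≡ edges B Y
  edges-agree-disjoint X Y {A} {B} agree disjoint = ∑-cong pointwise
    where
    pointwise : ∀ e → A e ▷ ind (within Y e) ≡ B e ▷ ind (within Y e)
    pointwise e with within Y e in q
    ... | false = ▷-0 (A e) (B e)
    ... | true = cong (_▷ 1) (agree e (not≡true λ p → disjoint (src e) (proj₁ (∧-elim p)) (proj₁ (∧-elim q))))

  tight-edges-≡ : ∀ {A B X} → edges A X ≡ edges B X → Tight A X → Tight B X
  tight-edges-≡ {X = X} eq (tight v t) = tight v (subst (λ k → 2 * card X ≤ k + 2) eq t)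

  -- Otherwise deleting z from Q would leave a set with too many edges.
  edge-at : ∀ {C Q} → Sparse C → Tight C Q → ∀ {x z} → Q x ≡ true → Q z ≡ true → x ≢ z →
            ∃ λ f → C f ≡ true × within Q f ≡ true × 1 ≤ inc z f
  edge-at {C} {Q} sparse (tight _ t) {x} {z} x∈Q z∈Q x≢z with ∑-witness
    {f = λ f → C f ▷ ind (within (del Q z) f)} {λ f → C f ▷ ind (within Q f)} fewer
    where
    fewer : edges C (del Q z) < edges C Q
    fewer = certify _ _ (sparse (del Q z) x (del-intro {H = Q} x≢z x∈Q) ⊕ t ⊕ ≤-reflexive (wt-del {H = Q} (λ _ → 1) z∈Q)
        ⊕ ≤-reflexive (wt-del {H = Q} (λ _ → 1) z∈Q) ⊕ z≤n {1})
      (eq (edges C (del Q z)) (edges C Q) (card Q) (card (del Q z)))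
      where
      eq : ∀ e e′ c c′ → suc e + (2 * c′ + (e′ + 2 + (c + (c + 1)))) ≡ e′ + (e + 2 + (2 * c + (1 + c′ + (1 + c′ + 0))))
      eq = solve-∀
  ... | f , p with C f in c | within Q f in q | src f ≟ z | tgt f ≟ z
  ... | true | true | yes s | _ = f , c , q , ≤-trans (≤-reflexive (cong ind (sym (≟-true s)))) (m≤m+n _ _)
  ... | true | true | no _ | yes t = f , c , q , ≤-trans (≤-reflexive (cong ind (sym (≟-true t)))) (m≤n+m _ _)
  ... | true | true | no _ | no _ rewrite q = contradiction p λ { (s≤s ()) }

  module Descent (h : Fin n → ℕ) {H : Fin m → Bool} (sparse : Sparse H) (base : Tight H full) where

    -- Under this bound no excess over `h` can grow, yet a vertex below `h` may use its free room.
    -- At a vertex above `h`, falling strictly below the cap lowers the excess.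
    cap : Fin n → ℕ
    cap v = h v ⊔ deg H v

    record Swap (X : Fin n → Bool) (z : Fin n) (H′ : Fin m → Bool) : Set where
      constructor swap
      field
        sparse′ : Sparse H′
        size    : wt H′ (λ _ → 1) ≡ wt H (λ _ → 1)
        agree   : AgreeOff X H′ H
        capped  : ∀ v → deg H′ v ≤ cap v
        strict  : deg H′ z < cap z

    Release : (Fin n → Bool) → Fin n → Set
    Release U z = ∃ λ X → Tight H X × X z ≡ true × X ⊑ U × ∃ (Swap X z)

    opaque
      swap? : ∀ X z H′ → Dec (Swap X z H′)
      swap? X z H′ = map′ (λ (a , b , c , d , e) → swap a b c d e) (λ (swap a b c d e) → a , b , c , d , e)
        (sparse? H′ ×-dec (wt H′ (λ _ → 1) ℕ.≟ wt H (λ _ → 1)) ×-dec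
         all? (λ e → (within X e Bool.≟ false) →-dec (H′ e Bool.≟ H e)) ×-dec
         all? (λ v → deg H′ v ≤? cap v) ×-dec (deg H′ z <? cap z))

      release? : ∀ U z → Dec (Release U z)
      release? U z = anyFun?
        (λ {X} {Y} p (t , a , s , H′ , swap b c d e f) → tight-resp (λ _ → refl) p t , trans (sym (p z)) a , ⊑-resp p s ,
          H′ , swap b c (λ g q → d g (trans (cong₂ _∧_ (p (src g)) (p (tgt g))) q)) e f)
        (λ X → tight? H X ×-dec (X z Bool.≟ true) ×-dec ⊑-dec X U ×-dec
          anyFun? (λ {A} {B} p (swap b c d e f) → swap (sparse-⊑ {B} {A} (λ g q → trans (p g) q) b)
                     (trans (sym (wt-cong p)) c) (λ g q → trans (sym (p g)) (d g q))
                     (λ v → subst (_≤ cap v) (wt-cong p) (e v)) (subst (_< cap z) (wt-cong p) f))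
                  (swap? X z))

    -- All that is needed of the order in which the vertices outside W were removed: any set not
    -- inside W contains a vertex that could not be released at an earlier stage U, when Q ⊑ U still held.
    Anchored : (Fin n → Bool) → Set
    Anchored W = ∀ Q → (∃ λ v → Q v ≡ true × W v ≡ false) →
      ∃ λ z → ∃ λ U → Q z ≡ true × W z ≡ false × W ⊑ U × Q ⊑ U × ¬ Release U z

    -- Exchanging e with an edge f at z inside the minimal tight set Q.
    release-at : ∀ {C e} → let x = src e ; y = tgt e in Sparse C → wt C (λ _ → 1) ≡ wt H (λ _ → 1) →
      (∀ v → deg C v ≤ cap v) → deg C x < cap x → deg C y < cap y → C e ≡ false → x ≢ y →
      ∀ {V} → AgreeOff V C H → ∀ {Q} → Minimal C x y Q → Q ⊑ V →
      ∀ {z} → Q z ≡ true → x ≢ z → y ≢ z → ∃ (Swap V z)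
    release-at {C} {e} C-sparse C-size C-capped C-x C-y e∉C x≢y {V} C-agree {Q} minimal@(C-Q , x∈Q , y∈Q , _) Q⊑V {z} z∈Q x≢z y≢z =
      exchange (edge-at C-sparse C-Q x∈Q z∈Q x≢z)
      where
      x y : Fin n
      x = src e
      y = tgt e
      inc-other : ∀ {v} → x ≢ v → y ≢ v → inc v e ≡ 0
      inc-other p q = cong₂ (λ a b → ind a + ind b) (≟-false p) (≟-false q)
      inc-end : ∀ {v} → x ≢ v ⊎ y ≢ v → inc v e ≤ 1
      inc-end (inj₁ p) = ≤-trans (≤-reflexive (cong (λ a → ind a + ind ⌊ y ≟ _ ⌋) (≟-false p))) (ind≤1 _)
      inc-end (inj₂ q) = ≤-trans (≤-reflexive (trans (cong (λ a → ind ⌊ x ≟ _ ⌋ + ind a) (≟-false q)) (+-identityʳ _))) (ind≤1 _)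
      -- Adding `e` costs one unit of degree at each of its distinct ends, which is the room left by
      -- the strict bounds there.
      capped : ∀ v → Dec (x ≡ v) → Dec (y ≡ v) → inc v e + deg C v ≤ cap v
      capped v (no p) (no q) = subst (λ k → k + deg C v ≤ cap v) (sym (inc-other p q)) (C-capped v)
      capped v (yes refl) _ = ≤-trans (+-monoˡ-≤ (deg C v) (inc-end (inj₂ λ q → x≢y (sym q)))) C-x
      capped v (no _) (yes refl) = ≤-trans (+-monoˡ-≤ (deg C v) (inc-end (inj₁ x≢y))) C-y
      exchange : (∃ λ f → C f ≡ true × within Q f ≡ true × 1 ≤ inc z f) → ∃ (Swap V z)
      exchange (f , f∈C , f∈Q , f-at-z) = D , swap D-sparse D-size D-agree D-capped D-z
        where
        D : Fin m → Bool
        D = del (add C e) f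
        D-sparse : Sparse D
        D-sparse = sparse-exchange C-sparse e∉C f∈C minimal f∈Q
        change : ∀ k → k f + wt D k ≡ k e + wt C k
        change k = trans (wt-del {H = add C e} k (∨-introʳ {⌊ f ≟ e ⌋} f∈C)) (wt-add {H = C} k e∉C)
        D-size : wt D (λ _ → 1) ≡ wt H (λ _ → 1)
        D-size = trans (suc-injective (change (λ _ → 1))) C-size
        D-agree : AgreeOff V D H
        D-agree g q = trans (del-other {H = add C e} g≢f) (trans (add-other {H = C} g≢e) (C-agree g q))
          where
          g≢f : g ≢ f
          g≢f g≡f = true≢false (within-mono {Q} {V} Q⊑V f f∈Q) (trans (cong (within V) (sym g≡f)) q)
          g≢e : g ≢ e
          g≢e g≡e = true≢false (∧-intro (Q⊑V x x∈Q) (Q⊑V y y∈Q)) (trans (cong (within V) (sym g≡e)) q)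
        D-deg : ∀ v → deg D v ≤ inc v e + deg C v
        D-deg v = ≤-trans (m≤n+m _ (inc v f)) (≤-reflexive (change (inc v)))
        D-capped : ∀ v → deg D v ≤ cap v
        D-capped v = ≤-trans (D-deg v) (capped v (x ≟ v) (y ≟ v))
        -- The removed edge `f` meets `z` and the added edge `e` does not, so one unit is gained at
        -- `z`.
        D-z : deg D z < cap z
        D-z = ≤-trans (+-monoˡ-≤ (deg D z) f-at-z)
          (≤-trans (≤-reflexive (trans (change (inc z)) (cong (_+ deg C z) (inc-other x≢z y≢z)))) (C-capped z))

    -- Disjointness allows the two swaps to be spliced into one sparse set `C` with room for `e` at
    -- both ends. The minimal tight set closed by `e` is then sought in `C`, not in `H`, and
    -- transferred back to `H` at the end.
    module Combine {W : Fin n → Bool} (anchored : Anchored W) {e : Fin m} (e∉H : H e ≡ false)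
      {X Y : Fin n → Bool} (tX : Tight H X) (tY : Tight H Y) (x∈X : X (src e) ≡ true) (y∈Y : Y (tgt e) ≡ true)
      (X⊑W : X ⊑ W) (Y⊑W : Y ⊑ W) {Hx Hy : Fin m → Bool} (sx : Swap X (src e) Hx) (sy : Swap Y (tgt e) Hy)
      (disjoint : ∀ v → X v ≡ true → Y v ≡ true → ⊥) where

      private
        module Sx = Swap sx
        module Sy = Swap sy
        x y : Fin n
        x = src e
        y = tgt e

        C : Fin m → Bool
        C = splice Hx Hy Y

        x∉Y : Y x ≡ false
        x∉Y = not≡true (disjoint x x∈X)

        y∉X : X y ≡ false
        y∉X = not≡true λ p → disjoint y p y∈Y

        edges-HxY : edges Hx Y ≡ edges H Y
        edges-HxY = edges-agree-disjoint X Y Sx.agree disjoint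

        edges-HyY : edges Hy Y ≡ edges Hx Y
        edges-HyY = trans (edges-agree Y Sy.agree Sy.size) (sym edges-HxY)

        C-sparse : Sparse C
        C-sparse = sparse-splice {Hx} {Hy} {Y} Sx.sparse′ (tight-edges-≡ (sym edges-HxY) tY) Sy.sparse′ edges-HyY

        C-size : wt C (λ _ → 1) ≡ wt H (λ _ → 1)
        C-size = trans (edges-splice-⊒ Hx Hy {Y} {full} (λ _ _ → refl) edges-HyY) Sx.size

        C-Hx : AgreeOff Y C Hx
        C-Hx g q rewrite q = refl

        C-Hy : AgreeOff X C Hy
        C-Hy g q with within Y g in r
        ... | true = refl
        ... | false = trans (Sx.agree g q) (sym (Sy.agree g r))

        C-H : ∀ {V} → X ⊑ V → Y ⊑ V → AgreeOff V C H
        C-H {V} X⊑V Y⊑V g q = trans (C-Hx g (off Y⊑V)) (Sx.agree g (off X⊑V))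
          where
          off : ∀ {Z} → Z ⊑ V → within Z g ≡ false
          off {Z} Z⊑V = not≡true λ p → true≢false (within-mono {Z} {V} Z⊑V g p) q

        C-capped : ∀ v → deg C v ≤ cap v
        C-capped v = by (Y v) refl
          where
          by : ∀ b → Y v ≡ b → deg C v ≤ cap v
          by false q = subst (_≤ cap v) (sym (deg-agree Y C-Hx q)) (Sx.capped v)
          by true q = subst (_≤ cap v) (sym (deg-agree X C-Hy (not≡true λ p → disjoint v p q))) (Sy.capped v)

        C-x : deg C x < cap x
        C-x = subst (_< cap x) (sym (deg-agree Y C-Hx x∉Y)) Sx.strict

        C-y : deg C y < cap y
        C-y = subst (_< cap y) (sym (deg-agree X C-Hy y∉X)) Sy.strict

        e∉C : C e ≡ false
        e∉C = trans (C-Hx e (cong (_∧ Y y) x∉Y)) (trans (Sx.agree e (trans (cong (X x ∧_) y∉X) (Bool.∧-zeroʳ (X x)))) e∉H)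

        C-X : Tight C X
        C-X = tight-edges-≡ (sym (trans (edges-splice-disjoint Hx Hy {Y} {X} disjoint) (edges-agree X Sx.agree Sx.size))) tX

        C-Y : Tight C Y
        C-Y = tight-edges-≡ (sym (trans (edges-splice-⊑ Hx Hy {Y} {Y} ⊑-refl) (trans edges-HyY edges-HxY))) tY

        -- The swaps keep the number of edges, so the whole vertex set stays tight; this guarantees
        -- that some tight set contains both ends of `e`.
        C-full : Tight C full
        C-full = tight-edges-≡ {H} {C} {full} (sym C-size) base

      combined : Linked H W x y
      combined = build (minimal-tight C-sparse C-full refl refl)
        where
        build : ∃ (Minimal C x y) → Linked H W x y
        build (Q , minimal@(C-Q , x∈Q , y∈Q , _)) = V , V-tight , V⊑ Q⊑W ⊑-refl , Q⊑V x x∈Q , Q⊑V y y∈Q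
          where
          -- `Q` is tight for `C` only. Joining it with `X` and `Y` encloses every edge on which `C`
          -- and `H` differ, so the union is tight for `H` too.
          V : Fin n → Bool
          V = (Q ∪ X) ∪ Y
          Q⊑V : Q ⊑ V
          Q⊑V v = ∨-introˡ ∘ ∨-introˡ
          X⊑V : X ⊑ V
          X⊑V v = ∨-introˡ ∘ ∨-introʳ {Q v}
          Y⊑V : Y ⊑ V
          Y⊑V v = ∨-introʳ {Q v ∨ X v}
          V⊑ : ∀ {U} → Q ⊑ U → W ⊑ U → V ⊑ U
          V⊑ {U} Q⊑U W⊑U = ∪-⊑ {X = Q ∪ X} {Y} (∪-⊑ {X = Q} {X} Q⊑U (λ v → W⊑U v ∘ X⊑W v)) (λ v → W⊑U v ∘ Y⊑W v)
          V-tight : Tight H V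
          V-tight = tight-edges-≡ (edges-agree V (C-H {V} X⊑V Y⊑V) C-size)
            (tight-∪ C-sparse (tight-∪ C-sparse C-Q C-X x∈Q x∈X) C-Y {y} (∨-introˡ y∈Q) y∈Y)
          Q⊑W : Q ⊑ W
          Q⊑W = from (⊑? Q W)
            where
            from : Q ⊑ W ⊎ (∃ λ v → Q v ≡ true × W v ≡ false) → Q ⊑ W
            from (inj₁ h) = h
            -- At the stage `U` at which `z` was stuck, the tight set `V` still lies in `U`, and
            -- exchanging `e` for an edge at `z` would release `z` there.
            from (inj₂ escape) = let z , U , z∈Q , z∉W , W⊑U , Q⊑U , stuck = anchored Q escape in
              ⊥-elim (stuck (V , V-tight , Q⊑V z z∈Q , V⊑ Q⊑U W⊑U ,
                release-at {C} {e} C-sparse C-size C-capped C-x C-y e∉C (outside {X} y∉X x∈X) {V} (C-H {V} X⊑V Y⊑V)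
                  {Q} minimal Q⊑V z∈Q (outside {W} z∉W (X⊑W x x∈X)) (outside {W} z∉W (Y⊑W y y∈Y))))

    -- This yields the maximality of `H` in G[W]. If the two releasing sets meet, their union
    -- already links the ends of `e`; only disjoint ones need the exchange argument.
    released⇒linked : ∀ {W} → Anchored W → ∀ {e} → H e ≡ false →
                      Release W (src e) → Release W (tgt e) → Linked H W (src e) (tgt e)
    released⇒linked {W} anchored {e} e∉H (X , tX , x∈X , X⊑W , Hx , sx) (Y , tY , y∈Y , Y⊑W , Hy , sy)
      with any? (λ v → (X v ∧ Y v) Bool.≟ true)
    ... | yes (v , p) = X ∪ Y , tight-∪ sparse tX tY (proj₁ (∧-elim {X v} p)) (proj₂ (∧-elim {X v} p)) ,
      ∪-⊑ {X = X} {Y} X⊑W Y⊑W , ∨-introˡ x∈X , ∨-introʳ {X (tgt e)} y∈Y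
    ... | no none = Combine.combined anchored e∉H tX tY x∈X y∈Y X⊑W Y⊑W sx sy (λ v p q → none (v , ∧-intro p q))

-- Removing the vertices that cannot be released

module Core {n m : ℕ} (ends : Fin m → Fin n × Fin n) (h : Fin n → ℕ) {H : Fin m → Bool}
  (sparse : Count.Sparse ends H) (base : Count.Tight ends H λ _ → true) where
  open Count ends
  open Exchange ends
  open Descent h sparse base

  Closed : (Fin n → Bool) → Set
  Closed W = Anchored W × (∀ v → W v ≡ false → h v ≤ deg H v)

  core : ∃ λ W → Closed W × (∀ v → W v ≡ true → Release W v)
  core = let (W , closed) , released = iterate {Q = λ (W , _) → ∀ v → W v ≡ true → Release W v}
                (λ (W , _) → card W) shrink (full , (λ { Q (v , _ , ()) }) , λ { v () })
         in W , closed , released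
    where
    anchored-del : ∀ {W u} → W u ≡ true → ¬ Release W u → Anchored W → Anchored (del W u)
    anchored-del {W} {u} u∈W stuck anchored Q (v , v∈Q , v∉W′) with ⊑? Q W
    ... | inj₂ escape = let z , U , z∈Q , z∉W , W⊑U , Q⊑U , s = anchored Q escape in
      z , U , z∈Q , not≡true (λ q → true≢false (del-⊑ {H = W} z q) z∉W) , ⊑-trans {X = del W u} {W} {U} (del-⊑ {H = W}) W⊑U , Q⊑U , s
    -- Here `Q` lies in `W` but not in the smaller set, so it contains `u`, and the stage to report
    -- is `W` itself.
    ... | inj₁ Q⊑W with v ≟ u
    ... | yes refl = v , W , v∈Q , not≡true (λ q → del-≢ {H = W} q refl) , del-⊑ {H = W} , Q⊑W , stuck
    ... | no _ = ⊥-elim (true≢false (Q⊑W v v∈Q) v∉W′)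
    -- A vertex of degree below its cap is released by `H` itself on a single-vertex tight set. So a
    -- stuck vertex has degree at least its cap, hence at least `h`.
    stuck-degree : ∀ {W u} → W u ≡ true → ¬ Release W u → h u ≤ deg H u
    stuck-degree {W} {u} u∈W stuck = ≤-trans (m≤m⊔n (h u) (deg H u)) (≮⇒≥ λ below → stuck
      (single u , tight-single u , ≟-true {i = u} refl , (λ v q → subst (λ v → W v ≡ true) (sym (≟-≡ q)) u∈W) ,
       H , swap sparse refl (λ _ _ → refl) (λ v → m≤n⊔m (h v) (deg H v)) below))
    shrink : (P : ∃ Closed) → (∀ v → proj₁ P v ≡ true → Release (proj₁ P) v) ⊎
             ∃ λ (P′ : ∃ Closed) → card (proj₁ P′) < card (proj₁ P)
    shrink (W , anchored , heavy) with any? (λ v → (W v Bool.≟ true) ×-dec ¬? (release? W v))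
    ... | no none = inj₁ λ v v∈W → decide v v∈W (release? W v)
      where
      decide : ∀ v → W v ≡ true → Dec (Release W v) → Release W v
      decide v v∈W (yes r) = r
      decide v v∈W (no s) = ⊥-elim (none (v , v∈W , s))
    ... | yes (u , u∈W , stuck) = inj₂ ((del W u , anchored-del u∈W stuck anchored , heavy′) ,
        ≤-reflexive (wt-del {H = W} (λ _ → 1) u∈W))
      where
      heavy′ : ∀ v → del W u v ≡ false → h v ≤ deg H v
      heavy′ v q with v ≟ u
      ... | yes refl = stuck-degree {W} u∈W stuck
      ... | no _ = heavy v q

  excess : (Fin m → Bool) → ℕ
  excess F = ∑ λ v → deg F v ∸ h v

  release-improves : ∀ {U v} → h v < deg H v → Release U v →
    ∃ λ H′ → (Sparse H′ × Tight H′ full) × excess H′ < excess H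
  release-improves {U} {v} over (X , _ , _ , _ , H′ , swap s z a c d) =
    H′ , (s , tight-edges-≡ {H} {H′} {full} (sym z) base) , ∑-mono-< below v strict
    where
    -- Truncated subtraction sends the `h` branch of the maximum to 0, so the cap allows exactly the
    -- present excess.
    cap-∸ : ∀ u → cap u ∸ h u ≡ deg H u ∸ h u
    cap-∸ u = trans (∸-distribʳ-⊔ (h u) (h u) (deg H u)) (cong (_⊔ (deg H u ∸ h u)) (n∸n≡0 (h u)))
    below : ∀ u → deg H′ u ∸ h u ≤ deg H u ∸ h u
    below u = ≤-trans (∸-monoˡ-≤ (h u) (c u)) (≤-reflexive (cap-∸ u))
    cap≡deg : cap v ≡ deg H v
    cap≡deg = m≤n⇒m⊔n≡n (<⇒≤ over)
    strict : deg H′ v ∸ h v < deg H v ∸ h v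
    strict with h v ≤? deg H′ v
    ... | yes q = ∸-monoˡ-< (subst (deg H′ v <_) cap≡deg d) q
    ... | no q = subst (_< deg H v ∸ h v) (sym (m≤n⇒m∸n≡0 (<⇒≤ (≰⇒> q)))) (m<n⇒0<n∸m over)

-- The hypothesis applied: a sparse spanning set of bounded degrees

module Toughness (G : Graph) (f : Fin (nV G) → ℕ)
  (tough : (S : Subset (nV G)) (r₁ r₂ : Fin (nV G) → Fin (nV G)) →
    IsComponentRep G 2 (∁ S) r₁ → IsComponentRep G 2 S r₂ →
    Ω G 2 (∁ S) r₁ ℤ.≤ sumS G S f ℤ.+ ℤ.+ 2 ℤ.+ Ω G 2 S r₂) where
  open Count (ends G)
  open Exchange (ends G)

  sumS-split : ∀ S → sumS G S f ≡ ℤ.+ ∑ (λ v → lookup S v ▷ (2 * f v)) ℤ.- ℤ.+ ∑ (λ v → lookup S v ▷ 3)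
  sumS-split S = partial λ v → v
    where
    partial : ∀ {k} (g : Fin k → Fin (nV G)) →
      List.foldr ℤ._+_ ℤ.0ℤ (List.map (λ v → if lookup S v then ℤ.+ (2 * f v) ℤ.- ℤ.+ 3 else ℤ.0ℤ) (List.tabulate g)) ≡
      ℤ.+ ∑ (λ i → lookup S (g i) ▷ (2 * f (g i))) ℤ.- ℤ.+ ∑ (λ i → lookup S (g i) ▷ 3)
    partial {zero} g = sym (cong₂ (λ a b → ℤ.+ a ℤ.- ℤ.+ b) (∑-empty _) (∑-empty _))
    partial {suc k} g = trans (cong₂ ℤ._+_ (term (lookup S (g zero)) (f (g zero))) (partial (g ∘ suc)))
      (trans (assemble (ℤ.+ (lookup S (g zero) ▷ (2 * f (g zero)))) (ℤ.+ (lookup S (g zero) ▷ 3))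
          (ℤ.+ ∑ λ i → lookup S (g (suc i)) ▷ (2 * f (g (suc i)))) (ℤ.+ ∑ λ i → lookup S (g (suc i)) ▷ 3))
        (sym (cong₂ (λ a b → ℤ.+ a ℤ.- ℤ.+ b) (∑-suc λ i → lookup S (g i) ▷ (2 * f (g i))) (∑-suc λ i → lookup S (g i) ▷ 3))))
      where
      term : ∀ b k → (if b then ℤ.+ (2 * k) ℤ.- ℤ.+ 3 else ℤ.0ℤ) ≡ ℤ.+ (b ▷ (2 * k)) ℤ.- ℤ.+ (b ▷ 3)
      term true k = refl
      term false k = refl
      assemble : ∀ a b c d → (a ℤ.- b) ℤ.+ (c ℤ.- d) ≡ (a ℤ.+ c) ℤ.- (b ℤ.+ d)
      assemble = solveℤ-∀

  clear : ∀ a b c d F T → ℤ.+ a ℤ.- ℤ.+ b ℤ.≤ (ℤ.+ F ℤ.- ℤ.+ T) ℤ.+ ℤ.+ 2 ℤ.+ (ℤ.+ c ℤ.- ℤ.+ d) →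
          a + T + d ≤ F + 2 + c + b
  clear a b c d F T le = ℤ.drop‿+≤+ (subst₂ ℤ._≤_
    (left (ℤ.+ a) (ℤ.+ b) (ℤ.+ d) (ℤ.+ T)) (right (ℤ.+ b) (ℤ.+ c) (ℤ.+ d) (ℤ.+ F) (ℤ.+ T))
    (ℤ.+-monoˡ-≤ (ℤ.+ b ℤ.+ ℤ.+ T ℤ.+ ℤ.+ d) le))
    where
    left : ∀ a b d T → (a ℤ.- b) ℤ.+ (b ℤ.+ T ℤ.+ d) ≡ a ℤ.+ T ℤ.+ d
    left = solveℤ-∀
    right : ∀ b c d F T → ((F ℤ.- T) ℤ.+ ℤ.+ 2 ℤ.+ (c ℤ.- d)) ℤ.+ (b ℤ.+ T ℤ.+ d) ≡ F ℤ.+ ℤ.+ 2 ℤ.+ c ℤ.+ b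
    right = solveℤ-∀

  -- The hypothesis with each Ω₂ replaced by `2|U| - e(K)` on the respective vertex set `U`, and all
  -- subtracted terms moved across. Any two saturated sets may be used, because each provides a
  -- valid representative function.
  tough-count : ∀ S {K₁ K₂} → Saturated K₁ (∁ᵇ S) → Saturated K₂ S →
    2 * card (∁ᵇ S) + edges K₂ S + 3 * card S ≤ ∑ (λ v → S v ▷ (2 * f v)) + 2 + 2 * card S + edges K₁ (∁ᵇ S)
  tough-count S {K₁} {K₂} sat₁ sat₂ = subst₂ _≤_
    (cong₂ _+_ (cong₂ _+_ (cong (2 *_) (wt-cong same₁)) (edges-cong {K₂} {K₂} (λ _ → refl) same₂)) (cong (3 *_) (wt-cong same₂)))
    (cong₂ _+_ (cong₂ _+_ (cong (_+ 2) (∑-cong λ v → cong (_▷ (2 * f v)) (same₂ v))) (cong (2 *_) (wt-cong same₂)))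
      (edges-cong {K₁} {K₁} (λ _ → refl) same₁)) count
    where
    T : Subset (nV G)
    T = tabulate S
    same₂ : lookup T ≗ S
    same₂ = lookup∘tabulate S
    same₁ : lookup (∁ T) ≗ ∁ᵇ S
    same₁ v = trans (lookup-map v not T) (cong not (same₂ v))
    module S₁ = Saturated (saturated-resp (sym ∘ same₁) sat₁)
    module S₂ = Saturated (saturated-resp (sym ∘ same₂) sat₂)
    module B₁ = Blocked G (∁ T) S₁.sparse S₁.inside S₁.blocked
    module B₂ = Blocked G T S₂.sparse S₂.inside S₂.blocked
    threes : ∑ (λ v → lookup T v ▷ 3) ≡ 3 * card (lookup T)
    threes = trans (∑-cong λ v → triple (lookup T v)) (∑-scale 3 λ v → lookup T v ▷ 1)
      where
      triple : ∀ b → b ▷ 3 ≡ 3 * (b ▷ 1)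
      triple true = refl
      triple false = refl
    F a b c d : ℕ
    F = ∑ λ v → lookup T v ▷ (2 * f v)
    a = 2 * numParts G (∁ T) B₁.r
    b = crossEdges G (∁ T) B₁.r
    c = 2 * numParts G T B₂.r
    d = crossEdges G T B₂.r
    cleared : a + 3 * card (lookup T) + d ≤ F + 2 + c + b
    cleared = subst (λ t → a + t + d ≤ F + 2 + c + b) threes
      (clear a b c d F _ (subst (λ s → Ω G 2 (∁ T) B₁.r ℤ.≤ s ℤ.+ ℤ.+ 2 ℤ.+ Ω G 2 T B₂.r) (sumS-split T)
        (tough T B₁.r B₂.r B₁.component-rep B₂.component-rep)))
    count : 2 * card (lookup (∁ T)) + edges K₂ (lookup T) + 3 * card (lookup T) ≤
            F + 2 + 2 * card (lookup T) + edges K₁ (lookup (∁ T))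
    count = certify _ _ (cleared ⊕ ≤-reflexive (sym B₁.Ω-count) ⊕ ≤-reflexive B₂.Ω-count)
      (eq a b c d F (card (lookup (∁ T))) (card (lookup T)) (edges K₁ (lookup (∁ T))) (edges K₂ (lookup T)))
      where
      eq : ∀ a b c d F c₁ c₂ e₁ e₂ →
        2 * c₁ + e₂ + 3 * c₂ + (F + 2 + c + b + (a + e₁ + (2 * c₂ + d))) ≡
        F + 2 + 2 * c₂ + e₁ + (a + 3 * c₂ + d + (2 * c₁ + b + (c + e₂)))
      eq = solve-∀

  Base : Set
  Base = ∃ λ H → Sparse H × Tight H full

  base-exists : Fin (nV G) → Base
  base-exists v₀ = let (K , _ , sat) = saturate {λ _ → false} {∁ᵇ (λ _ → false)} empty-sparse (λ e ()) in
    K , Saturated.sparse sat , tight (v₀ , refl) (certify _ _ (tough-count (λ _ → false) {K} {λ _ → false} sat empty-saturated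
      ⊕ ≤-reflexive no-terms ⊕ z≤n {edges (λ _ → false) (λ _ → false) + card λ (_ : Fin (nV G)) → false})
      (eq (card full) (edges K full) (edges (λ _ → false) (λ _ → false)) (card λ (_ : Fin (nV G)) → false) (∑ λ (v : Fin (nV G)) → 0)))
    where
    empty-sparse : Sparse λ _ → false
    empty-sparse X v p = ≤-trans (≤-reflexive (cong (_+ 2) (∑-zero {f = λ (_ : Fin (nE G)) → 0} λ _ → refl))) (*-monoʳ-≤ 2 (card-pos {X = X} p))
    empty-saturated : Saturated (λ _ → false) (λ _ → false)
    empty-saturated = record { sparse = empty-sparse ; inside = λ e () ; blocked = λ e () }
    no-terms : ∑ (λ (v : Fin (nV G)) → 0) ≡ 0
    no-terms = ∑-zero {f = λ (_ : Fin (nV G)) → 0} λ _ → refl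
    eq : ∀ c e e₀ z t → 2 * c + (t + 2 + 2 * z + e + (0 + (e₀ + z))) ≡ e + 2 + (2 * c + e₀ + 3 * z + (t + 0))
    eq = solve-∀

  bounded-base : Fin (nV G) → ∃ λ ((H , _) : Base) → ∀ v → deg H v ≤ 1 + 2 * f v
  bounded-base v₀ = iterate (λ (H , _) → ∑ λ v → deg H v ∸ (1 + 2 * f v)) improve (base-exists v₀)
    where
    h : Fin (nV G) → ℕ
    h v = 1 + 2 * f v
    improve : (B : Base) → (∀ v → deg (proj₁ B) v ≤ h v) ⊎
              ∃ λ (B′ : Base) → ∑ (λ v → deg (proj₁ B′) v ∸ h v) < ∑ (λ v → deg (proj₁ B) v ∸ h v)
    improve (H , sparse , base) with any? (λ v → h v <? deg H v)
    ... | no none = inj₁ λ v → ≮⇒≥ λ over → none (v , over)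
    ... | yes (v , over) = from-core C.core
      where
      module C = Core (ends G) h sparse base
      module D = Descent h sparse base
      from-core : (∃ λ W → C.Closed W × (∀ v → W v ≡ true → D.Release W v)) → (∀ v → deg H v ≤ h v) ⊎
        ∃ λ (B′ : Base) → ∑ (λ v → deg (proj₁ B′) v ∸ h v) < ∑ (λ v → deg H v ∸ h v)
      from-core (W , (anchored , heavy) , released) with W v in v∈W
      ... | true = inj₂ (let H′ , b , less = C.release-improves over (released v v∈W) in (H′ , b) , less)
      -- On `S` the restriction of `H` need not be maximal. Enlarging it to a saturated `K` only
      -- raises the edge count on `S`, which is the direction the count tolerates.
      ... | false = ⊥-elim (contradict (saturate {HS} {S} (sparse-⊑ {HS} {H} (λ e → proj₁ ∘ ∧-elim) sparse) (λ e → proj₂ ∘ ∧-elim {H e})))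
        where
        S : Fin (nV G) → Bool
        S = ∁ᵇ W
        HS HW : Fin (nE G) → Bool
        HS e = H e ∧ within S e
        HW e = H e ∧ within W e
        edges-restrict : ∀ U X → X ⊑ U → edges (λ e → H e ∧ within U e) X ≡ edges H X
        edges-restrict U X X⊑U = ∑-cong pointwise
          where
          pointwise : ∀ e → (H e ∧ within U e) ▷ ind (within X e) ≡ H e ▷ ind (within X e)
          pointwise e with within X e in q
          ... | false = ▷-0 (H e ∧ within U e) (H e)
          ... | true rewrite within-mono {X} {U} X⊑U e q = cong (_▷ 1) (Bool.∧-identityʳ (H e))
        double-not : W ≗ ∁ᵇ S
        double-not u = sym (Bool.not-involutive (W u))
        satW : Saturated HW W
        satW = record
          { sparse  = sparse-⊑ {HW} {H} (λ e → proj₁ ∘ ∧-elim) sparse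
          ; inside  = λ e → proj₂ ∘ ∧-elim {H e}
          ; blocked = λ e e∈W e∉HW → let X , t , X⊑W , q = D.released⇒linked anchored {e} (absent e e∈W e∉HW)
                                          (released _ (proj₁ (∧-elim e∈W))) (released _ (proj₂ (∧-elim {W (src e)} e∈W))) in
              X , tight-edges-≡ {H} {HW} {X} (sym (edges-restrict W X X⊑W)) t , X⊑W , q
          }
          where
          absent : ∀ e → within W e ≡ true → H e ∧ within W e ≡ false → H e ≡ false
          absent e p q = trans (sym (Bool.∧-identityʳ (H e))) (trans (cong (H e ∧_) (sym p)) q)
        degrees : ∑ (λ u → S u ▷ (2 * f u)) + card S < ∑ (λ u → S u ▷ deg H u)
        degrees = ≤-trans (s≤s (≤-reflexive (sym (∑-+ _ _)))) (∑-mono-< (λ u → below u (S u) refl) v (strict (S v) (cong not v∈W)))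
          where
          below : ∀ u b → S u ≡ b → b ▷ (2 * f u) + b ▷ 1 ≤ b ▷ deg H u
          below u false q = z≤n
          below u true q = ≤-trans (≤-reflexive (+-comm _ 1)) (heavy u (not-true q))
          strict : ∀ b → b ≡ true → b ▷ (2 * f v) + b ▷ 1 < b ▷ deg H v
          strict true q = ≤-trans (s≤s (≤-reflexive (+-comm _ 1))) over
        contradict : (∃ λ K → HS ⊑ K × Saturated K S) → ⊥
        -- The sum of these relations collapses to `1 ≤ 0`; the unit comes from the strict excess at
        -- `v` in `degrees`.
        contradict (K , HS⊑K , satS) = 1+n≰n {0} (certify 1 0
            (tough-count S (saturated-resp double-not satW) satS
              ⊕ degrees
              ⊕ ≤-reflexive (∑-deg H S)
              ⊕ ≤-reflexive (edges-restrict W (∁ᵇ S) (λ u → trans (double-not u)))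
              ⊕ ≤-trans (≤-reflexive (sym (edges-restrict S S ⊑-refl))) (edges-mono {HS} {K} {S} {S} HS⊑K ⊑-refl)
              ⊕ ≤-reflexive (tight-edges sparse base)
              ⊕ ≤-reflexive (cong (2 *_) (sym card-split)))
          (eq (card (∁ᵇ S)) (card S) (edges K S) (edges HW (∁ᵇ S)) (edges H S) (edges H (∁ᵇ S))
             (∑ λ u → S u ▷ (2 * f u)) (∑ λ u → S u ▷ deg H u) (wt H λ _ → 1) (card full)))
          where
          card-split : card S + card (∁ᵇ S) ≡ card full
          card-split = trans (card-∁ S) (sym (trans (∑-const (nV G) 1) (*-identityʳ (nV G))))
          eq : ∀ cW cS eK eHW eS eW F D t c →
            1 + (F + 2 + 2 * cS + eHW + (D + (eS + t + (eW + (eK + (2 * c + 2 * (cS + cW))))))) ≡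
            0 + (2 * cW + eK + 3 * cS + (suc (F + cS) + (D + eW + (eHW + (eS + (t + 2 + 2 * c))))))
          eq = solve-∀

-- Parity and a connected even subgraph

odd : ℕ → Bool
odd zero = false
odd (suc k) = not (odd k)

odd-+ : ∀ a b → odd (a + b) ≡ odd a xor odd b
odd-+ zero b = refl
odd-+ (suc a) b = trans (cong not (odd-+ a b)) (Bool.not-distribˡ-xor (odd a) (odd b))

odd-double : ∀ a → odd (2 * a) ≡ false
odd-double a = trans (odd-+ a (a + 0)) (trans (cong (λ b → odd a xor odd b) (+-identityʳ a)) (Bool.xor-same (odd a)))

odd-ind : ∀ b → odd (ind b) ≡ b
odd-ind true = refl
odd-ind false = refl

odd-∑ : ∀ {n} {f : Fin n → ℕ} → (∀ i → odd (f i) ≡ false) → odd (∑ f) ≡ false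
odd-∑ {zero} {f} even = cong odd (∑-empty f)
odd-∑ {suc n} {f} even = trans (cong odd (∑-suc f))
  (trans (odd-+ (f zero) _) (cong₂ _xor_ (even zero) (odd-∑ (even ∘ suc))))

odd-∑-except : ∀ {n} {f : Fin n → ℕ} s → (∀ i → i ≢ s → odd (f i) ≡ false) → odd (∑ f) ≡ odd (f s)
odd-∑-except {n} {f} s even = begin
  odd (∑ f)
    ≡⟨ cong odd (trans (∑-cong pointwise) (∑-+ _ _)) ⟩
  odd (∑ (λ i → ⌊ i ≟ s ⌋ ▷ f i) + ∑ (λ i → not ⌊ i ≟ s ⌋ ▷ f i))
    ≡⟨ odd-+ (∑ λ i → ⌊ i ≟ s ⌋ ▷ f i) _ ⟩
  odd (∑ (λ i → ⌊ i ≟ s ⌋ ▷ f i)) xor odd (∑ (λ i → not ⌊ i ≟ s ⌋ ▷ f i))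
    ≡⟨ cong₂ _xor_ (cong odd (∑-delta s f)) (odd-∑ rest) ⟩
  odd (f s) xor false
    ≡⟨ Bool.xor-identityʳ _ ⟩
  odd (f s) ∎
  where
  open ≡-Reasoning
  pointwise : ∀ i → f i ≡ ⌊ i ≟ s ⌋ ▷ f i + not ⌊ i ≟ s ⌋ ▷ f i
  pointwise i with i ≟ s
  ... | yes _ = sym (+-identityʳ _)
  ... | no _ = refl
  rest : ∀ i → odd (not ⌊ i ≟ s ⌋ ▷ f i) ≡ false
  rest i with i ≟ s
  ... | yes _ = refl
  ... | no p = even i p

module EvenSubgraph (G : Graph) {H : Fin (nE G) → Bool} {c : Fin (nE G) → Bool}
  (connects : ∀ b → Connects (ends G) (λ e → H e ≡ true × c e ≡ b) (λ _ → true)) where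
  open Count (ends G)
  open Reachability G

  Blue : Fin (nE G) → Set
  Blue e = H e ≡ true × c e ≡ false

  -- All edges of colour `true` are kept, so the subgraph stays connected however the blue edges are
  -- flipped.
  Between : (Fin (nE G) → Bool) → Set
  Between D = D ⊑ H × (∀ e → H e ≡ true → c e ≡ true → D e ≡ true)

  odd-inc : ∀ {e u w} → Joins G e u w → ∀ x → odd (inc x e) ≡ ⌊ x ≟ u ⌋ xor ⌊ x ≟ w ⌋
  odd-inc {e} joins x = trans (odd-+ (ind ⌊ src e ≟ x ⌋) _) (trans (cong₂ _xor_ (odd-ind ⌊ src e ≟ x ⌋) (odd-ind ⌊ tgt e ≟ x ⌋)) (orient joins))
    where
    orient : ∀ {u w} → Joins G e u w → ⌊ src e ≟ x ⌋ xor ⌊ tgt e ≟ x ⌋ ≡ ⌊ x ≟ u ⌋ xor ⌊ x ≟ w ⌋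
    orient (inj₁ refl) = cong₂ _xor_ (≟-sym (src e) x) (≟-sym (tgt e) x)
    orient (inj₂ refl) = trans (cong₂ _xor_ (≟-sym (src e) x) (≟-sym (tgt e) x)) (Bool.xor-comm ⌊ x ≟ src e ⌋ _)

  flip-edge : ∀ {D e} → Blue e → Between D →
              ∃ λ D′ → Between D′ × (∀ x → odd (deg D′ x) ≡ odd (inc x e) xor odd (deg D x))
  flip-edge {D} {e} (h , blue) (D⊑H , red) with D e in q
  ... | true = del D e , ((λ g → D⊑H g ∘ del-⊑ {H = D} g) , λ g hg cg → del-intro {H = D} (not-blue cg) (red g hg cg)) , parity
    where
    not-blue : ∀ {g} → c g ≡ true → g ≢ e
    not-blue r refl = true≢false r blue
    parity : ∀ x → odd (deg (del D e) x) ≡ odd (inc x e) xor odd (deg D x)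
    parity x = begin
      odd (deg (del D e) x)
        ≡⟨ cong (_xor odd (deg (del D e) x)) (Bool.xor-same (odd (inc x e))) ⟨
      (odd (inc x e) xor odd (inc x e)) xor odd (deg (del D e) x)
        ≡⟨ Bool.xor-assoc (odd (inc x e)) _ _ ⟩
      odd (inc x e) xor (odd (inc x e) xor odd (deg (del D e) x))
        ≡⟨ cong (odd (inc x e) xor_) (odd-+ (inc x e) _) ⟨
      odd (inc x e) xor odd (inc x e + deg (del D e) x)
        ≡⟨ cong (λ k → odd (inc x e) xor odd k) (wt-del {H = D} (inc x) q) ⟩
      odd (inc x e) xor odd (deg D x) ∎
      where open ≡-Reasoning
  ... | false = add D e , (included , λ g hg cg → ∨-introʳ {⌊ g ≟ e ⌋} (red g hg cg)) ,
    λ x → trans (cong odd (wt-add {H = D} (inc x) q)) (odd-+ (inc x e) _)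
    where
    included : add D e ⊑ H
    included g p with g ≟ e
    ... | yes refl = h
    ... | no _ = D⊑H g p

  -- Parity changes at intermediate vertices cancel in pairs. An edge traversed again is merely
  -- toggled again, so the walk need not be a simple path.
  flip-path : ∀ {u v} → Reach G Blue u v → ∀ {D} → Between D →
    ∃ λ D′ → Between D′ × (∀ x → odd (deg D′ x) ≡ (⌊ x ≟ u ⌋ xor ⌊ x ≟ v ⌋) xor odd (deg D x))
  flip-path (here {u}) {D} b = D , b , λ x → sym (cong (_xor odd (deg D x)) (Bool.xor-same ⌊ x ≟ u ⌋))
  flip-path (step {u} {w} {v} e blue joins r) {D} b with flip-edge blue b
  ... | D₁ , b₁ , p₁ with flip-path r b₁
  ... | D₂ , b₂ , p₂ = D₂ , b₂ , λ x → trans (p₂ x) (trans (cong ((⌊ x ≟ w ⌋ xor ⌊ x ≟ v ⌋) xor_)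
      (trans (p₁ x) (cong (_xor odd (deg D x)) (odd-inc joins x)))) (telescope ⌊ x ≟ u ⌋ ⌊ x ≟ w ⌋ ⌊ x ≟ v ⌋ (odd (deg D x))))
    where
    telescope : ∀ u w v d → (w xor v) xor ((u xor w) xor d) ≡ (u xor v) xor d
    telescope = from-yes (∀Bool? λ u → ∀Bool? λ w → ∀Bool? λ v → ∀Bool? λ d →
      (w xor v) xor ((u xor w) xor d) Bool.≟ (u xor v) xor d)

  -- Each odd vertex is repaired by a blue walk to the fixed vertex `s`, which collects all the
  -- defects. Earlier repairs survive since a walk changes parity only at its two ends.
  even-on : ∀ s L → ∃ λ D → Between D × (∀ x → x ∈ L → x ≢ s → odd (deg D x) ≡ false)
  even-on s [] = (λ e → H e ∧ c e) , ((λ e → proj₁ ∘ ∧-elim) , λ e → ∧-intro) , λ x ()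
  even-on s (v ∷ L) with even-on s L
  ... | D , b , even = correct (odd (deg D v)) refl
    where
    reach : Reach G Blue v s
    reach = connects⇒reach (λ e → (H e Bool.≟ true) ×-dec (c e Bool.≟ false)) (connects false) v s refl refl
    correct : ∀ q → odd (deg D v) ≡ q → ∃ λ D → Between D × (∀ x → x ∈ v ∷ L → x ≢ s → odd (deg D x) ≡ false)
    correct false q = D , b , λ { x (here refl) _ → q ; x (there p) → even x p }
    correct true q with flip-path reach b
    ... | D′ , b′ , parity = D′ , b′ , even′
      where
      even′ : ∀ x → x ∈ v ∷ L → x ≢ s → odd (deg D′ x) ≡ false
      even′ x x∈ x≢s with x ≟ v | parity x
      ... | yes refl | p rewrite ≟-false x≢s | q = p
      even′ x (here x≡v) x≢s | no x≢v | p = ⊥-elim (x≢v x≡v)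
      even′ x (there x∈L) x≢s | no x≢v | p rewrite ≟-false x≢s | even x x∈L x≢s = p

  even-subgraph : Fin (nV G) → ∃ λ D → Between D × (∀ x → odd (deg D x) ≡ false)
  even-subgraph s with even-on s (allFin (nV G))
  ... | D , b , even = D , b , all-even
    where
    total-even : odd (∑ (deg D)) ≡ false
    total-even = trans (cong odd (trans (sym (trans (cong (∑ (deg D) +_) none) (+-identityʳ _)))
      (trans (∑-deg D (λ _ → true)) (cong (wt D (λ _ → 1) +_) (sym (+-identityʳ _)))))) (odd-double (wt D λ _ → 1))
      where
      none : edges D (λ _ → false) ≡ 0
      none = ∑-zero λ e → ▷-0 (D e) false
    all-even : ∀ x → odd (deg D x) ≡ false
    all-even x with x ≟ s
    ... | no x≢s = even x (∈-allFin x) x≢s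
    -- The degree sum is even and all other degrees are even, which settles the remaining vertex.
    ... | yes refl = trans (sym (odd-∑-except x λ i i≢x → even i (∈-allFin i) i≢x)) total-even

-- A spanning closed trail by extending trails

module Trails (G : Graph) {D : Fin (nE G) → Bool}
  (even : ∀ v → odd (Count.deg (ends G) D v) ≡ false)
  (connected : Connects (ends G) (λ e → D e ≡ true) (λ _ → true)) where
  open Count (ends G)

  Steps : Set
  Steps = List (Fin (nE G) × Fin (nV G))

  total : (Fin (nE G) → ℕ) → List (Fin (nE G)) → ℕ
  total k L = sum (map k L)

  Inside : List (Fin (nE G)) → (Fin (nE G) → Bool) → Set
  Inside L F = ∀ e → e ∈ L → F e ≡ true

  inside-del : ∀ {F x L} → All (x ≢_) L → Inside (x ∷ L) F → Inside L (del F x)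
  inside-del {F} fresh inside e p = del-intro {H = F} (All.lookup fresh p ∘ sym) (inside e (there p))

  total-≤ : ∀ {F} k {L} → Unique L → Inside L F → total k L ≤ wt F k
  total-≤ k {[]} [] inside = z≤n
  total-≤ {F} k {x ∷ L} (fresh ∷ unique) inside = ≤-trans
    (+-monoʳ-≤ (k x) (total-≤ {del F x} k unique (inside-del {F} fresh inside)))
    (≤-reflexive (wt-del {H = F} k (inside x (here refl))))

  total-< : ∀ {F} k {L} → Unique L → Inside L F → total k L < wt F k →
            ∃ λ e → F e ≡ true × e ∉ L × 1 ≤ k e
  total-< {F} k {[]} [] inside less with ∑-witness {f = λ _ → 0} {λ e → F e ▷ k e}
    (subst (_< wt F k) (sym (∑-zero {f = λ (_ : Fin (nE G)) → 0} λ _ → refl)) less)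
  ... | e , pos with F e in q
  ... | true = e , q , (λ ()) , pos
  total-< {F} k {x ∷ L} (fresh ∷ unique) inside less with total-< {del F x} k unique (inside-del {F} fresh inside)
    (+-cancelˡ-< (k x) _ _ (subst (total k (x ∷ L) <_) (sym (wt-del {H = F} k (inside x (here refl)))) less))
  ... | e , q , e∉L , pos = e , del-⊑ {H = F} e q , (λ { (here p) → del-≢ {H = F} q p ; (there p) → e∉L p }) , pos

  times : Fin (nV G) → List (Fin (nV G)) → ℕ
  times v L = length (filter (λ u → u ≟ v) L)

  times-∷ : ∀ v u L → times v (u ∷ L) ≡ ind ⌊ u ≟ v ⌋ + times v L
  times-∷ v u L with u ≟ v
  ... | yes _ = refl
  ... | no _ = refl

  inc-joins : ∀ {e u w} → Joins G e u w → ∀ v → inc v e ≡ ind ⌊ u ≟ v ⌋ + ind ⌊ w ≟ v ⌋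
  inc-joins (inj₁ refl) v = refl
  inc-joins {e} (inj₂ refl) v = +-comm (ind ⌊ src e ≟ v ⌋) _

  -- Every recorded visit uses one edge end to enter and one to leave. The corrections are the
  -- start, left without being recorded, and the end, recorded without being left.
  walk-degree : ∀ {s st t} → WalkFrom G s st t → ∀ v →
    total (inc v) (map proj₁ st) + ind ⌊ t ≟ v ⌋ ≡ 2 * times v (map proj₂ st) + ind ⌊ s ≟ v ⌋
  walk-degree stop v = refl
  walk-degree {s} {(e , w) ∷ st} {t} (go e joins walk) v = begin
    inc v e + total (inc v) (map proj₁ st) + ind ⌊ t ≟ v ⌋
      ≡⟨ +-assoc (inc v e) _ _ ⟩
    inc v e + (total (inc v) (map proj₁ st) + ind ⌊ t ≟ v ⌋)
      ≡⟨ cong₂ _+_ (inc-joins joins v) (walk-degree walk v) ⟩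
    ind ⌊ s ≟ v ⌋ + ind ⌊ w ≟ v ⌋ + (2 * times v (map proj₂ st) + ind ⌊ w ≟ v ⌋)
      ≡⟨ collect (ind ⌊ s ≟ v ⌋) (ind ⌊ w ≟ v ⌋) (times v (map proj₂ st)) ⟩
    2 * (ind ⌊ w ≟ v ⌋ + times v (map proj₂ st)) + ind ⌊ s ≟ v ⌋
      ≡⟨ cong (λ k → 2 * k + ind ⌊ s ≟ v ⌋) (times-∷ v w (map proj₂ st)) ⟨
    2 * times v (map proj₂ ((e , w) ∷ st)) + ind ⌊ s ≟ v ⌋ ∎
    where
    open ≡-Reasoning
    collect : ∀ s w k → s + w + (2 * k + w) ≡ 2 * (w + k) + s
    collect = solve-∀

  walk-++ : ∀ {a b c xs ys} → WalkFrom G a xs b → WalkFrom G b ys c → WalkFrom G a (xs ++ ys) c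
  walk-++ stop q = q
  walk-++ (go e joins p) q = go e joins (walk-++ p q)

  walk-split : ∀ {s st t u} → WalkFrom G s st t → u ∈ map proj₂ st →
    ∃ λ xs → ∃ λ ys → st ≡ xs ++ ys × WalkFrom G s xs u × WalkFrom G u ys t
  walk-split {st = (e , w) ∷ st} (go e joins walk) (here refl) = (e , w) ∷ [] , st , refl , go e joins stop , walk
  walk-split {st = (e , w) ∷ st} (go e joins walk) (there p) with walk-split walk p
  ... | xs , ys , refl , q , r = (e , w) ∷ xs , ys , refl , go e joins q , r

  end-visited : ∀ {s st t} → WalkFrom G s st t → t ≡ s ⊎ t ∈ map proj₂ st
  end-visited stop = inj₁ refl
  end-visited (go e joins walk) with end-visited walk
  ... | inj₁ refl = inj₂ (here refl)
  ... | inj₂ p = inj₂ (there p)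

  visited : ∀ {s st} → WalkFrom G s st s → ∀ {x} → x ≡ s ⊎ x ∈ map proj₂ st → x ∈ visits G s st
  visited stop (inj₁ p) = here p
  visited (go e joins walk) (inj₂ p) = p
  visited (go e joins walk) (inj₁ refl) with end-visited walk
  ... | inj₁ refl = here refl
  ... | inj₂ p = there p

  visits-elim : ∀ {s st x} → x ∈ visits G s st → x ≡ s ⊎ x ∈ map proj₂ st
  visits-elim {st = []} (here p) = inj₁ p
  visits-elim {st = _ ∷ _} p = inj₂ p

  edge-visited : ∀ {s st t} → WalkFrom G s st t → ∀ {e} → e ∈ map proj₁ st →
    (src e ≡ s ⊎ src e ∈ map proj₂ st) × (tgt e ≡ s ⊎ tgt e ∈ map proj₂ st)
  edge-visited (go e (inj₁ refl) walk) (here refl) = inj₁ refl , inj₂ (here refl)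
  edge-visited (go e (inj₂ refl) walk) (here refl) = inj₂ (here refl) , inj₁ refl
  edge-visited (go e joins walk) (there p) with edge-visited walk p
  ... | a , b = shift a , shift b
    where
    shift : ∀ {x w L} {s : Fin (nV G)} → x ≡ w ⊎ x ∈ L → x ≡ s ⊎ x ∈ w ∷ L
    shift (inj₁ p) = inj₂ (here p)
    shift (inj₂ p) = inj₂ (there p)

  record Trail : Set where
    constructor trail
    field
      {start end} : Fin (nV G)
      {steps}     : Steps
      walk        : WalkFrom G start steps end
      unique      : Unique (map proj₁ steps)
      inside      : Inside (map proj₁ steps) D
  open Trail

  size : Trail → ℕ
  size T = length (steps T)

  size-≤ : ∀ T → size T ≤ nE G
  size-≤ T = ≤-trans (≤-reflexive (sym (ones (steps T)))) (≤-trans (total-≤ {D} (λ _ → 1) (unique T) (inside T))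
    (≤-trans (∑-mono λ e → ind≤1 (D e)) (≤-reflexive (trans (∑-const (nE G) 1) (*-identityʳ (nE G))))))
    where
    ones : ∀ (st : Steps) → total (λ _ → 1) (map proj₁ st) ≡ length st
    ones [] = refl
    ones (_ ∷ st) = cong suc (ones st)

  prepend : ∀ (T : Trail) e {w} → Joins G e w (start T) → D e ≡ true → e ∉ map proj₁ (steps T) →
            ∃ λ T′ → nE G ∸ size T′ < nE G ∸ size T
  prepend T e joins e∈D fresh = longer , ∸-monoʳ-< ≤-refl (size-≤ longer)
    where
    longer : Trail
    longer = trail (go e joins (walk T)) (¬Any⇒All¬ _ fresh ∷ unique T)
      λ { g (here refl) → e∈D ; g (there p) → inside T g p }

  -- The closed walk is cut at a visit of `u` and its two pieces are exchanged; the edge list is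
  -- only permuted, so it stays free of repetitions.
  rotate : ∀ {s st} → WalkFrom G s st s → Unique (map proj₁ st) → Inside (map proj₁ st) D → ∀ {u} → u ∈ visits G s st →
    ∃ λ T → start T ≡ u × size T ≡ length st × (∀ e → e ∈ map proj₁ (steps T) → e ∈ map proj₁ st)
  rotate {s} {st} p unique inside {u} u-visited with visits-elim {s} {st} u-visited
  ... | inj₁ refl = trail p unique inside , refl , refl , λ _ q → q
  ... | inj₂ q with walk-split p q
  ... | xs , ys , refl , s-u , u-s =
    trail (walk-++ u-s s-u) (P.Unique-resp-↭ perm unique) (λ e m → inside e (back e m)) , refl , same-size , back
    where
    module P = Permutation (setoid (Fin (nE G)))
    open import Data.List.Relation.Binary.Permutation.Setoid (setoid (Fin (nE G))) using (_↭_; ↭-sym)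
    perm : map proj₁ (xs ++ ys) ↭ map proj₁ (ys ++ xs)
    perm = subst₂ _↭_ (sym (map-++ proj₁ xs ys)) (sym (map-++ proj₁ ys xs)) (P.++-comm (map proj₁ xs) (map proj₁ ys))
    back : ∀ e → e ∈ map proj₁ (ys ++ xs) → e ∈ map proj₁ (xs ++ ys)
    back e = P.∈-resp-↭ (↭-sym perm)
    same-size : length (ys ++ xs) ≡ length (xs ++ ys)
    same-size = trans (length-++ ys) (trans (+-comm (length ys) _) (sym (length-++ xs)))

  Spanning : Trail → Set
  Spanning T = start T ≡ end T × (∀ v → v ∈ visits G (start T) (steps T))

  -- At the start of an open trail the degree in the trail is odd, so it can be extended there.
  extend-open : ∀ T → start T ≢ end T → ∃ λ T′ → nE G ∸ size T′ < nE G ∸ size T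
  extend-open T open-ended = add-edge (total-< {D} (inc s) (unique T) (inside T) (≤∧≢⇒< (total-≤ {D} (inc s) (unique T) (inside T)) unequal))
    where
    s : Fin (nV G)
    s = start T
    odd-total : odd (total (inc s) (map proj₁ (steps T))) ≡ true
    odd-total = begin
      odd (total (inc s) (map proj₁ (steps T)))
        ≡⟨ cong odd (trans (sym (+-identityʳ _)) (cong (λ b → total (inc s) (map proj₁ (steps T)) + ind b) (sym (≟-false (open-ended ∘ sym))))) ⟩
      odd (total (inc s) (map proj₁ (steps T)) + ind ⌊ end T ≟ s ⌋)
        ≡⟨ cong odd (walk-degree (walk T) s) ⟩
      odd (2 * times s (map proj₂ (steps T)) + ind ⌊ s ≟ s ⌋)
        ≡⟨ odd-+ (2 * times s (map proj₂ (steps T))) _ ⟩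
      odd (2 * times s (map proj₂ (steps T))) xor odd (ind ⌊ s ≟ s ⌋)
        ≡⟨ cong₂ _xor_ (odd-double (times s (map proj₂ (steps T)))) (trans (odd-ind _) (≟-true {i = s} refl)) ⟩
      true ∎
      where open ≡-Reasoning
    unequal : total (inc s) (map proj₁ (steps T)) ≢ deg D s
    unequal eq = true≢false (trans (cong odd (sym eq)) odd-total) (even s)
    at-s : ∀ e → 1 ≤ inc s e → ∃ λ w → Joins G e w s
    at-s e pos with src e ≟ s | tgt e ≟ s
    ... | yes refl | _ = tgt e , inj₂ refl
    ... | no _ | yes refl = src e , inj₁ refl
    at-s e () | no _ | no _
    add-edge : (∃ λ e → D e ≡ true × e ∉ map proj₁ (steps T) × 1 ≤ inc s e) → _
    add-edge (e , e∈D , fresh , pos) = prepend T e (proj₂ (at-s e pos)) e∈D fresh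

  -- A closed trail missing some vertex is rotated to start next to a missed vertex and extended there.
  extend-closed : ∀ {s st} → WalkFrom G s st s → Unique (map proj₁ st) → Inside (map proj₁ st) D →
    ∀ v → v ∉ visits G s st → ∃ λ T′ → nE G ∸ size T′ < nE G ∸ length st
  extend-closed {s} {st} p unique inside v v-missed =
    search (any? λ e → (D e Bool.≟ true) ×-dec ¬? (seen (src e) Bool.≟ seen (tgt e)))
    where
    open DecMembership _≟_ using (_∈?_)
    Extension : Set
    Extension = ∃ λ T′ → nE G ∸ size T′ < nE G ∸ length st
    seen : Fin (nV G) → Bool
    seen x = ⌊ x ∈? visits G s st ⌋
    seen-intro : ∀ {x} → x ∈ visits G s st → seen x ≡ true
    seen-intro {x} = ⌊⌋-intro (x ∈? visits G s st)
    seen-elim : ∀ {x} → seen x ≡ true → x ∈ visits G s st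
    seen-elim {x} = ⌊⌋-elim (x ∈? visits G s st)
    from : ∀ {e u w} → D e ≡ true → Joins G e w u → seen u ≡ true → e ∉ map proj₁ st → Extension
    from {e} e∈D joins u-seen fresh with rotate p unique inside (seen-elim u-seen)
    ... | T , refl , same , back with prepend T e joins e∈D (fresh ∘ back e)
    ... | T′ , less = T′ , subst (λ k → nE G ∸ size T′ < nE G ∸ k) same less
    attach : ∀ {e a b} → D e ≡ true → seen (src e) ≡ a → seen (tgt e) ≡ b → a ≢ b → Extension
    attach {e} {true} {true} _ _ _ differ = ⊥-elim (differ refl)
    attach {e} {false} {false} _ _ _ differ = ⊥-elim (differ refl)
    attach {e} {true} {false} e∈D a b _ = from e∈D (inj₂ refl) a λ q → true≢false (seen-intro (visited p (proj₂ (edge-visited p q)))) b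
    attach {e} {false} {true} e∈D a b _ = from e∈D (inj₁ refl) b λ q → true≢false (seen-intro (visited p (proj₁ (edge-visited p q)))) a
    search : Dec (∃ λ e → D e ≡ true × seen (src e) ≢ seen (tgt e)) → Extension
    search (yes (e , e∈D , differ)) = attach e∈D refl refl differ
    search (no none) = ⊥-elim (v-missed (seen-elim
      (trans (sym (connected seen const s v refl refl)) (seen-intro (visited p (inj₁ refl))))))
      where
      const : ∀ e → D e ≡ true → seen (src e) ≡ seen (tgt e)
      const e e∈D = decidable-stable (seen (src e) Bool.≟ seen (tgt e)) λ q → none (e , e∈D , q)

  spanning-trail : Fin (nV G) → ∃ Spanning
  spanning-trail v₀ = iterate (λ T → nE G ∸ size T) improve (trail (stop {u = v₀}) [] λ e ())
    where
    open DecMembership _≟_ using (_∈?_)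
    improve : ∀ T → Spanning T ⊎ ∃ λ T′ → nE G ∸ size T′ < nE G ∸ size T
    improve T@(trail {s} {t} {st} p unique inside) with s ≟ t
    ... | no q = inj₂ (extend-open T q)
    ... | yes refl = search (any? λ v → ¬? (v ∈? visits G s st))
      where
      search : Dec (∃ λ v → v ∉ visits G s st) → Spanning T ⊎ ∃ λ T′ → nE G ∸ size T′ < nE G ∸ length st
      search (yes (v , missed)) = inj₂ (extend-closed p unique inside v missed)
      search (no none) = inj₁ (refl , λ v → decidable-stable (v ∈? visits G s st) λ q → none (v , q))

  closed-trail : (f : Fin (nV G) → ℕ) → (∀ v → 1 ≤ f v) → (∀ v → deg D v ≤ 1 + 2 * f v) →
                 Fin (nV G) → SpanningClosedTrail G f
  closed-trail f pos bound v₀ = from (spanning-trail v₀)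
    where
    few : ∀ {s st} → WalkFrom G s st s → Inside (map proj₁ st) D → Unique (map proj₁ st) → ∀ v → timesMet G s st v ≤ f v
    -- The trivial trail visits its vertex once by convention, which the positivity of `f` allows.
    few {s} stop _ _ v = ≤-trans (≤-reflexive (times-∷ v s [])) (≤-trans (≤-reflexive (+-identityʳ _)) (≤-trans (ind≤1 _) (pos v)))
    -- More than `f v` visits would use at least `2 * f v + 2` edge ends at `v`, one more than the
    -- degree bound.
    few {s} walk@(go _ _ _) inside unique v = ≮⇒≥ λ many → 1+n≰n {1 + 2 * f v} (≤-trans
      (≤-trans (≤-reflexive (sym (*-distribˡ-+ 2 1 (f v)))) (*-monoʳ-≤ 2 many))
      (≤-trans (≤-reflexive (sym (+-cancelʳ-≡ (ind ⌊ s ≟ v ⌋) _ _ (walk-degree walk v))))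
        (≤-trans (total-≤ {D} (inc v) unique inside) (bound v))))
    from : ∃ Spanning → SpanningClosedTrail G f
    from (trail {s} {.s} {st} p unique inside , refl , spanning) = s , st , p , unique , spanning , few p inside unique

nonempty : ∀ {n} → 1 ≤ n → Fin n
nonempty (s≤s _) = zero

theorem7p1 : (G : Graph) → 1 ≤ nV G → (f : Fin (nV G) → ℕ) → ((v : Fin (nV G)) → 1 ≤ f v) →
    ((S : Subset (nV G)) → (r₁ r₂ : Fin (nV G) → Fin (nV G)) →
    IsComponentRep G 2 (∁ S) r₁ → IsComponentRep G 2 S r₂ →
    Ω G 2 (∁ S) r₁ ℤ.≤ sumS G S f ℤ.+ ℤ.+ 2 ℤ.+ Ω G 2 S r₂) →
    SpanningClosedTrail G f
theorem7p1 G n≥1 f pos tough = from-base (Toughness.bounded-base G f tough v₀)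
  where
  open Count (ends G)
  v₀ : Fin (nV G)
  v₀ = nonempty n≥1
  from-base : (∃ λ ((H , _) : Toughness.Base G f tough) → ∀ v → deg H v ≤ 1 + 2 * f v) → SpanningClosedTrail G f
  from-base ((H , sparse , base) , bounded) = from-trees (two-connections sparse base λ _ _ → refl)
    where
    from-trees : TwoConnections (ends G) H (λ _ → true) → SpanningClosedTrail G f
    from-trees (c , connects) = from-even (EvenSubgraph.even-subgraph G {H} {c} connects v₀)
      where
      from-even : (∃ λ D → EvenSubgraph.Between G {H} {c} connects D × (∀ x → odd (deg D x) ≡ false)) → SpanningClosedTrail G f
      from-even (D , (D⊑H , red) , even) = Trails.closed-trail G even connected f pos
        (λ v → ≤-trans (wt-mono {H = D} {H} D⊑H λ _ → ≤-refl) (bounded v)) v₀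
        where
        connected : Connects (ends G) (λ e → D e ≡ true) (λ _ → true)
        connected p const = connects true p λ e (h , q) → const e (red e h q)
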